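{- Let $\mathcal{R}$ be any relation on processes with $\simeq\;\subseteq\mathcal{R}\subseteq\;\approx$ (branching bisimilarity contained in $\mathcal{R}$, contained in weak bisimilarity). Then the following problem is undecidable: given a normed process algebra and two of its processes $P,Q$, decide whether $P\,\mathcal{R}\,Q$.
   Context: A process algebra (PA) is a triple $(\mathcal{C},\mathcal{A},\Delta)$: a finite set $\mathcal{C}$ of process constants, a finite set $\mathcal{A}$ of actions containing the silent action $\tau$, and a finite set $\Delta$ of rules $X\stackrel{\ell}{\longrightarrow}P$ with $X\in\mathcal{C}$. Processes are given by $P::=\epsilon\mid X\mid PP'\mid P\,\|\,P'$, where sequential composition is associative, parallel composition is associative and commutative, and $\epsilon P=P\epsilon=\epsilon\|P=P\|\epsilon=P$. Semantics: $X\stackrel{\ell}{\longrightarrow}P$ if the rule is in $\Delta$; if $P\stackrel{\ell}{\longrightarrow}P'$ then $PQ\stackrel{\ell}{\longrightarrow}P'Q$, $P\|Q\stackrel{\ell}{\longrightarrow}P'\|Q$ and $Q\|P\stackrel{\ell}{\longrightarrow}Q\|P'$. A process $P$ is normed if $P\stackrel{\ell_1}{\longrightarrow}\cdots\stackrel{\ell_m}{\longrightarrow}\epsilon$ for some actions; the PA is normed if all its processes are normed. Write $\Longrightarrow$ for the reflexive transitive closure of $\stackrel{\tau}{\longrightarrow}$, and $\stackrel{\widehat{\ell}}{\Longrightarrow}$ for $\Longrightarrow\stackrel{\ell}{\longrightarrow}\Longrightarrow$ if $\ell\neq\tau$ and for $\Longrightarrow$ if $\ell=\tau$. A relation $\mathcal{B}$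 is a weak bisimulation if whenever $P\mathcal{B}Q$ and $P\stackrel{\ell}{\longrightarrow}P'$ there is $Q'$ with $Q\stackrel{\widehat{\ell}}{\Longrightarrow}Q'$ and $P'\mathcal{B}Q'$, and symmetrically; $\approx$ is the largest weak bisimulation. A relation $\mathcal{B}$ is a branching bisimulation if whenever $P\mathcal{B}Q$ and $P\stackrel{\ell}{\longrightarrow}P'$, either (i) $Q\Longrightarrow Q''\stackrel{\ell}{\longrightarrow}Q'$ with $P\mathcal{B}Q''$ and $P'\mathcal{B}Q'$, or (ii) $\ell=\tau$ and $P'\mathcal{B}Q$; and symmetrically. $\simeq$ is the largest branching bisimulation. -}

module Defs where

open import Data.Fin.Base using (Fin; zero; suc; toℕ)
open import Data.List.Base using (List; []; _∷_)
open import Data.List.Membership.Propositional using (_∈_)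
open import Data.Nat.Base using (ℕ; zero; suc; _+_; _<_)
open import Data.Product.Base using (∃-syntax; Σ-syntax; _×_; _,_)
open import Data.Sum.Base using (_⊎_)
open import Data.Vec.Base using (Vec; []; _∷_; lookup)
open import Data.Vec.Relation.Binary.Pointwise.Inductive using (Pointwise)
open import Function.Base using (flip)
open import Level using (0ℓ) renaming (suc to lsuc)
open import Relation.Binary.Construct.Closure.ReflexiveTransitive using (Star)
open import Relation.Binary.Core using (Rel)
open import Relation.Binary.PropositionalEquality.Core using (_≡_)
open import Relation.Nullary.Negation.Core using (¬_)

infixr 7 _·_
infixr 6 _∥_
infix  4 _≅_

-- Process expressions over c constants.  A process is an expression
-- up to the congruence _≅_ below.

data Process (c : ℕ) : Set where
  ε   : Process c
  con : Fin c → Process c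
  _·_ : Process c → Process c → Process c
  _∥_ : Process c → Process c → Process c

data _≅_ {c : ℕ} : Rel (Process c) 0ℓ where
  ≅-refl  : ∀ {P} → P ≅ P
  ≅-sym   : ∀ {P Q} → P ≅ Q → Q ≅ P
  ≅-trans : ∀ {P Q R} → P ≅ Q → Q ≅ R → P ≅ R
  ·-cong  : ∀ {P P′ Q Q′} → P ≅ P′ → Q ≅ Q′ → P · Q ≅ P′ · Q′
  ∥-cong  : ∀ {P P′ Q Q′} → P ≅ P′ → Q ≅ Q′ → P ∥ Q ≅ P′ ∥ Q′
  ·-assoc : ∀ P Q R → (P · Q) · R ≅ P · (Q · R)
  ∥-assoc : ∀ P Q R → (P ∥ Q) ∥ R ≅ P ∥ (Q ∥ R)
  ∥-comm  : ∀ P Q → P ∥ Q ≅ Q ∥ P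
  ·-idˡ   : ∀ P → ε · P ≅ P
  ·-idʳ   : ∀ P → P · ε ≅ P
  ∥-idˡ   : ∀ P → ε ∥ P ≅ P
  ∥-idʳ   : ∀ P → P ∥ ε ≅ P

-- The actions are Fin (suc #visible), with the silent action at zero.
-- The list rules stands for the finite set of its elements.

record PA : Set where
  field
    #constants : ℕ
    #visible   : ℕ

  Constant : Set
  Constant = Fin #constants

  Action : Set
  Action = Fin (suc #visible)

  Proc : Set
  Proc = Process #constants

  field
    rules : List (Constant × Action × Proc)

open PA

τ : ∀ {k} → Fin (suc k)
τ = zero

infix 4 _⊢_⟶⟨_⟩_ _⊢_⟹_ _⊢_⟹⟨_⟩_ _⊢_≈_ _⊢_≃_

-- The constructor resp makes this a relation on processes up to _≅_.

data _⊢_⟶⟨_⟩_ (Γ : PA) : Proc Γ → Action Γ → Proc Γ → Set where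
  rule : ∀ {X ℓ P} → (X , ℓ , P) ∈ rules Γ → Γ ⊢ con X ⟶⟨ ℓ ⟩ P
  seq  : ∀ {P ℓ P′} Q → Γ ⊢ P ⟶⟨ ℓ ⟩ P′ → Γ ⊢ P · Q ⟶⟨ ℓ ⟩ P′ · Q
  parˡ : ∀ {P ℓ P′} Q → Γ ⊢ P ⟶⟨ ℓ ⟩ P′ → Γ ⊢ P ∥ Q ⟶⟨ ℓ ⟩ P′ ∥ Q
  parʳ : ∀ {P ℓ P′} Q → Γ ⊢ P ⟶⟨ ℓ ⟩ P′ → Γ ⊢ Q ∥ P ⟶⟨ ℓ ⟩ Q ∥ P′
  resp : ∀ {P P₁ ℓ Q₁ Q} →
         P ≅ P₁ → Γ ⊢ P₁ ⟶⟨ ℓ ⟩ Q₁ → Q₁ ≅ Q → Γ ⊢ P ⟶⟨ ℓ ⟩ Q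

-- Star is reflexive only up to _≡_, hence the trailing _≅_ here and
-- in _⊢_⟹_.

NormedProc : (Γ : PA) → Proc Γ → Set
NormedProc Γ P =
  ∃[ Q ] Star (λ P₁ P₂ → ∃[ ℓ ] Γ ⊢ P₁ ⟶⟨ ℓ ⟩ P₂) P Q × Q ≅ ε

Normed : PA → Set
Normed Γ = ∀ P → NormedProc Γ P

_⊢_⟹_ : (Γ : PA) → Rel (Proc Γ) 0ℓ
Γ ⊢ P ⟹ Q = ∃[ P′ ] Star (λ P₁ P₂ → Γ ⊢ P₁ ⟶⟨ τ ⟩ P₂) P P′ × P′ ≅ Q

_⊢_⟹⟨_⟩_ : (Γ : PA) → Proc Γ → Action Γ → Proc Γ → Set
Γ ⊢ P ⟹⟨ zero ⟩      Q = Γ ⊢ P ⟹ Q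
Γ ⊢ P ⟹⟨ ℓ@(suc _) ⟩ Q =
  ∃[ P₁ ] ∃[ P₂ ] (Γ ⊢ P ⟹ P₁) × (Γ ⊢ P₁ ⟶⟨ ℓ ⟩ P₂) × (Γ ⊢ P₂ ⟹ Q)

WeakSimulation : (Γ : PA) → Rel (Proc Γ) 0ℓ → Set
WeakSimulation Γ B = ∀ {P Q ℓ P′} → B P Q → Γ ⊢ P ⟶⟨ ℓ ⟩ P′ →
  ∃[ Q′ ] (Γ ⊢ Q ⟹⟨ ℓ ⟩ Q′) × B P′ Q′

WeakBisimulation : (Γ : PA) → Rel (Proc Γ) 0ℓ → Set
WeakBisimulation Γ B = WeakSimulation Γ B × WeakSimulation Γ (flip B)

BranchingSimulation : (Γ : PA) → Rel (Proc Γ) 0ℓ → Set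
BranchingSimulation Γ B = ∀ {P Q ℓ P′} → B P Q → Γ ⊢ P ⟶⟨ ℓ ⟩ P′ →
  (∃[ Q″ ] ∃[ Q′ ]
     (Γ ⊢ Q ⟹ Q″) × (Γ ⊢ Q″ ⟶⟨ ℓ ⟩ Q′) × B P Q″ × B P′ Q′)
  ⊎ (ℓ ≡ τ × B P′ Q)

BranchingBisimulation : (Γ : PA) → Rel (Proc Γ) 0ℓ → Set
BranchingBisimulation Γ B =
  BranchingSimulation Γ B × BranchingSimulation Γ (flip B)

-- The largest bisimulation is the union of all bisimulations.

_⊢_≈_ : (Γ : PA) → Rel (Proc Γ) (lsuc 0ℓ)
Γ ⊢ P ≈ Q = Σ[ B ∈ Rel (Proc Γ) 0ℓ ] WeakBisimulation Γ B × B P Q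

_⊢_≃_ : (Γ : PA) → Rel (Proc Γ) (lsuc 0ℓ)
Γ ⊢ P ≃ Q = Σ[ B ∈ Rel (Proc Γ) 0ℓ ] BranchingBisimulation Γ B × B P Q

-- Kleene's μ-recursive functions, as the model of computation.

data Rec : ℕ → Set where
  zeroᴿ : Rec 0
  sucᴿ  : Rec 1
  proj  : ∀ {n} → Fin n → Rec n
  comp  : ∀ {m n} → Rec m → Vec (Rec n) m → Rec n
  prec  : ∀ {n} → Rec n → Rec (suc (suc n)) → Rec (suc n)
  mu    : ∀ {n} → Rec (suc n) → Rec n

infix 4 _[_]⇓_

-- f [ xs ]⇓ y : the partial function f is defined at xs with value y.

data _[_]⇓_ : ∀ {n} → Rec n → Vec ℕ n → ℕ → Set where
  zeroᴿ : zeroᴿ [ [] ]⇓ 0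
  sucᴿ  : ∀ {x} → sucᴿ [ x ∷ [] ]⇓ suc x
  proj  : ∀ {n} (i : Fin n) {xs} → proj i [ xs ]⇓ lookup xs i
  comp  : ∀ {m n} {f : Rec m} {gs : Vec (Rec n) m} {xs ys z} →
          Pointwise (λ g y → g [ xs ]⇓ y) gs ys → f [ ys ]⇓ z →
          comp f gs [ xs ]⇓ z
  prec₀ : ∀ {n} {f : Rec n} {g xs y} →
          f [ xs ]⇓ y → prec f g [ 0 ∷ xs ]⇓ y
  precₛ : ∀ {n} {f : Rec n} {g k xs y z} →
          prec f g [ k ∷ xs ]⇓ y → g [ k ∷ y ∷ xs ]⇓ z →
          prec f g [ suc k ∷ xs ]⇓ z
  mu    : ∀ {n} {f : Rec (suc n)} {xs y} →
          f [ y ∷ xs ]⇓ 0 →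
          (∀ i → i < y → ∃[ v ] f [ i ∷ xs ]⇓ suc v) →
          mu f [ xs ]⇓ y

-- f computes the characteristic function of the problem Yes, whose
-- instances are given to f by their codes.  Nothing is asked of f on
-- numbers that code no instance.

Decides : ∀ {ℓ} {Instance : Set} → Rec 1 → (Instance → ℕ) → (Instance → Set ℓ) →
          Set ℓ
Decides f code Yes = ∀ i →
  (Yes i → f [ code i ∷ [] ]⇓ 1) × (¬ Yes i → f [ code i ∷ [] ]⇓ 0)

Undecidable : ∀ {ℓ} {Instance : Set} → (Instance → ℕ) → (Instance → Set ℓ) → Set ℓ
Undecidable code Yes = ¬ (∃[ f ] Decides f code Yes)

triangle : ℕ → ℕ
triangle zero    = 0
triangle (suc n) = suc n + triangle n

-- Cantor's bijection ℕ × ℕ → ℕ.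

pair : ℕ → ℕ → ℕ
pair m n = triangle (m + n) + n

codeList : ∀ {A : Set} → (A → ℕ) → List A → ℕ
codeList code []       = 0
codeList code (x ∷ xs) = suc (pair (code x) (codeList code xs))

codeProcess : ∀ {c} → Process c → ℕ
codeProcess ε       = pair 0 0
codeProcess (con X) = pair 1 (toℕ X)
codeProcess (P · Q) = pair 2 (pair (codeProcess P) (codeProcess Q))
codeProcess (P ∥ Q) = pair 3 (pair (codeProcess P) (codeProcess Q))

codePA : PA → ℕ
codePA Γ = pair (#constants Γ) (pair (#visible Γ) (codeList codeRule (rules Γ)))
  where
  codeRule : Constant Γ × Action Γ × Proc Γ → ℕ
  codeRule (X , ℓ , P) = pair (toℕ X) (pair (toℕ ℓ) (codeProcess P))

record Instance : Set where
  field
    Γ      : PA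
    normed : Normed Γ
    P Q    : Proc Γ

codeInstance : Instance → ℕ
codeInstance i = pair (codePA Γ) (pair (codeProcess P) (codeProcess Q))
  where open Instance i

{-# OPTIONS --safe #-}
-- Accepting runs of a register machine are encoded as in Post's
-- correspondence problem: a list of tiles is a run if, on every track, the
-- initial configuration followed by what the tiles write equals what they
-- read followed by the final configuration.
--
-- TV can silently build, and then freeze below the symbol K, any stack that
-- lists some tiles together with all that they write; TU can freeze only
-- stacks on which, for some track, the listed tiles do not read what is
-- written.  Every letter can be emitted or silently erased.  Once the control
-- process has become C r, which can always perform the letters outside
-- channel r, two frozen stacks are equivalent exactly if their projections
-- to channel r are equal.  As long as TU, TV, T or D is present, whatever it
-- can spawn can also be silently erased, so that all these states reach each
-- other by silent steps and are branching bisimilar; D, into which C r can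
-- turn, lets every process terminate without giving anything away.  Hence TV
-- and TU are branching bisimilar if every stack of TV has a counterpart in TU,
-- that is, if there is no accepting run, and are not even weakly bisimilar
-- otherwise.
--
-- Given a decision procedure f, take the machine that runs f on the code of
-- the instance built from this very machine and accepts if f answers yes.

module Submission where

open import Defs
open import Data.Bool.Base using (Bool; true; false)
open import Data.Empty using (⊥-elim; ⊥)
open import Data.Fin.Base using (Fin; zero; suc; toℕ; fromℕ<)
import Data.Fin.Properties as Fin
open import Data.Fin.Properties using (suc-injective)
open import Data.List.Base using
  (List; []; _∷_; _++_; map; filter; concatMap; length; lookup; allFin; replicate)
open import Data.List.Membership.Propositional using (_∈_; find; lose)
open import Data.List.Membership.Propositional.Properties using
  (∈-map⁺; ∈-map⁻; ∈-++⁺ˡ; ∈-++⁺ʳ; ∈-++⁻; ∈-concatMap⁺; ∈-concatMap⁻; ∈-allFin; ∈-filter⁺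
  ; ∈-filter⁻)
open import Data.List.Properties using
  (filter-accept; filter-reject; map-++; ++-assoc; ++-identityʳ; ∷-injective; ∷-injectiveˡ
  ; ∷-injectiveʳ; ∷ʳ-injectiveˡ; ∷ʳ-injectiveʳ; length-replicate; ++-cancelʳ; ++-cancelˡ
  ; map-injective)
open import Data.List.Relation.Binary.Sublist.Propositional using
  (_⊆_; _∷_; _∷ʳ_; minimum; ⊆-refl; ⊆-trans; ⊆-antisym)
open import Data.List.Relation.Unary.All as All using (All; []; _∷_)
open import Data.List.Relation.Unary.All.Properties using () renaming (++⁺ to All-++⁺)
open import Data.List.Relation.Unary.AllPairs using ([]; _∷_)
open import Data.List.Relation.Unary.Any as Any using (Any; here; there)
open import Data.List.Relation.Unary.Any.Properties using (lookup-index)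
open import Data.List.Relation.Unary.Unique.Propositional using (Unique)
open import Data.List.Relation.Unary.Unique.Propositional.Properties using
  () renaming (allFin⁺ to allFin-unique; map⁺ to map-unique)
import Data.Maybe.Base as Maybe
open import Data.Maybe.Base using (Maybe; just; nothing)
open import Data.Nat.Base using (ℕ; _+_; zero; suc; _<_; _≤_; _⊔_; pred; z≤n; s≤s)
import Data.Nat.Properties as ℕ
open import Data.Product.Base using (∃-syntax; _×_; _,_; proj₁; proj₂)
open import Data.Sum.Base using (_⊎_; inj₁; inj₂; reduce; [_,_]′)
open import Data.Unit.Base using (⊤; tt)
open import Data.Vec.Base as Vec using (Vec; []; _∷_)
open import Data.Vec.Properties using (lookup-map)
open import Data.Vec.Relation.Binary.Pointwise.Inductive using (Pointwise; []; _∷_)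
import Data.Vec.Relation.Unary.All as Allᵛ
open import Data.Vec.Relation.Unary.All using ([]; _∷_) renaming (All to Allᵛ)
open import Data.Vec.Relation.Unary.All.Properties using (lookup⁺)
open import Function.Base using (flip)
open import Level using (Level)
open import Relation.Binary.Construct.Closure.ReflexiveTransitive using
  (Star; _◅_; _◅◅_) renaming (ε to [])
open import Relation.Binary.Core using (Rel; _⇒_)
open import Relation.Binary.Definitions using (DecidableEquality)
open import Relation.Binary.PropositionalEquality using
  (_≡_; _≢_; refl; sym; trans; cong; cong₂; subst; subst₂; module ≡-Reasoning)
open import Relation.Nullary.Decidable using (yes; no; ¬?)

open PA using (Proc; Action; rules)

-- A finite-state grammar cannot check a whole run, but the failure to be one shows at a single
-- position of a single track, and a grammar can guess that position. Hence `TU` is given the faulty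
-- stacks, and a run appears as a stack of `TV` without counterpart. Comparing channel by channel is
-- what brings in Post's problem: only the order within a channel counts, so a stack of `TV` may set
-- each tile beside what it writes, while a stack of `TU` sets the same tiles, up to the error,
-- beside what they read. The channel is chosen after freezing, so one frozen stack has to agree on
-- all channels at once.
--
-- Nonterminating machines never arise. A decision procedure halts with 0 or 1 once the status of
-- the instance is known, so the machine reaches its final state, and solvability of the tiling is
-- carried along that run in both directions. Comparing the last configuration with the accepting
-- one then settles whether an accepting run exists.

-- Inverting transitions modulo the congruence.

data Null {c : ℕ} : Process c → Set where
  ε   : Null ε
  _·_ : ∀ {P Q} → Null P → Null Q → Null (P · Q)
  _∥_ : ∀ {P Q} → Null P → Null Q → Null (P ∥ Q)

Null-resp : ∀ {c} {P Q : Process c} → P ≅ Q → (Null P → Null Q) × (Null Q → Null P)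
Null-resp ≅-refl = (λ n → n) , (λ n → n)
Null-resp (≅-sym e) = proj₂ (Null-resp e) , proj₁ (Null-resp e)
Null-resp (≅-trans e f) =
  (λ n → proj₁ (Null-resp f) (proj₁ (Null-resp e) n)) ,
  (λ n → proj₂ (Null-resp e) (proj₂ (Null-resp f) n))
Null-resp (·-cong e f) =
  (λ { (m · n) → proj₁ (Null-resp e) m · proj₁ (Null-resp f) n }) ,
  (λ { (m · n) → proj₂ (Null-resp e) m · proj₂ (Null-resp f) n })
Null-resp (∥-cong e f) =
  (λ { (m ∥ n) → proj₁ (Null-resp e) m ∥ proj₁ (Null-resp f) n }) ,
  (λ { (m ∥ n) → proj₂ (Null-resp e) m ∥ proj₂ (Null-resp f) n })
Null-resp (·-assoc P Q R) = (λ { ((k · m) · n) → k · (m · n) }) , (λ { (k · (m · n)) → (k · m) · n })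
Null-resp (∥-assoc P Q R) = (λ { ((k ∥ m) ∥ n) → k ∥ (m ∥ n) }) , (λ { (k ∥ (m ∥ n)) → (k ∥ m) ∥ n })
Null-resp (∥-comm P Q) = (λ { (m ∥ n) → n ∥ m }) , (λ { (m ∥ n) → n ∥ m })
Null-resp (·-idˡ P) = (λ { (_ · n) → n }) , (ε ·_)
Null-resp (·-idʳ P) = (λ { (n · _) → n }) , (_· ε)
Null-resp (∥-idˡ P) = (λ { (_ ∥ n) → n }) , (ε ∥_)
Null-resp (∥-idʳ P) = (λ { (n ∥ _) → n }) , (_∥ ε)

Null⇒≅ε : ∀ {c} {P : Process c} → Null P → P ≅ ε
Null⇒≅ε ε = ≅-refl
Null⇒≅ε (m · n) = ≅-trans (·-cong (Null⇒≅ε m) (Null⇒≅ε n)) (·-idˡ ε)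
Null⇒≅ε (m ∥ n) = ≅-trans (∥-cong (Null⇒≅ε m) (Null⇒≅ε n)) (∥-idˡ ε)

infix 4 _⊢_↦⟨_⟩_

-- The transitions that can be inverted on the syntax: ≅ is replaced by
-- the rule seqʳ, and recovered in step-inv.

data _⊢_↦⟨_⟩_ (Γ : PA) : Proc Γ → Action Γ → Proc Γ → Set where
  rule : ∀ {X ℓ P} → (X , ℓ , P) ∈ rules Γ → Γ ⊢ con X ↦⟨ ℓ ⟩ P
  seqˡ : ∀ {P ℓ P′ Q} → Γ ⊢ P ↦⟨ ℓ ⟩ P′ → Γ ⊢ P · Q ↦⟨ ℓ ⟩ P′ · Q
  seqʳ : ∀ {P Q ℓ Q′} → Null P → Γ ⊢ Q ↦⟨ ℓ ⟩ Q′ → Γ ⊢ P · Q ↦⟨ ℓ ⟩ Q′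
  parˡ : ∀ {P ℓ P′ Q} → Γ ⊢ P ↦⟨ ℓ ⟩ P′ → Γ ⊢ P ∥ Q ↦⟨ ℓ ⟩ P′ ∥ Q
  parʳ : ∀ {P Q ℓ Q′} → Γ ⊢ Q ↦⟨ ℓ ⟩ Q′ → Γ ⊢ P ∥ Q ↦⟨ ℓ ⟩ P ∥ Q′

module _ {Γ : PA} where

  ↦⇒⟶ : ∀ {P ℓ P′} → Γ ⊢ P ↦⟨ ℓ ⟩ P′ → Γ ⊢ P ⟶⟨ ℓ ⟩ P′
  ↦⇒⟶ (rule r) = rule r
  ↦⇒⟶ (seqˡ p) = seq _ (↦⇒⟶ p)
  ↦⇒⟶ (seqʳ n p) = resp (≅-trans (·-cong (Null⇒≅ε n) ≅-refl) (·-idˡ _)) (↦⇒⟶ p) ≅-refl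
  ↦⇒⟶ (parˡ p) = parˡ _ (↦⇒⟶ p)
  ↦⇒⟶ (parʳ p) = parʳ _ (↦⇒⟶ p)

  Matches : Proc Γ → Proc Γ → Set
  Matches P Q = ∀ {ℓ P′} → Γ ⊢ P ↦⟨ ℓ ⟩ P′ → ∃[ Q′ ] (Γ ⊢ Q ↦⟨ ℓ ⟩ Q′) × P′ ≅ Q′

  Null-stuck : ∀ {P ℓ P′} {A : Set} → Null P → Γ ⊢ P ↦⟨ ℓ ⟩ P′ → A
  Null-stuck (m · n) (seqˡ p) = Null-stuck m p
  Null-stuck (m · n) (seqʳ _ p) = Null-stuck n p
  Null-stuck (m ∥ n) (parˡ p) = Null-stuck m p
  Null-stuck (m ∥ n) (parʳ p) = Null-stuck n p

  -- Both directions share one induction, since `≅-sym` exchanges them.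
  ≅-matches : ∀ {P Q} → P ≅ Q → Matches P Q × Matches Q P
  ≅-matches ≅-refl = (λ p → _ , p , ≅-refl) , (λ p → _ , p , ≅-refl)
  ≅-matches (≅-sym e) = proj₂ (≅-matches e) , proj₁ (≅-matches e)
  ≅-matches {P} {Q} (≅-trans {Q = R} e f) =
    compose (proj₁ (≅-matches e)) (proj₁ (≅-matches f)) ,
    compose (proj₂ (≅-matches f)) (proj₂ (≅-matches e))
    where
    compose : ∀ {P Q R} → Matches P Q → Matches Q R → Matches P R
    compose m n p with m p
    ... | _ , q , e₁ with n q
    ... | _ , r , e₂ = _ , r , ≅-trans e₁ e₂
  ≅-matches (·-cong e f) =
    go e f (proj₁ (≅-matches e)) (proj₁ (≅-matches f)) ,
    go (≅-sym e) (≅-sym f) (proj₂ (≅-matches e)) (proj₂ (≅-matches f))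
    where
    go : ∀ {P P₁ Q Q₁} → P ≅ P₁ → Q ≅ Q₁ → Matches P P₁ → Matches Q Q₁ → Matches (P · Q) (P₁ · Q₁)
    go e f m n (seqˡ p) with m p
    ... | _ , q , e₁ = _ , seqˡ q , ·-cong e₁ f
    go e f m n (seqʳ z p) with n p
    ... | _ , q , e₁ = _ , seqʳ (proj₁ (Null-resp e) z) q , e₁
  ≅-matches (∥-cong e f) =
    go e f (proj₁ (≅-matches e)) (proj₁ (≅-matches f)) ,
    go (≅-sym e) (≅-sym f) (proj₂ (≅-matches e)) (proj₂ (≅-matches f))
    where
    go : ∀ {P P₁ Q Q₁} → P ≅ P₁ → Q ≅ Q₁ → Matches P P₁ → Matches Q Q₁ → Matches (P ∥ Q) (P₁ ∥ Q₁)
    go e f m n (parˡ p) with m p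
    ... | _ , q , e₁ = _ , parˡ q , ∥-cong e₁ f
    go e f m n (parʳ p) with n p
    ... | _ , q , e₁ = _ , parʳ q , ∥-cong e e₁
  ≅-matches (·-assoc P Q R) =
    (λ { (seqˡ (seqˡ p)) → _ , seqˡ p , ·-assoc _ _ _
       ; (seqˡ (seqʳ n p)) → _ , seqʳ n (seqˡ p) , ≅-refl
       ; (seqʳ (m · n) p) → _ , seqʳ m (seqʳ n p) , ≅-refl }) ,
    (λ { (seqˡ p) → _ , seqˡ (seqˡ p) , ≅-sym (·-assoc _ _ _)
       ; (seqʳ m (seqˡ p)) → _ , seqˡ (seqʳ m p) , ≅-refl
       ; (seqʳ m (seqʳ n p)) → _ , seqʳ (m · n) p , ≅-refl })
  ≅-matches (∥-assoc P Q R) =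
    (λ { (parˡ (parˡ p)) → _ , parˡ p , ∥-assoc _ _ _
       ; (parˡ (parʳ p)) → _ , parʳ (parˡ p) , ∥-assoc _ _ _
       ; (parʳ p) → _ , parʳ (parʳ p) , ∥-assoc _ _ _ }) ,
    (λ { (parˡ p) → _ , parˡ (parˡ p) , ≅-sym (∥-assoc _ _ _)
       ; (parʳ (parˡ p)) → _ , parˡ (parʳ p) , ≅-sym (∥-assoc _ _ _)
       ; (parʳ (parʳ p)) → _ , parʳ p , ≅-sym (∥-assoc _ _ _) })
  ≅-matches (∥-comm P Q) =
    (λ { (parˡ p) → _ , parʳ p , ∥-comm _ _ ; (parʳ p) → _ , parˡ p , ∥-comm _ _ }) ,
    (λ { (parˡ p) → _ , parʳ p , ∥-comm _ _ ; (parʳ p) → _ , parˡ p , ∥-comm _ _ })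
  ≅-matches (·-idˡ P) =
    (λ { (seqʳ _ p) → _ , p , ≅-refl }) , (λ p → _ , seqʳ ε p , ≅-refl)
  ≅-matches (·-idʳ P) =
    (λ { (seqˡ p) → _ , p , ·-idʳ _ }) , (λ p → _ , seqˡ p , ≅-sym (·-idʳ _))
  ≅-matches (∥-idˡ P) =
    (λ { (parʳ p) → _ , p , ∥-idˡ _ }) , (λ p → _ , parʳ p , ≅-sym (∥-idˡ _))
  ≅-matches (∥-idʳ P) =
    (λ { (parˡ p) → _ , p , ∥-idʳ _ }) , (λ p → _ , parˡ p , ≅-sym (∥-idʳ _))

  step-inv : ∀ {P Q ℓ P′} → P ≅ Q → Γ ⊢ P ⟶⟨ ℓ ⟩ P′ → ∃[ Q′ ] (Γ ⊢ Q ↦⟨ ℓ ⟩ Q′) × P′ ≅ Q′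
  step-inv e p with ⟶⇒↦ p
    where
    ⟶⇒↦ : ∀ {P ℓ P′} → Γ ⊢ P ⟶⟨ ℓ ⟩ P′ → ∃[ Q′ ] (Γ ⊢ P ↦⟨ ℓ ⟩ Q′) × P′ ≅ Q′
    ⟶⇒↦ (rule r) = _ , rule r , ≅-refl
    ⟶⇒↦ (seq Q p) with ⟶⇒↦ p
    ... | _ , q , e = _ , seqˡ q , ·-cong e ≅-refl
    ⟶⇒↦ (parˡ Q p) with ⟶⇒↦ p
    ... | _ , q , e = _ , parˡ q , ∥-cong e ≅-refl
    ⟶⇒↦ (parʳ Q p) with ⟶⇒↦ p
    ... | _ , q , e = _ , parʳ q , ∥-cong ≅-refl e
    ⟶⇒↦ (resp e p f) with ⟶⇒↦ p
    ... | _ , q , e₁ with proj₂ (≅-matches e) q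
    ... | _ , q₁ , e₂ = _ , q₁ , ≅-trans (≅-sym f) (≅-trans e₁ e₂)
  ... | _ , q , e₁ with proj₁ (≅-matches e) q
  ... | _ , q₁ , e₂ = _ , q₁ , ≅-trans e₁ e₂

  infix 4 _⟶τ*_
  _⟶τ*_ : Proc Γ → Proc Γ → Set
  _⟶τ*_ = Star (λ P Q → Γ ⊢ P ⟶⟨ τ ⟩ Q)

  ⟹-refl : ∀ {P Q} → P ≅ Q → Γ ⊢ P ⟹ Q
  ⟹-refl e = _ , [] , e

  ⟹-step : ∀ {P Q R} → Γ ⊢ P ⟶⟨ τ ⟩ Q → Γ ⊢ Q ⟹ R → Γ ⊢ P ⟹ R
  ⟹-step p (_ , ps , e) = _ , p ◅ ps , e

  ⟹-respˡ : ∀ {P Q R} → P ≅ Q → Γ ⊢ Q ⟹ R → Γ ⊢ P ⟹ R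
  ⟹-respˡ e (_ , [] , f) = _ , [] , ≅-trans e f
  ⟹-respˡ e (_ , p ◅ ps , f) = _ , resp e p ≅-refl ◅ ps , f

  ⟹-trans : ∀ {P Q R} → Γ ⊢ P ⟹ Q → Γ ⊢ Q ⟹ R → Γ ⊢ P ⟹ R
  ⟹-trans (_ , ps , e) q with ⟹-respˡ e q
  ... | _ , qs , f = _ , ps ◅◅ qs , f

  ⟹-map : ∀ {P Q} (F : Proc Γ → Proc Γ) → (∀ {X Y} → Γ ⊢ X ⟶⟨ τ ⟩ Y → Γ ⊢ F X ⟶⟨ τ ⟩ F Y) →
           (∀ {X Y} → X ≅ Y → F X ≅ F Y) → Γ ⊢ P ⟹ Q → Γ ⊢ F P ⟹ F Q
  ⟹-map F s c (_ , [] , e) = _ , [] , c e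
  ⟹-map F s c (_ , p ◅ ps , e) = ⟹-step (s p) (⟹-map F s c (_ , ps , e))

  ⟹-∥ˡ : ∀ {P Q} R → Γ ⊢ P ⟹ Q → Γ ⊢ P ∥ R ⟹ Q ∥ R
  ⟹-∥ˡ R = ⟹-map (_∥ R) (parˡ R) (λ e → ∥-cong e ≅-refl)

-- The process algebra of a grammar.

-- A left-linear grammar: the nonterminal sits at the left end, the top of the stack, and each
-- production inserts letters right below it. `u₀-grow` lets `u₀` derive every word.
record Grammar : Set₁ where
  infix 4 _≟_
  field
    Letter Chan Nt : Set
    letters        : List Letter
    letter∈        : ∀ x → x ∈ letters
    chans          : List Chan
    chan∈          : ∀ r → r ∈ chans
    _≟_            : DecidableEquality Chan
    r₀             : Chan
    nts            : List Nt
    nt∈            : ∀ g → g ∈ nts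
    channel        : Letter → Chan
    prods          : Nt → List (Maybe Nt × List Letter)
    finals         : Nt → List (List Letter)
    u₀ v₀          : Nt
    u₀-grow        : ∀ x → (just u₀ , x ∷ []) ∈ prods u₀

module Construction (G : Grammar) where

  open Grammar G

  π : Chan → List Letter → List Letter
  π r = filter (λ x → channel x ≟ r)

  -- A stack built by the grammar is topped by a nonterminal; firing a final
  -- rule replaces the nonterminal by K.  The nonterminal nothing is the only
  -- one with a rule that depends on the input of the machine.

  data Ctl : Set where
    TU TV T D : Ctl
    C         : Chan → Ctl

  data Stk : Set where
    H K : Stk
    nt  : Maybe Nt → Stk
    ltr : Letter → Stk

  data Const : Set where
    ctl : Ctl → Const
    stk : Stk → Const

  -- The order matters: the constants that occur in the input rule or are compared in the instance
  -- come first, so that their numbers are known without knowing the machine.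
  consts : List Const
  consts =
    ctl TU ∷ ctl TV ∷ stk K ∷ stk (nt nothing) ∷ map (λ x → stk (ltr x)) letters ++
    ctl T ∷ ctl D ∷ stk H ∷ map (λ g → stk (nt (just g))) nts ++ map (λ r → ctl (C r)) chans

  const∈ : ∀ a → a ∈ consts
  const∈ (ctl TU) = here refl
  const∈ (ctl TV) = there (here refl)
  const∈ (stk K) = there (there (here refl))
  const∈ (stk (nt nothing)) = there (there (there (here refl)))
  const∈ (stk (ltr x)) = there (there (there (there (∈-++⁺ˡ (∈-map⁺ _ (letter∈ x))))))
  const∈ (ctl T) = there (there (there (there (∈-++⁺ʳ (map _ letters) (here refl)))))
  const∈ (ctl D) = there (there (there (there (∈-++⁺ʳ (map _ letters) (there (here refl))))))
  const∈ (stk H) = there (there (there (there (∈-++⁺ʳ (map _ letters) (there (there (here refl)))))))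
  const∈ (stk (nt (just g))) =
    there (there (there (there (∈-++⁺ʳ (map _ letters) (there (there (there (∈-++⁺ˡ (∈-map⁺ _ (nt∈ g))))))))))
  const∈ (ctl (C r)) =
    there (there (there (there (∈-++⁺ʳ (map _ letters) (there (there (there (∈-++⁺ʳ (map _ nts) (∈-map⁺ _ (chan∈ r))))))))))

  opaque
    N : ℕ
    N = length consts

    enc : Const → Fin N
    enc a = Any.index (const∈ a)

    dec : Fin N → Const
    dec = lookup consts

    dec-enc : ∀ a → dec (enc a) ≡ a
    dec-enc a = sym (lookup-index (const∈ a))

  index-++⁺ˡ : ∀ {A : Set} {x : A} {xs ys} (m : x ∈ xs) →
               toℕ (Any.index (∈-++⁺ˡ {ys = ys} m)) ≡ toℕ (Any.index m)
  index-++⁺ˡ (here _)  = refl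
  index-++⁺ˡ (there m) = cong suc (index-++⁺ˡ m)

  index-map⁺ : ∀ {A B : Set} (f : A → B) {x xs} (m : x ∈ xs) →
               toℕ (Any.index (∈-map⁺ f m)) ≡ toℕ (Any.index m)
  index-map⁺ f (here refl) = refl
  index-map⁺ f (there m)   = cong suc (index-map⁺ f m)

  opaque
    unfolding enc

    toℕ-TU : toℕ (enc (ctl TU)) ≡ 0
    toℕ-TU = refl

    toℕ-TV : toℕ (enc (ctl TV)) ≡ 1
    toℕ-TV = refl

    toℕ-K : toℕ (enc (stk K)) ≡ 2
    toℕ-K = refl

    toℕ-nothing : toℕ (enc (stk (nt nothing))) ≡ 3
    toℕ-nothing = refl

    toℕ-ltr : ∀ x → toℕ (enc (stk (ltr x))) ≡ 4 + toℕ (Any.index (letter∈ x))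
    toℕ-ltr x =
      cong (4 +_) (trans (index-++⁺ˡ (∈-map⁺ (λ x → stk (ltr x)) (letter∈ x))) (index-map⁺ _ (letter∈ x)))

  -- Visible actions are named after constants, so that one number `N` counts both.
  data Lab : Set where
    silent : Lab
    vis    : Const → Lab

  ⌜_⌝ : Lab → Fin (suc N)
  ⌜ silent ⌝ = zero
  ⌜ vis a ⌝  = suc (enc a)

  ⌜⌝-injective : ∀ {l k} → ⌜ l ⌝ ≡ ⌜ k ⌝ → l ≡ k
  ⌜⌝-injective {silent} {silent} e = refl
  ⌜⌝-injective {vis a} {vis b} e =
    cong vis (trans (sym (dec-enc a)) (trans (cong dec (suc-injective e)) (dec-enc b)))

  Pr : Set
  Pr = Process N

  ⟦_⟧ : List Stk → Pr
  ⟦ [] ⟧    = ε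
  ⟦ a ∷ v ⟧ = con (enc (stk a)) · ⟦ v ⟧

  ctlP : Ctl → Pr
  ctlP c = con (enc (ctl c))

  stks : List Stk
  stks = H ∷ K ∷ nt nothing ∷ map (λ g → nt (just g)) nts ++ map ltr letters

  stk∈ : ∀ a → a ∈ stks
  stk∈ H = here refl
  stk∈ K = there (here refl)
  stk∈ (nt nothing) = there (there (here refl))
  stk∈ (nt (just g)) = there (there (there (∈-++⁺ˡ (∈-map⁺ _ (nt∈ g)))))
  stk∈ (ltr x) = there (there (there (∈-++⁺ʳ (map _ nts) (∈-map⁺ _ (letter∈ x)))))

  -- Freezing is announced by the action named after `TU`. No control process ever moves to `TU`, so
  -- this action betrays a freezing.
  stkRules : Stk → List (Lab × List Stk)
  stkRules H = (silent , []) ∷ map (λ a → silent , H ∷ a ∷ []) stks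
  stkRules K = (silent , []) ∷ (vis (stk K) , []) ∷ []
  stkRules (nt nothing) = (silent , []) ∷ []
  stkRules (nt (just g)) =
    (silent , []) ∷ map (λ (g′ , w) → silent , nt g′ ∷ map ltr w) (prods g) ++
    map (λ w → vis (ctl TU) , K ∷ map ltr w) (finals g)
  stkRules (ltr x) = (silent , []) ∷ (vis (stk (ltr x)) , []) ∷ []

  data Spawn : Ctl → Stk → Set where
    TU-u : Spawn TU (nt (just u₀))
    TV-u : Spawn TV (nt (just u₀))
    TV-v : Spawn TV (nt (just v₀))
    T-u  : Spawn T (nt (just u₀))
    T-v  : Spawn T (nt (just v₀))
    D-H  : Spawn D H

  spawning : Ctl → Stk → Lab × Pr
  spawning c a = silent , ctlP c ∥ ⟦ a ∷ [] ⟧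

  ctlRules : Ctl → List (Lab × Pr)
  ctlRules TU = spawning TU (nt (just u₀)) ∷ (vis (ctl T) , ctlP T) ∷ []
  ctlRules TV = spawning TV (nt (just u₀)) ∷ spawning TV (nt (just v₀)) ∷ (vis (ctl T) , ctlP T) ∷ []
  ctlRules T =
    spawning T (nt (just u₀)) ∷ spawning T (nt (just v₀)) ∷
    map (λ r → vis (ctl (C r)) , ctlP (C r)) chans
  ctlRules D = spawning D H ∷ (vis (ctl D) , ε) ∷ []
  ctlRules (C r) =
    (vis (ctl D) , ctlP D) ∷
    map (λ x → vis (stk (ltr x)) , ctlP (C r)) (filter (λ x → ¬? (channel x ≟ r)) letters)

  constRules : Const → List (Lab × Pr)
  constRules (ctl c) = ctlRules c
  constRules (stk a) = map (λ (l , v) → l , ⟦ v ⟧) (stkRules a)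

  -- Rules are attached to every number and not only to the values of `enc`: a constant that is
  -- listed twice has a second number, and that process must be normed too.
  rulesAt : Fin N → List (Fin N × Fin (suc N) × Pr)
  rulesAt i = map (λ (l , P) → i , ⌜ l ⌝ , P) (constRules (dec i))

  fixedRules : List (Fin N × Fin (suc N) × Pr)
  fixedRules = concatMap rulesAt (allFin N)

  data Deriv (g : Nt) : Maybe Nt → List Letter → Set where
    start : Deriv g (just g) []
    step  : ∀ {g₁ g₂ w v} → Deriv g (just g₁) w → (g₂ , v) ∈ prods g₁ → Deriv g g₂ (v ++ w)

  u₀-any : ∀ w → Deriv u₀ (just u₀) w
  u₀-any [] = start
  u₀-any (x ∷ w) = step (u₀-any w) (u₀-grow x)

  ⟦⟧-++ : ∀ u v → ⟦ u ⟧ · ⟦ v ⟧ ≅ ⟦ u ++ v ⟧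
  ⟦⟧-++ [] v = ·-idˡ _
  ⟦⟧-++ (a ∷ u) v = ≅-trans (·-assoc _ _ _) (·-cong ≅-refl (⟦⟧-++ u v))

  π-∷-in : ∀ {r x} w → channel x ≡ r → π r (x ∷ w) ≡ x ∷ π r w
  π-∷-in {r} w e = filter-accept (λ x → channel x ≟ r) e

  π-∷-out : ∀ {r x} w → channel x ≢ r → π r (x ∷ w) ≡ π r w
  π-∷-out {r} w e = filter-reject (λ x → channel x ≟ r) e

  π-split : ∀ {r x} w {w₁} → π r w ≡ x ∷ w₁ →
            ∃[ u ] ∃[ w₂ ] w ≡ u ++ x ∷ w₂ × π r w₂ ≡ w₁
  π-split {r} (y ∷ w) e with channel y ≟ r
  π-split {r} (y ∷ w) refl | yes p = [] , w , refl , refl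
  ... | no _ with π-split w e
  ... | u , w₂ , refl , e₂ = y ∷ u , w₂ , refl , e₂

  module System (init : List Letter) where

    Γ : PA
    Γ = record
      { #constants = N ; #visible = N
      ; rules = (enc (stk (nt nothing)) , ⌜ vis (ctl TU) ⌝ , ⟦ K ∷ map ltr init ⟧) ∷ fixedRules }

    Final : Maybe Nt → List Letter → Set
    Final nothing  w = w ≡ init
    Final (just g) w = w ∈ finals g

    Generates : Nt → List Letter → Set
    Generates g γ = ∃[ g′ ] ∃[ w ] ∃[ v ] Deriv g g′ w × Final g′ v × γ ≡ v ++ w

    -- A single `γ` has to serve all channels, because it is frozen before `C r` fixes the channel.
    Covered : List Letter → Set
    Covered γ′ = ∃[ γ ] Generates u₀ γ × (∀ r → π r γ′ ≡ π r γ)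

    data SRule : Stk → Lab → List Stk → Set where
      erase : ∀ {a} → SRule a silent []
      melt  : SRule K (vis (stk K)) []
      emit  : ∀ {x} → SRule (ltr x) (vis (stk (ltr x))) []
      grow  : ∀ a → SRule H silent (H ∷ a ∷ [])
      prod  : ∀ {g g′ w} → (g′ , w) ∈ prods g → SRule (nt (just g)) silent (nt g′ ∷ map ltr w)
      stop  : ∀ {g w} → Final g w → SRule (nt g) (vis (ctl TU)) (K ∷ map ltr w)

    data Move : Ctl → Ctl → Set where
      TU-T : Move TU T
      TV-T : Move TV T
      T-C  : ∀ r → Move T (C r)
      C-D  : ∀ {r} → Move (C r) D

    data CRule : Ctl → Lab → Pr → Set where
      spawn : ∀ {c a} → Spawn c a → CRule c silent (ctlP c ∥ ⟦ a ∷ [] ⟧)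
      move  : ∀ {c c′} → Move c c′ → CRule c (vis (ctl c′)) (ctlP c′)
      mask  : ∀ {x r} → channel x ≢ r → CRule (C r) (vis (stk (ltr x))) (ctlP (C r))
      done  : CRule D (vis (ctl D)) ε

    data Rule : Const → Lab → Pr → Set where
      stk : ∀ {a l v} → SRule a l v → Rule (stk a) l ⟦ v ⟧
      ctl : ∀ {c l P} → CRule c l P → Rule (ctl c) l P

    ∈⇒SRule : ∀ a {l v} → (l , v) ∈ stkRules a → SRule a l v
    ∈⇒SRule H (here refl) = erase
    ∈⇒SRule H (there m) with ∈-map⁻ _ m
    ... | a , _ , refl = grow a
    ∈⇒SRule K (here refl) = erase
    ∈⇒SRule K (there (here refl)) = melt
    ∈⇒SRule (nt nothing) (here refl) = erase
    ∈⇒SRule (nt (just g)) (here refl) = erase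
    ∈⇒SRule (nt (just g)) (there m) with ∈-++⁻ (map _ (prods g)) m
    ∈⇒SRule (nt (just g)) (there m) | inj₁ n with ∈-map⁻ _ n
    ... | _ , p , refl = prod p
    ∈⇒SRule (nt (just g)) (there m) | inj₂ n with ∈-map⁻ _ n
    ... | _ , p , refl = stop p
    ∈⇒SRule (ltr x) (here refl) = erase
    ∈⇒SRule (ltr x) (there (here refl)) = emit

    ∈⇒CRule : ∀ c {l P} → (l , P) ∈ ctlRules c → CRule c l P
    ∈⇒CRule TU (here refl) = spawn TU-u
    ∈⇒CRule TU (there (here refl)) = move TU-T
    ∈⇒CRule TV (here refl) = spawn TV-u
    ∈⇒CRule TV (there (here refl)) = spawn TV-v
    ∈⇒CRule TV (there (there (here refl))) = move TV-T
    ∈⇒CRule T (here refl) = spawn T-u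
    ∈⇒CRule T (there (here refl)) = spawn T-v
    ∈⇒CRule T (there (there m)) with ∈-map⁻ _ m
    ... | r , _ , refl = move (T-C r)
    ∈⇒CRule D (here refl) = spawn D-H
    ∈⇒CRule D (there (here refl)) = done
    ∈⇒CRule (C r) (here refl) = move C-D
    ∈⇒CRule (C r) (there m) with ∈-map⁻ _ m
    ... | x , p , refl = mask (proj₂ (∈-filter⁻ (λ x → ¬? (channel x ≟ r)) {xs = letters} p))

    ∈⇒ConstRule : ∀ a {l P} → (l , P) ∈ constRules a → Rule a l P
    ∈⇒ConstRule (ctl c) p = ctl (∈⇒CRule c p)
    ∈⇒ConstRule (stk a) p with ∈-map⁻ (λ (l , v) → l , ⟦ v ⟧) {xs = stkRules a} p
    ... | (l , v) , q , refl = stk (∈⇒SRule a q)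

    ∈⇒Rule : ∀ {i ℓ P} → (i , ℓ , P) ∈ PA.rules Γ → ∃[ l ] ℓ ≡ ⌜ l ⌝ × Rule (dec i) l P
    ∈⇒Rule (here refl) =
      _ , refl ,
      subst (λ a → Rule a (vis (ctl TU)) ⟦ K ∷ map ltr init ⟧)
        (sym (dec-enc (stk (nt nothing)))) (stk (stop {nothing} {init} refl))
    ∈⇒Rule (there m) with Any.satisfied (∈-concatMap⁻ rulesAt {xs = allFin N} m)
    ... | i , n with ∈-map⁻ (λ (l , P) → i , ⌜ l ⌝ , P) {xs = constRules (dec i)} n
    ... | (l , P) , p , refl = l , refl , ∈⇒ConstRule (dec i) p

    fixedAt : ∀ {l P} i → (l , P) ∈ constRules (dec i) → (i , ⌜ l ⌝ , P) ∈ PA.rules Γ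
    fixedAt {l} {P} i m = there (∈-concatMap⁺ rulesAt (Any.map f (∈-allFin i)))
      where
      f : ∀ {j} → i ≡ j → (i , ⌜ l ⌝ , P) ∈ rulesAt j
      f refl = ∈-map⁺ _ m

    fixed : ∀ {l P} a → (l , P) ∈ constRules a → (enc a , ⌜ l ⌝ , P) ∈ PA.rules Γ
    fixed a m = fixedAt (enc a) (subst (λ a → _ ∈ constRules a) (sym (dec-enc a)) m)

    SRule⇒∈ : ∀ {a l v} → SRule a l v → (enc (stk a) , ⌜ l ⌝ , ⟦ v ⟧) ∈ PA.rules Γ
    SRule⇒∈ {a} s = go a s
      where
      listed : ∀ a {l v} → (l , v) ∈ stkRules a → (enc (stk a) , ⌜ l ⌝ , ⟦ v ⟧) ∈ PA.rules Γ
      listed a m = fixed (stk a) (∈-map⁺ (λ (l , v) → l , ⟦ v ⟧) m)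
      go : ∀ a {l v} → SRule a l v → (enc (stk a) , ⌜ l ⌝ , ⟦ v ⟧) ∈ PA.rules Γ
      go H erase = listed H (here refl)
      go K erase = listed K (here refl)
      go (nt nothing) erase = listed (nt nothing) (here refl)
      go (nt (just g)) erase = listed (nt (just g)) (here refl)
      go (ltr x) erase = listed (ltr x) (here refl)
      go K melt = listed K (there (here refl))
      go (ltr x) emit = listed (ltr x) (there (here refl))
      go H (grow a) = listed H (there (∈-map⁺ (λ a → silent , H ∷ a ∷ []) (stk∈ a)))
      go (nt (just g)) (prod p) =
        listed (nt (just g)) (there (∈-++⁺ˡ (∈-map⁺ (λ (g′ , w) → silent , nt g′ ∷ map ltr w) p)))
      go (nt nothing) (stop refl) = here refl
      go (nt (just g)) (stop p) =
        listed (nt (just g))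
          (there (∈-++⁺ʳ (map _ (prods g)) (∈-map⁺ (λ w → vis (ctl TU) , K ∷ map ltr w) p)))

    CRule⇒∈ : ∀ {c l P} → CRule c l P → (enc (ctl c) , ⌜ l ⌝ , P) ∈ PA.rules Γ
    CRule⇒∈ (spawn TU-u) = fixed (ctl TU) (here refl)
    CRule⇒∈ (spawn TV-u) = fixed (ctl TV) (here refl)
    CRule⇒∈ (spawn TV-v) = fixed (ctl TV) (there (here refl))
    CRule⇒∈ (spawn T-u) = fixed (ctl T) (here refl)
    CRule⇒∈ (spawn T-v) = fixed (ctl T) (there (here refl))
    CRule⇒∈ (spawn D-H) = fixed (ctl D) (here refl)
    CRule⇒∈ (move TU-T) = fixed (ctl TU) (there (here refl))
    CRule⇒∈ (move TV-T) = fixed (ctl TV) (there (there (here refl)))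
    CRule⇒∈ (move (T-C r)) = fixed (ctl T) (there (there (∈-map⁺ _ (chan∈ r))))
    CRule⇒∈ (move (C-D {r})) = fixed (ctl (C r)) (here refl)
    CRule⇒∈ (mask {x} {r} ne) =
      fixed (ctl (C r)) (there (∈-map⁺ _ (∈-filter⁺ (λ x → ¬? (channel x ≟ r)) (letter∈ x) ne)))
    CRule⇒∈ done = fixed (ctl D) (there (here refl))

    stk-step : ∀ {a l u} v → SRule a l u → Γ ⊢ ⟦ a ∷ v ⟧ ⟶⟨ ⌜ l ⌝ ⟩ ⟦ u ++ v ⟧
    stk-step {u = u} v s = resp ≅-refl (seq _ (rule (SRule⇒∈ s))) (⟦⟧-++ u v)

    ctl-step : ∀ {c l P} → CRule c l P → Γ ⊢ ctlP c ⟶⟨ ⌜ l ⌝ ⟩ P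
    ctl-step r = rule (CRule⇒∈ r)

    con-inv : ∀ {a ℓ P} → Γ ⊢ con (enc a) ↦⟨ ℓ ⟩ P → ∃[ l ] ℓ ≡ ⌜ l ⌝ × Rule a l P
    con-inv {a} (rule m) with ∈⇒Rule m
    ... | l , e , r = l , e , subst (λ a → Rule a _ _) (dec-enc a) r

    stk-inv : ∀ {a v ℓ X} → Γ ⊢ ⟦ a ∷ v ⟧ ↦⟨ ℓ ⟩ X →
              ∃[ l ] ∃[ u ] ℓ ≡ ⌜ l ⌝ × SRule a l u × X ≅ ⟦ u ++ v ⟧
    stk-inv {a} {v} (seqˡ p) with con-inv {stk a} p
    ... | l , e , stk {v = u} s = l , u , e , s , ⟦⟧-++ u v

    ctl-inv : ∀ {c ℓ P} → Γ ⊢ ctlP c ↦⟨ ℓ ⟩ P → ∃[ l ] ℓ ≡ ⌜ l ⌝ × CRule c l P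
    ctl-inv {c} p with con-inv {ctl c} p
    ... | l , e , ctl r = l , e , r

    ⟦⟧-erase : ∀ u {v} → Γ ⊢ ⟦ u ++ v ⟧ ⟹ ⟦ v ⟧
    ⟦⟧-erase [] = ⟹-refl ≅-refl
    ⟦⟧-erase (a ∷ u) = ⟹-step (stk-step _ erase) (⟦⟧-erase u)

    private
      _then_ : ∀ {P ℓ Q} → Γ ⊢ P ⟶⟨ ℓ ⟩ Q → NormedProc Γ Q → NormedProc Γ P
      p then (_ , ps , e) = _ , (_ , p) ◅ ps , e

      firing : ∀ i {a l P} → dec i ≡ a → (l , P) ∈ constRules a → Γ ⊢ con i ⟶⟨ ⌜ l ⌝ ⟩ P
      firing i refl m = rule (fixedAt i m)

      normed-D : ∀ {i} → dec i ≡ ctl D → NormedProc Γ (con i)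
      normed-D {i} e = firing i e (there (here refl)) then (_ , [] , ≅-refl)

      normed-C : ∀ {i} r → dec i ≡ ctl (C r) → NormedProc Γ (con i)
      normed-C {i} r e = firing i e (here refl) then normed-D (dec-enc (ctl D))

      normed-T : ∀ {i} → dec i ≡ ctl T → NormedProc Γ (con i)
      normed-T {i} e =
        firing i e (there (there (∈-map⁺ _ (chan∈ r₀)))) then normed-C r₀ (dec-enc (ctl (C r₀)))

      normed-con : ∀ i a → dec i ≡ a → NormedProc Γ (con i)
      normed-con i (ctl TU) e = firing i e (there (here refl)) then normed-T (dec-enc (ctl T))
      normed-con i (ctl TV) e = firing i e (there (there (here refl))) then normed-T (dec-enc (ctl T))
      normed-con i (ctl T) e = normed-T e
      normed-con i (ctl D) e = normed-D e
      normed-con i (ctl (C r)) e = normed-C r e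
      normed-con i (stk H) e = firing i e (here refl) then (_ , [] , ≅-refl)
      normed-con i (stk K) e = firing i e (here refl) then (_ , [] , ≅-refl)
      normed-con i (stk (nt nothing)) e = firing i e (here refl) then (_ , [] , ≅-refl)
      normed-con i (stk (nt (just g))) e = firing i e (here refl) then (_ , [] , ≅-refl)
      normed-con i (stk (ltr x)) e = firing i e (here refl) then (_ , [] , ≅-refl)

      normed-resp : ∀ {P Q} → P ≅ Q → NormedProc Γ Q → NormedProc Γ P
      normed-resp e (_ , [] , f) = _ , [] , ≅-trans e f
      normed-resp e (_ , (ℓ , p) ◅ ps , f) = resp e p ≅-refl then (_ , ps , f)

    -- Control runs from `TU` or `TV` through `T`, `C r₀` and `D` to `ε`; every stack symbol can
    -- erase itself.
    normed : Normed Γ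
    normed ε = _ , [] , ≅-refl
    normed (con i) = normed-con i (dec i) refl
    normed (P · Q) = go (normed P)
      where
      go : ∀ {P} → NormedProc Γ P → NormedProc Γ (P · Q)
      go (_ , [] , e) = normed-resp (≅-trans (·-cong e ≅-refl) (·-idˡ Q)) (normed Q)
      go (_ , (_ , p) ◅ ps , e) = seq Q p then go (_ , ps , e)
    normed (P ∥ Q) = go (normed P)
      where
      go : ∀ {P} → NormedProc Γ P → NormedProc Γ (P ∥ Q)
      go (_ , [] , e) = normed-resp (≅-trans (∥-cong e ≅-refl) (∥-idˡ Q)) (normed Q)
      go (_ , (_ , p) ◅ ps , e) = parˡ Q p then go (_ , ps , e)

-- Covered stacks make `TV` and `TU` branching bisimilar.

module Similarity (G : Grammar) (init : List (Grammar.Letter G)) where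

  open Grammar G
  open Construction G
  open System init

  wrd frz : List Letter → Pr
  wrd w = ⟦ map ltr w ⟧
  frz w = ⟦ K ∷ map ltr w ⟧

  -- VU and UV compare TV with TU; in the other modes both sides run the
  -- same control process.

  data Mode : Set where
    VU UV TT DD : Mode
    CC          : Chan → Mode

  left right : Mode → Ctl
  left VU = TV
  left UV = TU
  left TT = T
  left DD = D
  left (CC r) = C r
  right VU = TU
  right UV = TV
  right TT = T
  right DD = D
  right (CC r) = C r

  -- The stacks that c can silently create and destroy in parallel.

  data Garbage (c : Ctl) : List Stk → Set where
    any   : Spawn c H → ∀ v → Garbage c v
    word  : Spawn c (nt (just u₀)) → ∀ w → Garbage c (map ltr w)
    deriv : ∀ {g g′ w} → Spawn c (nt (just g)) → Deriv g g′ w → Garbage c (nt g′ ∷ map ltr w)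

  Alike : Mode → List Letter → List Letter → Set
  Alike (CC r) w w′ = π r w ≡ π r w′
  Alike _      w w′ = ∀ r → π r w ≡ π r w′

  -- Words get a clause of their own only under `C r`, which spawns nothing; in all other modes a
  -- word is garbage.
  data Base (m : Mode) : Pr → Pr → Set where
    garbage : ∀ {v v′} → Garbage (left m) v → Garbage (right m) v′ → Base m ⟦ v ⟧ ⟦ v′ ⟧
    frozen  : ∀ {w w′} → Alike m w w′ → Base m (frz w) (frz w′)
    word    : ∀ {r w w′} → m ≡ CC r → π r w ≡ π r w′ → Base m (wrd w) (wrd w′)

  data Similar (m : Mode) : Pr → Pr → Set where
    base : ∀ {X Y} → Base m X Y → Similar m X Y
    same : ∀ {X Y} → X ≅ Y → Similar m X Y
    par  : ∀ {X Y X′ Y′} → Similar m X Y → Similar m X′ Y′ → Similar m (X ∥ X′) (Y ∥ Y′)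
    resp : ∀ {X X₁ Y₁ Y} → X ≅ X₁ → Similar m X₁ Y₁ → Y₁ ≅ Y → Similar m X Y

  -- The clause `same` takes over when `D` has terminated and no control process is left.
  data Bisim (P Q : Pr) : Set where
    same : P ≅ Q → Bisim P Q
    mode : ∀ m {X Y} → P ≅ ctlP (left m) ∥ X → Similar m X Y → Q ≅ ctlP (right m) ∥ Y → Bisim P Q

  infix 4 _⊩_⟹_
  _⊩_⟹_ : Ctl → Pr → Pr → Set
  c ⊩ X ⟹ Y = Γ ⊢ ctlP c ∥ X ⟹ ctlP c ∥ Y

  lift : ∀ c {X Y} → Γ ⊢ X ⟹ Y → c ⊩ X ⟹ Y
  lift c = ⟹-map (ctlP c ∥_) (parʳ _) (∥-cong ≅-refl)

  ∥-swap : ∀ (X Y Z : Pr) → X ∥ (Y ∥ Z) ≅ (X ∥ Z) ∥ Y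
  ∥-swap X Y Z = ≅-trans (∥-cong ≅-refl (∥-comm Y Z)) (≅-sym (∥-assoc X Z Y))

  ⊩-∥ˡ : ∀ {c X Y} Z → c ⊩ X ⟹ Y → c ⊩ X ∥ Z ⟹ Y ∥ Z
  ⊩-∥ˡ Z p =
    ⟹-respˡ (≅-sym (∥-assoc _ _ _)) (⟹-trans (⟹-∥ˡ Z p) (⟹-refl (∥-assoc _ _ _)))

  ⊩-∥ʳ : ∀ {c X Y} Z → c ⊩ X ⟹ Y → c ⊩ Z ∥ X ⟹ Z ∥ Y
  ⊩-∥ʳ Z p =
    ⟹-respˡ (∥-swap _ _ _) (⟹-trans (⟹-∥ˡ Z p) (⟹-refl (≅-sym (∥-swap _ _ _))))

  destroy : ∀ c v → c ⊩ ⟦ v ⟧ ⟹ ε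
  destroy c [] = ⟹-refl ≅-refl
  destroy c (a ∷ v) = ⟹-trans (lift c (⟹-step (stk-step v erase) (⟹-refl ≅-refl))) (destroy c v)

  derive : ∀ {g g′ w} → Deriv g g′ w → Γ ⊢ ⟦ nt (just g) ∷ [] ⟧ ⟹ ⟦ nt g′ ∷ map ltr w ⟧
  derive start = ⟹-refl ≅-refl
  derive (step {w = w} {v} d p) = ⟹-trans (derive d)
    (⟹-step (resp ≅-refl (stk-step (map ltr w) (prod p)) (eq v w)) (⟹-refl ≅-refl))
    where
    eq : ∀ {g} v w → ⟦ (nt g ∷ map ltr v) ++ map ltr w ⟧ ≅ ⟦ nt g ∷ map ltr (v ++ w) ⟧
    eq v w rewrite map-++ ltr v w = ≅-refl

  spawns : ∀ {c a v} → Spawn c a → Γ ⊢ ⟦ a ∷ [] ⟧ ⟹ ⟦ v ⟧ → c ⊩ ε ⟹ ⟦ v ⟧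
  spawns {c} s p =
    ⟹-respˡ (∥-idʳ _) (⟹-step (ctl-step (spawn s)) (lift c p))

  create : ∀ {c v} → Garbage c v → c ⊩ ε ⟹ ⟦ v ⟧
  create (any s v) = spawns s (⟹-trans (push v) (⟦⟧-erase (H ∷ [])))
    where
    push : ∀ v → Γ ⊢ ⟦ H ∷ [] ⟧ ⟹ ⟦ H ∷ v ⟧
    push [] = ⟹-refl ≅-refl
    push (a ∷ v) = ⟹-trans (push v) (⟹-step (stk-step v (grow a)) (⟹-refl ≅-refl))
  create (word s w) = spawns s (⟹-trans (derive (u₀-any w)) (⟦⟧-erase (_ ∷ [])))
  create (deriv s d) = spawns s (derive d)

  -- The way leads through `ε`. It makes all garbage of one control process mutually reachable by
  -- silent steps, which is why `Base` may pair any two pieces of it.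
  replace : ∀ {c v v′} → Garbage c v′ → c ⊩ ⟦ v ⟧ ⟹ ⟦ v′ ⟧
  replace {c} {v} g = ⟹-trans (destroy c v) (create g)

  Similar-flip : ∀ {m m′} → (∀ {X Y} → Base m X Y → Base m′ Y X) →
                 ∀ {X Y} → Similar m X Y → Similar m′ Y X
  Similar-flip f (base b) = base (f b)
  Similar-flip f (same e) = same (≅-sym e)
  Similar-flip f (par s t) = par (Similar-flip f s) (Similar-flip f t)
  Similar-flip f (resp e s e′) = resp (≅-sym e′) (Similar-flip f s) (≅-sym e)

  Similar-map : ∀ {m m′} → (∀ {X Y} → Base m X Y → Base m′ X Y) →
                ∀ {X Y} → Similar m X Y → Similar m′ X Y
  Similar-map f (base b) = base (f b)
  Similar-map f (same e) = same e
  Similar-map f (par s t) = par (Similar-map f s) (Similar-map f t)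
  Similar-map f (resp e s e′) = resp e (Similar-map f s) e′

  flip-VU : ∀ {X Y} → Base VU X Y → Base UV Y X
  flip-VU (garbage g h) = garbage h g
  flip-VU (frozen a) = frozen (λ r → sym (a r))
  flip-UV : ∀ {X Y} → Base UV X Y → Base VU Y X
  flip-UV (garbage g h) = garbage h g
  flip-UV (frozen a) = frozen (λ r → sym (a r))
  flip-TT : ∀ {X Y} → Base TT X Y → Base TT Y X
  flip-TT (garbage g h) = garbage h g
  flip-TT (frozen a) = frozen (λ r → sym (a r))
  flip-DD : ∀ {X Y} → Base DD X Y → Base DD Y X
  flip-DD (garbage g h) = garbage h g
  flip-DD (frozen a) = frozen (λ r → sym (a r))
  flip-CC : ∀ {r X Y} → Base (CC r) X Y → Base (CC r) Y X
  flip-CC (garbage g h) = garbage h g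
  flip-CC (frozen a) = frozen (sym a)
  flip-CC (word refl e) = word refl (sym e)

  Bisim-sym : ∀ {P Q} → Bisim P Q → Bisim Q P
  Bisim-sym (same e) = same (≅-sym e)
  Bisim-sym (mode VU e s f) = mode UV f (Similar-flip flip-VU s) e
  Bisim-sym (mode UV e s f) = mode VU f (Similar-flip flip-UV s) e
  Bisim-sym (mode TT e s f) = mode TT f (Similar-flip flip-TT s) e
  Bisim-sym (mode DD e s f) = mode DD f (Similar-flip flip-DD s) e
  Bisim-sym (mode (CC r) e s f) = mode (CC r) f (Similar-flip flip-CC s) e

  VU⊆TT : ∀ {X Y} → Base VU X Y → Base TT X Y
  VU⊆TT (garbage g h) = garbage (V g) (U h)
    where
    V : ∀ {v} → Garbage TV v → Garbage T v
    V (word s w) = word T-u w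
    V (deriv TV-u d) = deriv T-u d
    V (deriv TV-v d) = deriv T-v d
    U : ∀ {v} → Garbage TU v → Garbage T v
    U (word s w) = word T-u w
    U (deriv TU-u d) = deriv T-u d
  VU⊆TT (frozen a) = frozen a

  UV⊆TT : ∀ {X Y} → Base UV X Y → Base TT X Y
  UV⊆TT b = flip-TT (VU⊆TT (flip-UV b))

  -- `H` can build any stack at all, so what was compared under `C r` is mere garbage under `D`.
  CC⊆DD : ∀ {r X Y} → Base (CC r) X Y → Base DD X Y
  CC⊆DD (garbage (any () v) h)
  CC⊆DD (garbage (word () w) h)
  CC⊆DD (garbage (deriv () d) h)
  CC⊆DD (frozen a) = garbage (any D-H _) (any D-H _)
  CC⊆DD (word e a) = garbage (any D-H _) (any D-H _)

  -- Lets the answering side become an exact copy before control vanishes; afterwards nothing could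
  -- repair a difference.
  DD-replace : ∀ {X Y} → Similar DD X Y → D ⊩ Y ⟹ X
  DD-replace (base (garbage g h)) = replace g
  DD-replace (base (frozen a)) = replace (any D-H _)
  DD-replace (same e) = ⟹-refl (∥-cong ≅-refl (≅-sym e))
  DD-replace (par s t) = ⟹-trans (⊩-∥ˡ _ (DD-replace s)) (⊩-∥ʳ _ (DD-replace t))
  DD-replace (resp e s f) =
    ⟹-respˡ (∥-cong ≅-refl (≅-sym f))
      (⟹-trans (DD-replace s) (⟹-refl (∥-cong ≅-refl (≅-sym e))))

  -- Under `C r` garbage can no longer be replaced, so before `T` turns into `C r` the answering
  -- side copies all garbage literally. What then still differs are frozen words that agree on every
  -- channel.
  TT-commit : ∀ {X Y} → Similar TT X Y →
              ∃[ Y′ ] (T ⊩ Y ⟹ Y′) × Similar TT X Y′ × (∀ r → Similar (CC r) X Y′)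
  TT-commit (base (garbage g h)) = _ , replace g , same ≅-refl , λ r → same ≅-refl
  TT-commit (base (frozen a)) = _ , ⟹-refl ≅-refl , base (frozen a) , λ r → base (frozen (a r))
  TT-commit (same e) = _ , ⟹-refl ≅-refl , same e , λ r → same e
  TT-commit (par s t) with TT-commit s | TT-commit t
  ... | _ , p , s₁ , s₂ | _ , q , t₁ , t₂ =
    _ , ⟹-trans (⊩-∥ˡ _ p) (⊩-∥ʳ _ q) , par s₁ t₁ , λ r → par (s₂ r) (t₂ r)
  TT-commit (resp e s f) with TT-commit s
  ... | _ , p , s₁ , s₂ =
    _ , ⟹-respˡ (∥-cong ≅-refl (≅-sym f)) p , resp e s₁ ≅-refl , λ r → resp e (s₂ r) ≅-refl

  data Answer (m : Mode) (X Y : Pr) (ℓ : Fin (suc N)) (X′ : Pr) : Set where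
    move : ∀ {Y″ Y′} → right m ⊩ Y ⟹ Y″ →
           Γ ⊢ ctlP (right m) ∥ Y″ ⟶⟨ ℓ ⟩ ctlP (right m) ∥ Y′ →
           Similar m X Y″ → Similar m X′ Y′ → Answer m X Y ℓ X′
    stay : ℓ ≡ τ → Similar m X′ Y → Answer m X Y ℓ X′

  Answer-resp : ∀ {m X X₁ Y Y₁ ℓ X′ X₁′} → X ≅ X₁ → Y ≅ Y₁ → X′ ≅ X₁′ →
                Answer m X₁ Y₁ ℓ X₁′ → Answer m X Y ℓ X′
  Answer-resp e f g (move p q s t) =
    move (⟹-respˡ (∥-cong ≅-refl f) p) q (resp e s ≅-refl) (resp g t ≅-refl)
  Answer-resp e f g (stay h s) = stay h (resp g s (≅-sym f))

  copy : ∀ {m X Y ℓ X′} → right m ⊩ Y ⟹ X → Γ ⊢ X ⟶⟨ ℓ ⟩ X′ → Answer m X Y ℓ X′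
  copy p q = move p (parʳ _ q) (same ≅-refl) (same ≅-refl)

  module _ (covered : ∀ γ′ → Generates v₀ γ′ → Covered γ′) where

    -- Isolates the one asymmetry: a stack derived from `v₀` next to `TV` is beyond the reach of
    -- `TU`. All other garbage is answered by copying.
    transfer : ∀ m {v} → Garbage (left m) v →
               Garbage (right m) v ⊎
               (m ≡ VU × ∃[ g ] ∃[ w ] v ≡ nt g ∷ map ltr w × Deriv v₀ g w)
    transfer VU (word _ w) = inj₁ (word TU-u w)
    transfer VU (deriv TV-u d) = inj₁ (deriv TU-u d)
    transfer VU (deriv TV-v d) = inj₂ (refl , _ , _ , refl , d)
    transfer UV (word _ w) = inj₁ (word TV-u w)
    transfer UV (deriv TU-u d) = inj₁ (deriv TV-u d)
    transfer TT g = inj₁ g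
    transfer DD g = inj₁ g
    transfer (CC r) g = inj₁ g

    words : ∀ m {w w′} → Alike m w w′ → Similar m (wrd w) (wrd w′)
    words VU a = base (garbage (word TV-u _) (word TU-u _))
    words UV a = base (garbage (word TU-u _) (word TV-u _))
    words TT a = base (garbage (word T-u _) (word T-u _))
    words DD a = base (garbage (any D-H _) (any D-H _))
    words (CC r) a = base (word refl a)

    answer-V : ∀ {g w v ℓ X′} → Deriv v₀ g w → Garbage TU v →
               Γ ⊢ ⟦ nt g ∷ map ltr w ⟧ ↦⟨ ℓ ⟩ X′ → Answer VU ⟦ nt g ∷ map ltr w ⟧ ⟦ v ⟧ ℓ X′
    answer-V {g} {w} {v} d h p with stk-inv {nt g} {map ltr w} p
    ... | silent , [] , refl , erase , e =
      stay refl (resp e (base (garbage (word TV-u w) h)) ≅-refl)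
    ... | silent , _ , refl , prod {w = v₁} q , e =
      stay refl (resp e (subst (λ u → Similar VU ⟦ _ ∷ u ⟧ _) (map-++ ltr v₁ w)
        (base (garbage (deriv TV-v (step d q)) h))) ≅-refl)
    -- Here `covered` enters: `TU` silently trades its stack for the derivation of a counterpart and
    -- freezes that one. Until this moment any two stacks may stay paired.
    ... | vis _ , _ , refl , stop {w = v₁} f , e
      with covered (v₁ ++ w) (_ , _ , _ , d , f , refl)
    ... | _ , (g₂ , w₂ , v₂ , d₂ , f₂ , refl) , a =
      move (replace (deriv TU-u d₂)) (parʳ _ (stk-step (map ltr w₂) (stop f₂)))
        (base (garbage (deriv TV-v d) (deriv TU-u d₂)))
        (resp e (subst₂ (λ u u′ → Similar VU ⟦ K ∷ u ⟧ ⟦ K ∷ u′ ⟧) (map-++ ltr v₁ w) (map-++ ltr v₂ w₂)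
          (base (frozen a))) ≅-refl)

    answer-frozen : ∀ m {w w′ ℓ X′} → Alike m w w′ → Γ ⊢ frz w ↦⟨ ℓ ⟩ X′ →
                    Answer m (frz w) (frz w′) ℓ X′
    answer-frozen m {w} {w′} a p with stk-inv {K} {map ltr w} p
    ... | _ , _ , refl , erase , e =
      move (⟹-refl ≅-refl) (parʳ _ (stk-step (map ltr w′) erase)) (base (frozen a))
        (resp e (words m a) ≅-refl)
    ... | _ , _ , refl , melt , e =
      move (⟹-refl ≅-refl) (parʳ _ (stk-step (map ltr w′) melt)) (base (frozen a))
        (resp e (words m a) ≅-refl)

    -- A letter outside channel `r` is erased for nothing or imitated by a mask of `C r`. A letter
    -- of channel `r` is brought to the top of the other word by erasing the letters above it.
    answer-word : ∀ {r} w {w′ ℓ X′} → π r w ≡ π r w′ → Γ ⊢ wrd w ↦⟨ ℓ ⟩ X′ →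
                  Answer (CC r) (wrd w) (wrd w′) ℓ X′
    answer-word {r} (x ∷ w) {w′} a p with channel x ≟ r
    answer-word {r} (x ∷ w) {w′} a p | no ne with stk-inv {ltr x} {map ltr w} p
    ... | _ , _ , refl , erase , e =
      stay refl (resp e (base (word refl a)) ≅-refl)
    ... | _ , _ , refl , emit , e =
      move (⟹-refl ≅-refl) (parˡ _ (ctl-step (mask ne)))
        (base (word {w = x ∷ w} refl (trans (π-∷-out w ne) a)))
        (resp e (base (word {w = w} refl a)) ≅-refl)
    answer-word {r} (x ∷ w) {w′} a p | yes c with π-split w′ (sym a)
    ... | u , w₂ , refl , b = finish (stk-inv {ltr x} {map ltr w} p)
      where
      skip : C r ⊩ wrd (u ++ x ∷ w₂) ⟹ wrd (x ∷ w₂)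
      skip rewrite map-++ ltr u (x ∷ w₂) = lift (C r) (⟦⟧-erase (map ltr u))
      both : π r (x ∷ w) ≡ π r (x ∷ w₂)
      both = trans (π-∷-in w c) (trans (cong (x ∷_) (sym b)) (sym (π-∷-in w₂ c)))
      finish : ∀ {ℓ X′} →
               ∃[ l ] ∃[ u ] ℓ ≡ ⌜ l ⌝ × SRule (ltr x) l u × X′ ≅ ⟦ u ++ map ltr w ⟧ →
               Answer (CC r) (wrd (x ∷ w)) (wrd (u ++ x ∷ w₂)) ℓ X′
      finish (_ , _ , refl , erase , e) =
        move skip (parʳ _ (stk-step (map ltr w₂) erase)) (base (word {w = x ∷ w} {x ∷ w₂} refl both))
          (resp e (base (word {w = w} {w₂} refl (sym b))) ≅-refl)
      finish (_ , _ , refl , emit , e) =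
        move skip (parʳ _ (stk-step (map ltr w₂) emit)) (base (word {w = x ∷ w} {x ∷ w₂} refl both))
          (resp e (base (word {w = w} {w₂} refl (sym b))) ≅-refl)

    answer : ∀ m {X Y ℓ X′} → Similar m X Y → Γ ⊢ X ↦⟨ ℓ ⟩ X′ → Answer m X Y ℓ X′
    answer m (base (garbage g h)) p with transfer m g
    ... | inj₁ g′ = copy (replace g′) (↦⇒⟶ p)
    answer m (base (garbage g h)) p | inj₂ (refl , _ , _ , refl , d) = answer-V d h p
    answer m (base (frozen a)) p = answer-frozen m a p
    answer m (base (word {w = w} refl a)) p = answer-word w a p
    answer m (same e) p = copy (⟹-refl (∥-cong ≅-refl (≅-sym e))) (↦⇒⟶ p)
    answer m (par {Y = Y} {Y′ = Y′} s t) (parˡ p) with answer m s p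
    ... | move q r s₁ s₂ =
      move (⊩-∥ˡ Y′ q) (resp (≅-sym (∥-assoc _ _ _)) (parˡ Y′ r) (∥-assoc _ _ _))
        (par s₁ t) (par s₂ t)
    ... | stay h s₁ = stay h (par s₁ t)
    answer m (par {Y = Y} {Y′ = Y′} s t) (parʳ p) with answer m t p
    ... | move q r t₁ t₂ =
      move (⊩-∥ʳ Y q) (resp (∥-swap _ _ _) (parˡ Y r) (≅-sym (∥-swap _ _ _)))
        (par s t₁) (par s t₂)
    ... | stay h t₁ = stay h (par s t₁)
    answer m (resp e s f) p with proj₁ (≅-matches e) p
    ... | _ , q , e₁ = Answer-resp e (≅-sym f) e₁ (answer m s q)

    Reply : Pr → Pr → Fin (suc N) → Pr → Set
    Reply P Q ℓ P′ =
      (∃[ Q″ ] ∃[ Q′ ] (Γ ⊢ Q ⟹ Q″) × (Γ ⊢ Q″ ⟶⟨ ℓ ⟩ Q′) × Bisim P Q″ × Bisim P′ Q′)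
      ⊎ (ℓ ≡ τ × Bisim P′ Q)

    control : ∀ m {P Q X Y l R P′} → P ≅ ctlP (left m) ∥ X → Similar m X Y → Q ≅ ctlP (right m) ∥ Y →
              CRule (left m) l R → P′ ≅ R ∥ X → Reply P Q ⌜ l ⌝ P′
    control m {P} {Q} {X} {Y} {P′ = P′} e s f r g = go m r e s f g
      where
      moves : ∀ m m′ {a} → P ≅ ctlP (left m) ∥ X → Similar m X Y → Q ≅ ctlP (right m) ∥ Y →
              CRule (right m) (vis a) (ctlP (right m′)) → Similar m′ X Y → P′ ≅ ctlP (left m′) ∥ X →
              Reply P Q ⌜ vis a ⌝ P′
      moves m m′ e s f r t g =
        inj₁ (_ , _ , ⟹-refl f , parˡ _ (ctl-step r) , mode m e s ≅-refl , mode m′ g t ≅-refl)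

      -- A spawn is answered by staying: the new stack is paired with `ε`, the empty word.
      spawned : ∀ m {v} → Similar m X Y → Q ≅ ctlP (right m) ∥ Y → Similar m ⟦ v ⟧ ε →
                P′ ≅ (ctlP (left m) ∥ ⟦ v ⟧) ∥ X → Reply P Q τ P′
      spawned m s f t g =
        inj₂ (refl , mode m (≅-trans g (∥-assoc _ _ _)) (resp ≅-refl (par t s) (∥-idˡ _)) f)

      go : ∀ m {l R} → CRule (left m) l R → P ≅ ctlP (left m) ∥ X → Similar m X Y →
           Q ≅ ctlP (right m) ∥ Y → P′ ≅ R ∥ X → Reply P Q ⌜ l ⌝ P′
      go VU (spawn TV-u) e s f g = spawned VU s f (base (garbage (deriv TV-u start) (word TU-u []))) g
      go VU (spawn TV-v) e s f g = spawned VU s f (base (garbage (deriv TV-v start) (word TU-u []))) g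
      go VU (move TV-T) e s f g = moves VU TT e s f (move TU-T) (Similar-map VU⊆TT s) g
      go UV (spawn TU-u) e s f g = spawned UV s f (base (garbage (deriv TU-u start) (word TV-u []))) g
      go UV (move TU-T) e s f g = moves UV TT e s f (move TV-T) (Similar-map UV⊆TT s) g
      go TT (spawn T-u) e s f g = spawned TT s f (base (garbage (deriv T-u start) (word T-u []))) g
      go TT (spawn T-v) e s f g = spawned TT s f (base (garbage (deriv T-v start) (word T-u []))) g
      go TT (move (T-C r)) e s f g with TT-commit s
      ... | _ , p , s₁ , s₂ =
        inj₁ (_ , _ , ⟹-respˡ f p , parˡ _ (ctl-step (move (T-C r))) ,
              mode TT e s₁ ≅-refl , mode (CC r) g (s₂ r) ≅-refl)
      go DD (spawn D-H) e s f g = spawned DD s f (base (garbage (any D-H _) (any D-H []))) g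
      go DD done e s f g =
        inj₁ (_ , _ , ⟹-respˡ f (DD-replace s) , parˡ _ (ctl-step done) ,
              mode DD e (same ≅-refl) ≅-refl , same g)
      go (CC r) (move C-D) e s f g = moves (CC r) DD e s f (move C-D) (Similar-map CC⊆DD s) g
      go (CC r) (mask ne) e s f g = moves (CC r) (CC r) e s f (mask ne) s g

    Bisim-simulation : BranchingSimulation Γ Bisim
    Bisim-simulation (same e) p = inj₁ (_ , _ , ⟹-refl (≅-sym e) , p , same ≅-refl , same ≅-refl)
    Bisim-simulation (mode m e s f) p with step-inv e p
    ... | _ , parˡ q , g with ctl-inv {left m} q
    ...   | _ , refl , r = control m e s f r g
    Bisim-simulation (mode m e s f) p | _ , parʳ q , g with answer m s q
    ... | move a b s₁ s₂ = inj₁ (_ , _ , ⟹-respˡ f a , b , mode m e s₁ ≅-refl , mode m g s₂ ≅-refl)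
    ... | stay h s₁ = inj₂ (h , mode m g s₁ f)

    covered⇒≃ : Γ ⊢ ctlP TV ≃ ctlP TU
    covered⇒≃ =
      Bisim , (Bisim-simulation , flipped) , mode VU (≅-sym (∥-idʳ _)) (same ≅-refl) (≅-sym (∥-idʳ _))
      where
      flipped : BranchingSimulation Γ (λ P Q → Bisim Q P)
      flipped b p with Bisim-simulation (Bisim-sym b) p
      ... | inj₁ (_ , _ , q , r , b₁ , b₂) = inj₁ (_ , _ , q , r , Bisim-sym b₁ , Bisim-sym b₂)
      ... | inj₂ (h , b₁) = inj₂ (h , Bisim-sym b₁)

-- Weak bisimilarity of `TV` and `TU` forces all stacks to be covered.

module Dissimilarity (G : Grammar) (init : List (Grammar.Letter G)) where

  open Grammar G
  open Construction G
  open System init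
  open Similarity G init using (wrd; frz; spawns; derive)

  data Quiet : Lab → Set where
    silent : Quiet silent
    letter : ∀ x → Quiet (vis (stk (ltr x)))

  data Loose (S : Nt → Set) : Pr → Set where
    word  : ∀ w → Loose S (wrd w)
    deriv : ∀ {g g′ w} → S g → Deriv g g′ w → Loose S ⟦ nt g′ ∷ map ltr w ⟧
    par   : ∀ {X Y} → Loose S X → Loose S Y → Loose S (X ∥ Y)
    resp  : ∀ {X Y} → X ≅ Y → Loose S Y → Loose S X

  data LooseStep (S : Nt → Set) (l : Lab) (X′ : Pr) : Set where
    quiet : Quiet l → Loose S X′ → LooseStep S l X′
    call  : ∀ {g γ X″} → l ≡ vis (ctl TU) → S g → Generates g γ → Loose S X″ →
            X′ ≅ X″ ∥ frz γ → LooseStep S l X′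

  stk-inv′ : ∀ {a v l X} → Γ ⊢ ⟦ a ∷ v ⟧ ↦⟨ ⌜ l ⌝ ⟩ X → ∃[ u ] SRule a l u × X ≅ ⟦ u ++ v ⟧
  stk-inv′ {a} {v} p with stk-inv {a} {v} p
  ... | l , u , h , s , e with ⌜⌝-injective h
  ... | refl = u , s , e

  ctx-inv : ∀ {c P X l P′} → P ≅ ctlP c ∥ X → Γ ⊢ P ⟶⟨ ⌜ l ⌝ ⟩ P′ →
            (∃[ R ] CRule c l R × P′ ≅ R ∥ X) ⊎
            (∃[ X′ ] (Γ ⊢ X ↦⟨ ⌜ l ⌝ ⟩ X′) × P′ ≅ ctlP c ∥ X′)
  ctx-inv {c} e p with step-inv e p
  ... | _ , parʳ q , f = inj₂ (_ , q , f)
  ... | _ , parˡ q , f with ctl-inv {c} q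
  ... | l , h , r with ⌜⌝-injective h
  ... | refl = inj₁ (_ , r , f)

  loose-step : ∀ {S X l X′} → Loose S X → Γ ⊢ X ↦⟨ ⌜ l ⌝ ⟩ X′ → LooseStep S l X′
  loose-step (word (x ∷ w)) p with stk-inv′ {ltr x} {map ltr w} p
  ... | _ , erase , e = quiet silent (resp e (word w))
  ... | _ , emit , e = quiet (letter x) (resp e (word w))
  loose-step (deriv {g′ = g′} {w} s d) p with stk-inv′ {nt g′} {map ltr w} p
  ... | _ , erase , e = quiet silent (resp e (word w))
  ... | _ , prod {w = v} q , e =
    quiet silent (resp e (subst (λ u → Loose _ ⟦ _ ∷ u ⟧) (map-++ ltr v w) (deriv s (step d q))))
  ... | _ , stop {w = v} f , e =
    call refl s (_ , _ , _ , d , f , refl) (word [])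
      (≅-trans (subst (λ u → _ ≅ ⟦ K ∷ u ⟧) (sym (map-++ ltr v w)) e) (≅-sym (∥-idˡ _)))
  loose-step (par a b) (parˡ p) with loose-step a p
  ... | quiet q a′ = quiet q (par a′ b)
  ... | call h s g a′ e = call h s g (par a′ b)
    (≅-trans (∥-cong e ≅-refl) (≅-trans (≅-trans (∥-assoc _ _ _) (∥-cong ≅-refl (∥-comm _ _))) (≅-sym (∥-assoc _ _ _))))
  loose-step (par a b) (parʳ p) with loose-step b p
  ... | quiet q b′ = quiet q (par a b′)
  ... | call h s g b′ e = call h s g (par a b′) (≅-trans (∥-cong ≅-refl e) (≅-sym (∥-assoc _ _ _)))
  loose-step (resp e a) p with proj₁ (≅-matches e) p
  ... | _ , q , f with loose-step a q
  ... | quiet h a′ = quiet h (resp f a′)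
  ... | call h s g a′ e₁ = call h s g a′ (≅-trans f e₁)

  loose-erase : ∀ {S X} → Loose S X → Γ ⊢ X ⟹ ε
  loose-erase (word w) = erase-all (map ltr w)
    where
    erase-all : ∀ v → Γ ⊢ ⟦ v ⟧ ⟹ ε
    erase-all [] = ⟹-refl ≅-refl
    erase-all (a ∷ v) = ⟹-step (stk-step v erase) (erase-all v)
  loose-erase (deriv {w = w} s d) = ⟹-step (stk-step (map ltr w) erase) (loose-erase {λ _ → ⊤} (word w))
  loose-erase (par {Y = Y} a b) =
    ⟹-trans (⟹-∥ˡ Y (loose-erase a)) (⟹-respˡ (∥-idˡ Y) (loose-erase b))
  loose-erase (resp e a) = ⟹-respˡ e (loose-erase a)

  loose-map : ∀ {S S′ : Nt → Set} → (∀ {g} → S g → S′ g) → ∀ {X} → Loose S X → Loose S′ X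
  loose-map f (word w) = word w
  loose-map f (deriv s d) = deriv (f s) d
  loose-map f (par a b) = par (loose-map f a) (loose-map f b)
  loose-map f (resp e a) = resp e (loose-map f a)

  -- just w records that the word w is still frozen by K, nothing that it
  -- has been released.

  In : (Nt → Set) → Ctl → Maybe (List Letter) → Pr → Set
  In S c nothing  P = ∃[ X ] Loose S X × P ≅ ctlP c ∥ X
  In S c (just w) P = ∃[ X ] Loose S X × P ≅ ctlP c ∥ (X ∥ frz w)

  -- `In` keeps track of one frozen word at most, so the outcome of a call is described only when
  -- there is none yet.
  data Next (S : Nt → Set) (c : Ctl) (k : Maybe (List Letter)) (l : Lab) (P′ : Pr) : Set where
    quiet   : Quiet l → In S c k P′ → Next S c k l P′
    release : ∀ {w} → k ≡ just w → l ≡ silent ⊎ l ≡ vis (stk K) → In S c nothing P′ → Next S c k l P′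
    call    : l ≡ vis (ctl TU) →
              (k ≡ nothing → ∃[ g ] ∃[ γ ] S g × Generates g γ × In S c (just γ) P′) →
              Next S c k l P′
    moved   : ∀ {c′} → Move c c′ → l ≡ vis (ctl c′) → In S c′ k P′ → Next S c k l P′

  -- Shuts out `D`, whose `H` could silently build a fresh `K`.
  Tame : Ctl → (Nt → Set) → Set
  Tame c S = ∀ {a} → Spawn c a → ∃[ g ] a ≡ nt (just g) × S g

  next : ∀ {S c k P l P′} → Tame c S → In S c k P → Γ ⊢ P ⟶⟨ ⌜ l ⌝ ⟩ P′ → Next S c k l P′
  next {S} {c} {k} {P} {l} {P′} t i p = go k i
    where
    control : ∀ {R X} k → CRule c l R → P′ ≅ R ∥ X →
              (∀ {c′ P″} → P″ ≅ ctlP c′ ∥ X → In S c′ k P″) →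
              (∀ {g P″} → S g → P″ ≅ (ctlP c ∥ ⟦ nt (just g) ∷ [] ⟧) ∥ X → In S c k P″) →
              Next S c k l P′
    control k (spawn s) e f g with t s
    ... | _ , refl , s′ = quiet silent (g s′ e)
    control k (move m) e f g = moved m refl (f e)
    control k (mask {x} _) e f g = quiet (letter x) (f e)
    control k done e f g with t D-H
    ... | _ , () , _
    go : ∀ k → In S c k P → Next S c k l P′
    go nothing (X , a , e) with ctx-inv e p
    ... | inj₁ (R , r , f) = control nothing r f (λ h → X , a , h)
      (λ s h → _ , par (deriv s start) a , ≅-trans h (∥-assoc _ _ _))
    ... | inj₂ (X′ , q , f) with loose-step a q
    ...   | quiet h a′ = quiet h (_ , a′ , f)
    ...   | call h s g a′ e′ =
      call h (λ _ → _ , _ , s , g , _ , a′ , ≅-trans f (∥-cong ≅-refl e′))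
    go (just w) (X , a , e) with ctx-inv e p
    ... | inj₁ (R , r , f) = control (just w) r f (λ h → X , a , h)
      (λ s h → _ , par (deriv s start) a ,
               ≅-trans h (≅-trans (∥-assoc _ _ _) (∥-cong ≅-refl (≅-sym (∥-assoc _ _ _)))))
    ... | inj₂ (_ , parˡ q , f) with loose-step a q
    ...   | quiet h a′ = quiet h (_ , a′ , f)
    ...   | call h s g a′ e′ = call h (λ ())
    go (just w) (X , a , e) | inj₂ (_ , parʳ q , f) with stk-inv′ {K} {map ltr w} q
    ...   | _ , erase , e′ = release refl (inj₁ refl) (_ , par a (resp e′ (word w)) , f)
    ...   | _ , melt , e′ = release refl (inj₂ refl) (_ , par a (resp e′ (word w)) , f)

  In-resp : ∀ {S c P Q} k → P ≅ Q → In S c k P → In S c k Q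
  In-resp nothing e (X , a , f) = X , a , ≅-trans (≅-sym e) f
  In-resp (just w) e (X , a , f) = X , a , ≅-trans (≅-sym e) f

  In-map : ∀ {S S′ : Nt → Set} → (∀ {g} → S g → S′ g) → ∀ {c P} k → In S c k P → In S′ c k P
  In-map f nothing (X , a , e) = X , loose-map f a , e
  In-map f (just w) (X , a , e) = X , loose-map f a , e

  In-star : ∀ {S c k P Q} → Tame c S → In S c k P → _⟶τ*_ {Γ} P Q → In S c k Q ⊎ In S c nothing Q
  In-star t i [] = inj₁ i
  In-star {k = k} t i (p ◅ ps) with next {k = k} {l = silent} t i p
  ... | quiet _ j = In-star {k = k} t j ps
  ... | call () _
  ... | moved _ () _
  ... | release _ _ j with In-star {k = nothing} t j ps
  ...   | inj₁ h = inj₂ h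
  ...   | inj₂ h = inj₂ h

  In-⟹ : ∀ {S c k P Q} → Tame c S → In S c k P → Γ ⊢ P ⟹ Q → In S c k Q ⊎ In S c nothing Q
  In-⟹ {k = k} t i (_ , ps , e) with In-star {k = k} t i ps
  ... | inj₁ j = inj₁ (In-resp k e j)
  ... | inj₂ j = inj₂ (In-resp nothing e j)

  In-move₁ : ∀ {S c c₁ k P Q} → Tame c S → c₁ ≢ TU → In S c k P →
             Γ ⊢ P ⟶⟨ ⌜ vis (ctl c₁) ⌝ ⟩ Q → In S c₁ k Q
  In-move₁ {c₁ = c₁} {k} t ne i p with next {k = k} {l = vis (ctl c₁)} t i p
  ... | quiet () _
  ... | release _ (inj₁ ()) _
  ... | release _ (inj₂ ()) _
  ... | call refl _ = ⊥-elim (ne refl)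
  ... | moved _ refl j = j

  In-move : ∀ {S c c₁ k P Q} → Tame c S → Tame c₁ S → c₁ ≢ TU →
            In S c k P → Γ ⊢ P ⟹⟨ ⌜ vis (ctl c₁) ⌝ ⟩ Q → In S c₁ k Q ⊎ In S c₁ nothing Q
  In-move {c₁ = c₁} {k} t t₁ ne i (_ , _ , ps , p , qs) with In-⟹ {k = k} t i ps
  ... | inj₁ j = In-⟹ {k = k} t₁ (In-move₁ {c₁ = c₁} {k = k} t ne j p) qs
  ... | inj₂ j with In-⟹ {k = nothing} t₁ (In-move₁ {c₁ = c₁} {k = nothing} t ne j p) qs
  ...   | inj₁ h = inj₂ h
  ...   | inj₂ h = inj₂ h

  released-mute₁ : ∀ {S c P Q} → Tame c S → In S c nothing P → Γ ⊢ P ⟶⟨ ⌜ vis (stk K) ⌝ ⟩ Q → ⊥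
  released-mute₁ t i p with next {k = nothing} {l = vis (stk K)} t i p
  ... | quiet () _
  ... | release () _ _
  ... | call () _
  ... | moved _ () _

  -- A new `K` arises only through the visible call, so a released word never lets `K` be seen
  -- again. This is the threat that makes both players keep their words frozen.
  released-mute : ∀ {S c P Q} → Tame c S → In S c nothing P → Γ ⊢ P ⟹⟨ ⌜ vis (stk K) ⌝ ⟩ Q → ⊥
  released-mute {S} {c} t i (_ , _ , ps , p , _) with In-⟹ {k = nothing} t i ps
  ... | inj₁ j = released-mute₁ t j p
  ... | inj₂ j = released-mute₁ t j p

  word-step : ∀ {r P l P′} w → P ≅ ctlP (C r) ∥ wrd w → Γ ⊢ P ⟶⟨ ⌜ l ⌝ ⟩ P′ →
              (CRule (C r) l (ctlP (C r)) × P′ ≅ ctlP (C r) ∥ wrd w) ⊎ l ≡ vis (ctl D) ⊎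
              (∃[ x ] ∃[ w₁ ] w ≡ x ∷ w₁ × (l ≡ silent ⊎ l ≡ vis (stk (ltr x))) ×
               P′ ≅ ctlP (C r) ∥ wrd w₁)
  word-step w e p with ctx-inv e p
  ... | inj₁ (_ , move C-D , f) = inj₂ (inj₁ refl)
  ... | inj₁ (_ , mask ne , f) = inj₁ (mask ne , f)
  word-step (x ∷ w) e p | inj₂ (_ , q , f) with stk-inv′ {ltr x} {map ltr w} q
  ... | _ , erase , g = inj₂ (inj₂ (x , w , refl , inj₁ refl , ≅-trans f (∥-cong ≅-refl g)))
  ... | _ , emit , g = inj₂ (inj₂ (x , w , refl , inj₂ refl , ≅-trans f (∥-cong ≅-refl g)))

  π-∷-⊆ : ∀ r x w → π r w ⊆ π r (x ∷ w)
  π-∷-⊆ r x w with channel x ≟ r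
  ... | yes _ = x ∷ʳ ⊆-refl
  ... | no _  = ⊆-refl

  word-star : ∀ {r P P′} w → P ≅ ctlP (C r) ∥ wrd w → _⟶τ*_ {Γ} P P′ →
              ∃[ w₁ ] (P′ ≅ ctlP (C r) ∥ wrd w₁) × π r w₁ ⊆ π r w
  word-star w e [] = w , e , ⊆-refl
  word-star w e (p ◅ ps) with word-step {l = silent} w e p
  ... | inj₁ (() , _)
  ... | inj₂ (inj₁ ())
  ... | inj₂ (inj₂ (x , w₁ , refl , _ , f)) with word-star w₁ f ps
  ... | w₂ , g , s = w₂ , g , ⊆-trans s (π-∷-⊆ _ x w₁)

  word-⟹ : ∀ {r P P′} w → P ≅ ctlP (C r) ∥ wrd w → Γ ⊢ P ⟹ P′ →
            ∃[ w₁ ] (P′ ≅ ctlP (C r) ∥ wrd w₁) × π r w₁ ⊆ π r w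
  word-⟹ w e (_ , ps , f) with word-star w e ps
  ... | w₁ , g , s = w₁ , ≅-trans (≅-sym f) g , s

  frozen-star : ∀ {r P P′} w → P ≅ ctlP (C r) ∥ frz w → _⟶τ*_ {Γ} P P′ →
                (P′ ≅ ctlP (C r) ∥ frz w) ⊎ (∃[ w₁ ] P′ ≅ ctlP (C r) ∥ wrd w₁)
  frozen-star w e [] = inj₁ e
  frozen-star w e (p ◅ ps) with ctx-inv {l = silent} e p
  ... | inj₁ (_ , spawn () , _)
  ... | inj₂ (_ , q , f) with stk-inv′ {K} {map ltr w} q
  ... | _ , erase , g with word-star w (≅-trans f (∥-cong ≅-refl g)) ps
  ... | w₁ , h , _ = inj₂ (w₁ , h)

  tame-C : ∀ {r} → Tame (C r) (λ _ → ⊤)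
  tame-C ()

  module _ (B : Rel Pr _) (sim : WeakSimulation Γ B) where

    follow : ∀ {P Q P′} → B P Q → _⟶τ*_ {Γ} P P′ → ∃[ Q′ ] (Γ ⊢ Q ⟹ Q′) × B P′ Q′
    follow b [] = _ , ⟹-refl ≅-refl , b
    follow b (p ◅ ps) with sim b p
    ... | _ , q , b₁ with follow b₁ ps
    ... | _ , q₁ , b₂ = _ , ⟹-trans q q₁ , b₂

    unreleased : ∀ {S c P P′ Q} → Tame c S → B P Q → Γ ⊢ P ⟶⟨ ⌜ vis (stk K) ⌝ ⟩ P′ →
                 In S c nothing Q → ⊥
    unreleased t b p i with sim b p
    ... | _ , q , _ = released-mute t i q

    -- Letters outside `r` are erased and those of `r` emitted. `C r` masks no letter of `r`, so the
    -- answer must come from the other word. As that word may also lose letters silently, one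
    -- direction gives only a sublist; antisymmetry later yields equality.
    word-sub : ∀ {r P Q} w′ w → B P Q → P ≅ ctlP (C r) ∥ wrd w′ → Q ≅ ctlP (C r) ∥ wrd w →
               π r w′ ⊆ π r w
    word-sub {r} [] w b e f = minimum (π r w)
    word-sub {r} (x ∷ w′) w b e f with channel x ≟ r
    word-sub {r} (x ∷ w′) w b e f | no ne with sim b (resp e (parʳ _ (stk-step (map ltr w′) erase)) ≅-refl)
    ... | Q′ , q , b₁ with word-⟹ w f q
    ... | w₁ , g , s = ⊆-trans (word-sub w′ w₁ b₁ ≅-refl g) s
    word-sub {r} (x ∷ w′) w b e f | yes c with sim b (resp e (parʳ _ (stk-step (map ltr w′) emit)) ≅-refl)
    ... | Q′ , (_ , _ , ps , p , qs) , b₁ with word-⟹ w f ps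
    ... | w₁ , g , s with word-step {l = vis (stk (ltr x))} w₁ g p
    ... | inj₁ (mask ne , _) = ⊥-elim (ne c)
    ... | inj₂ (inj₁ ())
    ... | inj₂ (inj₂ (_ , w₂ , refl , inj₁ () , h))
    ... | inj₂ (inj₂ (_ , w₂ , refl , inj₂ refl , h)) with word-⟹ w₂ h qs
    ... | w₃ , k , s₁ =
      ⊆-trans (refl ∷ ⊆-trans (word-sub w′ w₃ b₁ ≅-refl k) s₁)
        (subst (_⊆ π r w) (π-∷-in w₂ c) s)

    frozen-sub : ∀ {r P Q} w′ w → B P Q → P ≅ ctlP (C r) ∥ frz w′ → Q ≅ ctlP (C r) ∥ frz w →
                 π r w′ ⊆ π r w
    frozen-sub {r} w′ w b e f with sim b (resp e (parʳ _ (stk-step (map ltr w′) melt)) ≅-refl)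
    ... | _ , (_ , _ , (_ , ps , h) , p , qs) , b₁ with frozen-star w f ps
    ... | inj₂ (w₁ , g) =
      ⊥-elim (released-mute₁ tame-C (_ , word w₁ , ≅-trans (≅-sym h) g) p)
    ... | inj₁ g with ctx-inv {l = vis (stk K)} (≅-trans (≅-sym h) g) p
    ... | inj₁ (_ , () , _)
    ... | inj₂ (_ , q , k) with stk-inv′ {K} {map ltr w} q
    ... | _ , melt , k₁ with word-⟹ w (≅-trans k (∥-cong ≅-refl k₁)) qs
    ... | w₁ , k₂ , s = ⊆-trans (word-sub w′ w₁ b₁ ≅-refl k₂) s

  tame-TU : Tame TU (_≡ u₀)
  tame-TU TU-u = _ , refl , refl

  tame-T : Tame T (λ _ → ⊤)
  tame-T T-u = _ , refl , tt
  tame-T T-v = _ , refl , tt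

  tame-TU′ : Tame TU (λ _ → ⊤)
  tame-TU′ TU-u = _ , refl , tt

  call-reply : ∀ {P Q} → In (_≡ u₀) TU nothing P → Γ ⊢ P ⟹⟨ ⌜ vis (ctl TU) ⌝ ⟩ Q →
               ∃[ γ ] Generates u₀ γ × (In (_≡ u₀) TU (just γ) Q ⊎ In (_≡ u₀) TU nothing Q)
  call-reply i (_ , _ , ps , p , qs) = called (reduce (In-⟹ {k = nothing} tame-TU i ps)) p qs
    where
    called : ∀ {P Q R} → In (_≡ u₀) TU nothing P → Γ ⊢ P ⟶⟨ ⌜ vis (ctl TU) ⌝ ⟩ Q → Γ ⊢ Q ⟹ R →
             ∃[ γ ] Generates u₀ γ × (In (_≡ u₀) TU (just γ) R ⊎ In (_≡ u₀) TU nothing R)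
    called j p qs with next {k = nothing} {l = vis (ctl TU)} tame-TU j p
    ... | quiet () _
    ... | release () _ _
    ... | moved () refl _
    ... | call _ f with f refl
    ... | _ , γ , refl , g , j₁ = γ , g , In-⟹ {k = just γ} tame-TU j₁ qs

  melting : ∀ c w → Γ ⊢ ctlP c ∥ frz w ⟶⟨ ⌜ vis (stk K) ⌝ ⟩ ctlP c ∥ wrd w
  melting c w = parʳ _ (stk-step (map ltr w) melt)

  -- Played as a game: `TV` derives and freezes `γ′`, and `TU` can only answer by freezing some `γ`
  -- generated from `u₀`. That answer precedes the choice of `r`, so `agree` tests the same `γ` on
  -- each channel.
  ≈⇒covered : Γ ⊢ ctlP TV ≈ ctlP TU → ∀ γ′ → Generates v₀ γ′ → Covered γ′
  ≈⇒covered (B , (sim , sim′) , b₀) γ′ (g′ , w , v , d , f , refl)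
    with ⟹-respˡ (≅-sym (∥-idʳ _)) (spawns TV-v (derive d))
  ... | _ , ps , e with follow B sim b₀ ps
  ... | _ , qs , b₁ with sim b₁ (resp e (parʳ _ (stk-step (map ltr w) (stop f))) frozen-++)
    where
    frozen-++ : ctlP TV ∥ ⟦ (K ∷ map ltr v) ++ map ltr w ⟧ ≅ ctlP TV ∥ frz (v ++ w)
    frozen-++ rewrite map-++ ltr v w = ≅-refl
  ... | _ , q , b₂ with call-reply (reduce (In-⟹ {k = nothing} tame-TU (_ , word [] , ≅-sym (∥-idʳ _)) qs)) q
  ... | _ , _ , inj₂ i = ⊥-elim (unreleased B sim tame-TU b₂ (melting TV (v ++ w)) i)
  ... | γ , g , inj₁ i = γ , g , agree
    where
    agree : ∀ r → π r (v ++ w) ≡ π r γ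
    agree r with sim b₂ (parˡ _ (ctl-step (move TV-T)))
    ... | _ , q₁ , b₃ with In-move {c₁ = T} {k = just γ} tame-TU′ tame-T (λ ()) (In-map (λ _ → tt) (just γ) i) q₁
    ... | inj₂ j = ⊥-elim (unreleased B sim tame-T b₃ (melting T (v ++ w)) j)
    ... | inj₁ j with sim b₃ (parˡ _ (ctl-step (move (T-C r))))
    ... | _ , q₂ , b₄ with In-move {c₁ = C r} {k = just γ} tame-T tame-C (λ ()) j q₂
    ... | inj₂ k = ⊥-elim (unreleased B sim tame-C b₄ (melting (C r) (v ++ w)) k)
    -- The roles are swapped to get rid of `X`: the side of `γ` erases it silently, and the other
    -- side, a control process and one frozen word, can only wait or release its word. Releasing is
    -- refuted by `K`.
    ... | inj₁ (X , a , h)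
      with ⟹-respˡ h (⟹-map (ctlP (C r) ∥_) (parʳ _) (∥-cong ≅-refl)
             (⟹-trans (⟹-∥ˡ (frz γ) (loose-erase a)) (⟹-refl (∥-idˡ _))))
    ... | _ , qs₁ , h₁ with follow (flip B) sim′ b₄ qs₁
    ... | _ , (_ , ps₁ , h₂) , b₅ with frozen-star (v ++ w) ≅-refl ps₁
    ... | inj₁ h₃ =
      ⊆-antisym (frozen-sub B sim (v ++ w) γ b₅ (≅-trans (≅-sym h₂) h₃) h₁)
                (frozen-sub (flip B) sim′ γ (v ++ w) b₅ h₁ (≅-trans (≅-sym h₂) h₃))
    ... | inj₂ (w₁ , h₃) =
      ⊥-elim (unreleased (flip B) sim′ tame-C b₅ (resp h₁ (melting (C r) γ) ≅-refl)
        (_ , word w₁ , ≅-trans (≅-sym h₂) h₃))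

-- Register machine runs as tilings.

concatMap-pick : ∀ {A B : Set} (f : A → List B) {k ks} → k ∈ ks → Unique ks →
                 (∀ j → j ≢ k → f j ≡ []) → concatMap f ks ≡ f k
concatMap-pick f {k} (here refl) (k∉ ∷ _) f-else =
  trans (cong (f k ++_) (none k∉)) (++-identityʳ _)
  where
  none : ∀ {ks} → All (k ≢_) ks → concatMap f ks ≡ []
  none [] = refl
  none {j ∷ ks} (ne ∷ k∉) = cong₂ _++_ (f-else j (λ e → ne (sym e))) (none k∉)
concatMap-pick f {ks = j ∷ ks} (there m) (j∉ ∷ u) f-else =
  trans (cong (_++ concatMap f ks) (f-else j (All.lookup j∉ m))) (concatMap-pick f m u f-else)

data Instr (Q : Set) : Set where
  inc  : ℕ → Q → Instr Q
  test : ℕ → Q → Q → Instr Q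
  stop : Instr Q

-- A register holding x is written as mz, then x times ma, then a separator;
-- the mark mz makes the test for zero local.

data Mark : Set where
  mz ma : Mark

counter : ℕ → List Mark
counter x = mz ∷ replicate x ma

counter-injective : ∀ {x y} → counter x ≡ counter y → x ≡ y
counter-injective {x} {y} e =
  trans (sym (length-replicate x)) (trans (cong length (∷-injectiveʳ e)) (length-replicate y))

replicate-∷ʳ : ∀ {A : Set} x {y : A} → replicate x y ++ y ∷ [] ≡ replicate (suc x) y
replicate-∷ʳ zero = refl
replicate-∷ʳ (suc x) = cong (_ ∷_) (replicate-∷ʳ x)

counter-∷ʳma : ∀ {w} x → w ++ ma ∷ [] ≡ counter x → ∃[ y ] x ≡ suc y × w ≡ counter y
counter-∷ʳma {w} zero e with ∷ʳ-injectiveʳ w [] e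
... | ()
counter-∷ʳma {w} (suc x) e =
  x , refl , ∷ʳ-injectiveˡ w (counter x) (trans e (cong (mz ∷_) (sym (replicate-∷ʳ x))))

counter-∷ʳmz : ∀ {w} x → w ++ mz ∷ [] ≡ counter x → x ≡ 0
counter-∷ʳmz zero e = refl
counter-∷ʳmz {w} (suc x) e
  with ∷ʳ-injectiveʳ w (counter x) (trans e (cong (mz ∷_) (sym (replicate-∷ʳ x))))
... | ()

infix 20 _at_
_at_ : List Mark → ℕ → ℕ → List Mark
(w at r) r′ with r ℕ.≟ r′
... | yes _ = w
... | no _  = []

-- The erased and written marks are those just before the separators.

record Effect (Q : Set) : Set where
  constructor effect
  field
    target         : Q
    erased written : ℕ → List Mark

-- The branches of a test exclude each other: `true` takes away a final `ma`, while `false` requires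
-- the final mark to be `mz`, so that the register is zero, and writes it back.
effects : ∀ {Q} → Instr Q → Bool → Maybe (Effect Q)
effects (inc r q)    true  = just (effect q (λ _ → []) ((ma ∷ []) at r))
effects (inc r q)    false = nothing
effects (test r q p) true  = just (effect p ((ma ∷ []) at r) (λ _ → []))
effects (test r q p) false = just (effect q ((mz ∷ []) at r) ((mz ∷ []) at r))
effects stop         _     = nothing

State : Set
State = ℕ → ℕ

infixl 5 _[_≔_]
_[_≔_] : State → ℕ → ℕ → State
(σ [ r ≔ x ]) r′ with r ℕ.≟ r′
... | yes _ = x
... | no _  = σ r′

module Tiling {Q : Set} (instr : Q → Instr Q) (n : ℕ) (qₑ : Q) (qₑ-stop : instr qₑ ≡ stop) (goal : State) where

  data Sym : Set where
    mark  : Mark → Sym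
    sep $ : Sym
    state : Q → Sym

  data Track : Set where
    ctrl : Track
    reg  : Fin n → Track

  data Tile : Set where
    copy : Fin n → Mark → Tile
    step : Q → Bool → Tile

  marks : List Mark → List Sym
  marks = map mark

  when : Fin n → Fin n → List Sym → List Sym
  when i j w with i Fin.≟ j
  ... | yes _ = w
  ... | no _  = []

  -- Without an effect, the separator on the state track matches nothing.

  readsE writesE : Q → Maybe (Effect Q) → Track → List Sym
  readsE q nothing ctrl = sep ∷ []
  readsE q nothing (reg i) = []
  readsE q (just _) ctrl = state q ∷ []
  readsE q (just (effect _ e _)) (reg i) = marks (e (toℕ i)) ++ sep ∷ []
  writesE q nothing k = []
  writesE q (just (effect q′ _ _)) ctrl = state q′ ∷ []
  writesE q (just (effect _ _ w)) (reg i) = marks (w (toℕ i)) ++ sep ∷ []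

  reads writes : Tile → Track → List Sym
  reads (copy i m) ctrl    = []
  reads (copy i m) (reg j) = when i j (mark m ∷ [])
  reads (step q b) k       = readsE q (effects (instr q) b) k
  writes (copy i m) k = reads (copy i m) k
  writes (step q b) k = writesE q (effects (instr q) b) k

  U V : Track → List Tile → List Sym
  U k = concatMap (λ t → reads t k)
  V k = concatMap (λ t → writes t k)

  config : Q → State → Track → List Sym
  config q σ ctrl    = state q ∷ []
  config q σ (reg i) = marks (counter (σ (toℕ i))) ++ sep ∷ []

  -- Read against each other, the two sides spell a run from (q , σ) to
  -- (qₑ , goal): every configuration is read once and its successor is
  -- written.

  Solves : Q → State → List Tile → Set
  Solves q σ ts = ∀ k → config q σ k ++ V k ts ≡ U k ts ++ config qₑ goal k

  Solvable : Q → State → Set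
  Solvable q σ = ∃[ ts ] Solves q σ ts

  prefix : (Fin n → List Mark) → Track → List Sym
  prefix ws ctrl    = []
  prefix ws (reg i) = marks (ws i)

  copies : (Fin n → List Mark) → List Tile
  copies ws = concatMap (λ i → map (copy i) (ws i)) (allFin n)

  concatMap-++ : ∀ {A B : Set} (f : A → List B) xs ys → concatMap f (xs ++ ys) ≡ concatMap f xs ++ concatMap f ys
  concatMap-++ f [] ys = refl
  concatMap-++ f (x ∷ xs) ys = trans (cong (f x ++_) (concatMap-++ f xs ys)) (sym (++-assoc (f x) _ _))

  concatMap-concatMap : ∀ {A B C : Set} (f : B → List C) (g : A → List B) xs →
                        concatMap f (concatMap g xs) ≡ concatMap (λ x → concatMap f (g x)) xs
  concatMap-concatMap f g [] = refl
  concatMap-concatMap f g (x ∷ xs) =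
    trans (concatMap-++ f (g x) _) (cong (concatMap f (g x) ++_) (concatMap-concatMap f g xs))

  U-copies : ∀ ws k → U k (copies ws) ≡ prefix ws k
  U-copies ws ctrl = trans (concatMap-concatMap _ _ (allFin n)) (none (allFin n))
    where
    blank : ∀ i w → U ctrl (map (copy i) w) ≡ []
    blank i [] = refl
    blank i (m ∷ w) = blank i w
    none : ∀ is → concatMap (λ i → U ctrl (map (copy i) (ws i))) is ≡ []
    none [] = refl
    none (i ∷ is) = cong₂ _++_ (blank i (ws i)) (none is)
  U-copies ws (reg j) =
    trans (concatMap-concatMap _ _ (allFin n))
      (trans (concatMap-pick _ (∈-allFin j) (allFin-unique n) (λ i i≢j → other i≢j (ws i))) (own (ws j)))
    where
    other : ∀ {i} → i ≢ j → ∀ w → U (reg j) (map (copy i) w) ≡ []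
    other {i} i≢j [] = refl
    other {i} i≢j (m ∷ w) with i Fin.≟ j
    ... | yes e = ⊥-elim (i≢j e)
    ... | no _  = other i≢j w
    own : ∀ w → U (reg j) (map (copy j) w) ≡ marks w
    own [] = refl
    own (m ∷ w) with j Fin.≟ j
    ... | yes _ = cong (mark m ∷_) (own w)
    ... | no ne = ⊥-elim (ne refl)

  V-copies : ∀ ws k → V k (copies ws) ≡ prefix ws k
  V-copies ws k =
    trans (trans (concatMap-concatMap _ _ (allFin n))
      (trans (cong-concatMap (allFin n) (λ i → same i (ws i))) (sym (concatMap-concatMap _ _ (allFin n)))))
      (U-copies ws k)
    where
    same : ∀ i w → V k (map (copy i) w) ≡ U k (map (copy i) w)
    same i [] = refl
    same i (m ∷ w) = cong (reads (copy i m) k ++_) (same i w)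
    cong-concatMap : ∀ {f g : Fin n → List Sym} is → (∀ i → f i ≡ g i) → concatMap f is ≡ concatMap g is
    cong-concatMap [] e = refl
    cong-concatMap (i ∷ is) e = cong₂ _++_ (e i) (cong-concatMap is e)

  split-++ : ∀ u v (x : List Sym) → marks u ++ (marks v ++ sep ∷ []) ++ x ≡ marks (u ++ v) ++ sep ∷ x
  split-++ u v x = begin
    marks u ++ (marks v ++ sep ∷ []) ++ x ≡⟨ cong (marks u ++_) (++-assoc (marks v) _ x) ⟩
    marks u ++ marks v ++ sep ∷ x         ≡⟨ ++-assoc (marks u) (marks v) _ ⟨
    (marks u ++ marks v) ++ sep ∷ x       ≡⟨ cong (_++ sep ∷ x) (map-++ mark u v) ⟨
    marks (u ++ v) ++ sep ∷ x             ∎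
    where open ≡-Reasoning

  split-∷ʳ : ∀ u (x : List Sym) → (marks u ++ sep ∷ []) ++ x ≡ marks u ++ sep ∷ x
  split-∷ʳ u x = ++-assoc (marks u) _ x

  -- Marks contain no separator, so the first separators of both sides coincide.
  cut : ∀ u v {x y} → marks u ++ sep ∷ x ≡ marks v ++ sep ∷ y → u ≡ v × x ≡ y
  cut [] [] e = refl , ∷-injectiveʳ e
  cut (m ∷ u) (m′ ∷ v) e with ∷-injective e
  ... | refl , e′ with cut u v e′
  ... | refl , h = refl , h

  -- Copy tiles carry over the marks `ws` that the instruction leaves alone; one step tile then
  -- consumes the end of every register together with the state.
  run : ∀ {q σ σ′ b q′ e w} → effects (instr q) b ≡ just (effect q′ e w) → (ws : Fin n → List Mark) →
        (∀ i → ws i ++ e (toℕ i) ≡ counter (σ (toℕ i))) →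
        (∀ i → ws i ++ w (toℕ i) ≡ counter (σ′ (toℕ i))) →
        Solvable q′ σ′ → Solvable q σ
  run {q} {σ} {σ′} {b} {q′} {e} {w} eff ws before after (ts , sol) = copies ws ++ step q b ∷ ts , solves
    where
    open ≡-Reasoning
    Us : ∀ k → U k (copies ws ++ step q b ∷ ts) ≡ prefix ws k ++ reads (step q b) k ++ U k ts
    Us k = trans (concatMap-++ _ (copies ws) _) (cong (_++ U k (step q b ∷ ts)) (U-copies ws k))
    Vs : ∀ k → V k (copies ws ++ step q b ∷ ts) ≡ prefix ws k ++ writes (step q b) k ++ V k ts
    Vs k = trans (concatMap-++ _ (copies ws) _) (cong (_++ V k (step q b ∷ ts)) (V-copies ws k))
    solves : Solves q σ (copies ws ++ step q b ∷ ts)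
    solves k rewrite Us k | Vs k | eff = main k
      where
      main : ∀ k → config q σ k ++ prefix ws k ++ writesE q (just (effect q′ e w)) k ++ V k ts ≡
             (prefix ws k ++ readsE q (just (effect q′ e w)) k ++ U k ts) ++ config qₑ goal k
      main ctrl = cong (state q ∷_) (sol ctrl)
      main (reg i) = begin
        (marks (counter (σ r)) ++ sep ∷ []) ++ marks (ws i) ++ (marks (w r) ++ sep ∷ []) ++ V (reg i) ts
          ≡⟨ cong₂ _++_ (cong (λ u → marks u ++ sep ∷ []) (sym (before i))) (split-++ (ws i) (w r) _) ⟩
        (marks (ws i ++ e r) ++ sep ∷ []) ++ marks (ws i ++ w r) ++ sep ∷ V (reg i) ts
          ≡⟨ split-∷ʳ (ws i ++ e r) _ ⟩
        marks (ws i ++ e r) ++ sep ∷ (marks (ws i ++ w r) ++ sep ∷ V (reg i) ts)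
          ≡⟨ cong (λ u → marks (ws i ++ e r) ++ sep ∷ (marks u ++ sep ∷ V (reg i) ts)) (after i) ⟩
        marks (ws i ++ e r) ++ sep ∷ (marks (counter (σ′ r)) ++ sep ∷ V (reg i) ts)
          ≡⟨ cong (λ u → marks (ws i ++ e r) ++ sep ∷ u) (trans (sym (split-∷ʳ (counter (σ′ r)) _)) (sol (reg i))) ⟩
        marks (ws i ++ e r) ++ sep ∷ (U (reg i) ts ++ config qₑ goal (reg i))
          ≡⟨ ++-assoc (marks (ws i ++ e r)) _ _ ⟨
        (marks (ws i ++ e r) ++ sep ∷ U (reg i) ts) ++ config qₑ goal (reg i)
          ≡⟨ cong (_++ config qₑ goal (reg i)) (split-++ (ws i) (e r) _) ⟨
        (marks (ws i) ++ (marks (e r) ++ sep ∷ []) ++ U (reg i) ts) ++ config qₑ goal (reg i) ∎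
        where r = toℕ i

  -- Copy tiles for different registers may be interleaved arbitrarily; on the tracks only the marks
  -- copied for each register remain visible.
  data Parse (ts : List Tile) : Set where
    copied : ∀ ws → (∀ k → U k ts ≡ prefix ws k) → (∀ k → V k ts ≡ prefix ws k) → Parse ts
    stepped : ∀ ws q b ts′ →
              (∀ k → U k ts ≡ prefix ws k ++ reads (step q b) k ++ U k ts′) →
              (∀ k → V k ts ≡ prefix ws k ++ writes (step q b) k ++ V k ts′) → Parse ts

  parse : ∀ ts → Parse ts
  parse [] = copied (λ _ → []) (λ { ctrl → refl ; (reg i) → refl }) (λ { ctrl → refl ; (reg i) → refl })
  parse (step q b ∷ ts) =
    stepped (λ _ → []) q b ts (λ { ctrl → refl ; (reg i) → refl }) (λ { ctrl → refl ; (reg i) → refl })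
  parse (copy i m ∷ ts) = go (parse ts)
    where
    cons : (Fin n → List Mark) → Fin n → List Mark
    cons ws j with i Fin.≟ j
    ... | yes _ = m ∷ ws j
    ... | no _  = ws j
    prefix-cons : ∀ ws k → reads (copy i m) k ++ prefix ws k ≡ prefix (cons ws) k
    prefix-cons ws ctrl = refl
    prefix-cons ws (reg j) with i Fin.≟ j
    ... | yes _ = refl
    ... | no _  = refl
    extend : ∀ ws k {x y} → x ≡ prefix ws k ++ y → reads (copy i m) k ++ x ≡ prefix (cons ws) k ++ y
    extend ws k {y = y} e = trans (cong (reads (copy i m) k ++_) e)
      (trans (sym (++-assoc (reads (copy i m) k) _ _)) (cong (_++ y) (prefix-cons ws k)))
    go : Parse ts → Parse (copy i m ∷ ts)
    go (copied ws u v) = copied (cons ws)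
      (λ k → trans (cong (reads (copy i m) k ++_) (u k)) (prefix-cons ws k))
      (λ k → trans (cong (reads (copy i m) k ++_) (v k)) (prefix-cons ws k))
    go (stepped ws q b ts′ u v) =
      stepped (cons ws) q b ts′ (λ k → extend ws k (u k)) (λ k → extend ws k (v k))

  -- `rest` ranges over `σ′` because it is settled separately for each instruction which state the
  -- written marks spell.
  record Unrun (q : Q) (σ : State) : Set where
    constructor unrun
    field
      {branch}  : Bool
      {eff}     : Effect Q
      fires     : effects (instr q) branch ≡ just eff
      ws        : Fin n → List Mark
      before    : ∀ i → ws i ++ Effect.erased eff (toℕ i) ≡ counter (σ (toℕ i))
      rest      : ∀ σ′ → (∀ i → ws i ++ Effect.written eff (toℕ i) ≡ counter (σ′ (toℕ i))) →
                  Solvable (Effect.target eff) σ′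

  Ended : Q → State → Set
  Ended q σ = q ≡ qₑ × (∀ (i : Fin n) → σ (toℕ i) ≡ goal (toℕ i))

  unroll : ∀ {q σ} → Solvable q σ → Ended q σ ⊎ Unrun q σ
  unroll {q} {σ} (ts , sol) with parse ts
  ... | copied ws u v =
    inj₁ (halted (trans (sym (cong (state q ∷_) (v ctrl)))
           (trans (sol ctrl) (cong (_++ config qₑ goal ctrl) (u ctrl)))) , equal)
    where
    halted : state q ∷ [] ≡ state qₑ ∷ [] → q ≡ qₑ
    halted refl = refl
    equal : ∀ i → σ (toℕ i) ≡ goal (toℕ i)
    equal i with cut (counter (σ (toℕ i))) (ws i ++ counter (goal (toℕ i))) {marks (ws i)} {[]}
      (trans (sym (trans (cong (config q σ (reg i) ++_) (v (reg i))) (split-∷ʳ (counter (σ (toℕ i))) _)))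
        (trans (sol (reg i))
          (trans (cong (_++ config qₑ goal (reg i)) (u (reg i)))
            (trans (cong (marks (ws i) ++_) (sym (++-identityʳ _)))
              (split-++ (ws i) (counter (goal (toℕ i))) [])))))
    ... | e , h with ws i
    -- `h` equates the marks copied with what follows the only separator, which is nothing.
    ... | [] = counter-injective e
  ... | stepped ws q₁ b ts′ u v = go (effects (instr q₁) b) refl
    where
    sol′ : ∀ {E} → effects (instr q₁) b ≡ E → ∀ k →
           config q σ k ++ prefix ws k ++ writesE q₁ E k ++ V k ts′ ≡
           (prefix ws k ++ readsE q₁ E k ++ U k ts′) ++ config qₑ goal k
    sol′ refl k = trans (cong (config q σ k ++_) (sym (v k)))
      (trans (sol k) (cong (_++ config qₑ goal k) (u k)))
    go : ∀ E → effects (instr q₁) b ≡ E → Ended q σ ⊎ Unrun q σ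
    go nothing e with sol′ e ctrl
    ... | ()
    go (just (effect q′ er wr)) e with ∷-injectiveˡ (sol′ e ctrl)
    ... | refl = inj₂ (unrun e ws (λ i → sym (proj₁ (here-cut i))) (λ σ′ after → ts′ , rest σ′ after))
      where
      here-cut : ∀ i → counter (σ (toℕ i)) ≡ ws i ++ er (toℕ i) ×
                 marks (ws i) ++ (marks (wr (toℕ i)) ++ sep ∷ []) ++ V (reg i) ts′ ≡
                 U (reg i) ts′ ++ config qₑ goal (reg i)
      here-cut i = cut _ _
        (trans (sym (split-∷ʳ (counter (σ (toℕ i))) _))
          (trans (sol′ e (reg i))
            (trans (cong (_++ config qₑ goal (reg i)) (split-++ (ws i) (er (toℕ i)) _))
              (++-assoc (marks (ws i ++ er (toℕ i))) _ _))))
      rest : ∀ σ′ → (∀ i → ws i ++ wr (toℕ i) ≡ counter (σ′ (toℕ i))) → Solves q′ σ′ ts′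
      rest σ′ after ctrl = ∷-injectiveʳ (sol′ e ctrl)
      rest σ′ after (reg i) =
        trans (split-∷ʳ (counter (σ′ (toℕ i))) _)
          (trans (cong (λ x → marks x ++ sep ∷ V (reg i) ts′) (sym (after i)))
            (trans (sym (split-++ (ws i) (wr (toℕ i)) _)) (proj₂ (here-cut i))))

  infix 3 _⟺_
  _⟺_ : Set → Set → Set
  A ⟺ B = (A → B) × (B → A)

  -- An equivalence, here and for the tests, so that unsolvability too can be pulled back from the
  -- end of a halting run.
  solvable-inc : ∀ {q r q′ σ σ′} → instr q ≡ inc r q′ → (∀ s → σ′ s ≡ (σ [ r ≔ suc (σ r) ]) s) →
                 Solvable q σ ⟺ Solvable q′ σ′
  solvable-inc {q} {r} {q′} {σ} {σ′} h e = to , from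
    where
    add : ∀ s → counter (σ s) ++ ((ma ∷ []) at r) s ≡ counter (σ′ s)
    add s rewrite e s with r ℕ.≟ s
    ... | yes refl = cong (mz ∷_) (replicate-∷ʳ (σ s))
    ... | no _     = ++-identityʳ _
    from : Solvable q′ σ′ → Solvable q σ
    from = run {b = true} (cong (λ i → effects i true) h) (λ i → counter (σ (toℕ i)))
      (λ i → ++-identityʳ _) (λ i → add (toℕ i))
    to : Solvable q σ → Solvable q′ σ′
    to s with unroll s
    ... | inj₁ (refl , _) with trans (sym h) qₑ-stop
    ... | ()
    to s | inj₂ (unrun {b} f ws before rest) with trans (sym f) (cong (λ i → effects i b) h)
    to s | inj₂ (unrun {true} f ws before rest) | refl =
      rest σ′ (λ i → trans (cong (_++ ((ma ∷ []) at r) (toℕ i)) (trans (sym (++-identityʳ _)) (before i))) (add (toℕ i)))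

  at-self : ∀ w r → (w at r) r ≡ w
  at-self w r with r ℕ.≟ r
  ... | yes _ = refl
  ... | no ne = ⊥-elim (ne refl)

  module _ {q r p p′} (h : instr q ≡ test r p p′) (r<n : r < n) where

    private
      i₀ : Fin n
      i₀ = fromℕ< r<n

      at-i₀ : ∀ w → (w at r) (toℕ i₀) ≡ w
      at-i₀ w = trans (cong (w at r) (Fin.toℕ-fromℕ< r<n)) (at-self w r)

      not-ended : ∀ σ {A : Set} → Ended q σ → A
      not-ended _ (refl , _) with trans (sym h) qₑ-stop
      ... | ()

    solvable-zero : ∀ {σ σ′} → σ r ≡ 0 → (∀ s → σ′ s ≡ σ s) → Solvable q σ ⟺ Solvable p σ′
    solvable-zero {σ} {σ′} zr e = to , from
      where
      from : Solvable p σ′ → Solvable q σ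
      from = run {b = false} (cong (λ i → effects i false) h) ws keep
        (λ i → trans (keep i) (cong counter (sym (e (toℕ i)))))
        where
        -- On the tested track the step tile itself reads and rewrites `mz`, so nothing is copied
        -- there.
        ws : Fin n → List Mark
        ws i with r ℕ.≟ toℕ i
        ... | yes _ = []
        ... | no _  = counter (σ (toℕ i))
        keep : ∀ i → ws i ++ ((mz ∷ []) at r) (toℕ i) ≡ counter (σ (toℕ i))
        keep i with r ℕ.≟ toℕ i
        ... | yes refl = cong counter (sym zr)
        ... | no _     = ++-identityʳ _
      to : Solvable q σ → Solvable p σ′
      to s with unroll s
      ... | inj₁ x = not-ended σ x
      ... | inj₂ (unrun {b} f ws before rest) with trans (sym f) (cong (λ i → effects i b) h)
      to s | inj₂ (unrun {false} f ws before rest) | refl =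
        rest σ′ (λ i → trans (before i) (cong counter (sym (e (toℕ i)))))
      -- The wrong branch would have to find an `ma` at the end of an empty register. The bound on
      -- `r` provides the track on which this is seen.
      to s | inj₂ (unrun {true} f ws before rest) | refl
        with counter-∷ʳma {ws i₀} (σ r)
          (trans (cong (ws i₀ ++_) (sym (at-i₀ (ma ∷ []))))
            (trans (before i₀) (cong (λ s → counter (σ s)) (Fin.toℕ-fromℕ< r<n))))
      ... | y , e′ , _ with trans (sym zr) e′
      ... | ()

    solvable-suc : ∀ {σ σ′ x} → σ r ≡ suc x → (∀ s → σ′ s ≡ (σ [ r ≔ x ]) s) →
                   Solvable q σ ⟺ Solvable p′ σ′
    solvable-suc {σ} {σ′} {x} sr e = to , from
      where
      drop : ∀ s → counter (σ′ s) ++ ((ma ∷ []) at r) s ≡ counter (σ s)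
      drop s rewrite e s with r ℕ.≟ s
      ... | yes refl = trans (cong (mz ∷_) (replicate-∷ʳ x)) (cong counter (sym sr))
      ... | no _     = ++-identityʳ _
      from : Solvable p′ σ′ → Solvable q σ
      from = run {b = true} (cong (λ i → effects i true) h) (λ i → counter (σ′ (toℕ i)))
        (λ i → drop (toℕ i)) (λ i → ++-identityʳ _)
      to : Solvable q σ → Solvable p′ σ′
      to s with unroll s
      ... | inj₁ y = not-ended σ y
      ... | inj₂ (unrun {b} f ws before rest) with trans (sym f) (cong (λ i → effects i b) h)
      to s | inj₂ (unrun {true} f ws before rest) | refl =
        rest σ′ (λ i → trans (++-identityʳ _)
          (++-cancelʳ (((ma ∷ []) at r) (toℕ i)) (ws i) _ (trans (before i) (sym (drop (toℕ i))))))
      to s | inj₂ (unrun {false} f ws before rest) | refl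
        with counter-∷ʳmz {ws i₀} (σ r)
          (trans (cong (ws i₀ ++_) (sym (at-i₀ (mz ∷ []))))
            (trans (before i₀) (cong (λ s → counter (σ s)) (Fin.toℕ-fromℕ< r<n))))
      ... | e′ with trans (sym sr) e′
      ... | ()

  solvable-end : ∀ {σ} → Solvable qₑ σ ⟺ (∀ (i : Fin n) → σ (toℕ i) ≡ goal (toℕ i))
  solvable-end {σ} = to , from
    where
    to : Solvable qₑ σ → ∀ (i : Fin n) → σ (toℕ i) ≡ goal (toℕ i)
    to s with unroll s
    ... | inj₁ (_ , e) = e
    ... | inj₂ (unrun {b} f _ _ _) with trans (sym f) (cong (λ i → effects i b) qₑ-stop)
    ... | ()
    from : (∀ (i : Fin n) → σ (toℕ i) ≡ goal (toℕ i)) → Solvable qₑ σ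
    from e = [] , λ { ctrl → refl ; (reg i) → trans (++-identityʳ _) (cong (λ x → marks (counter x) ++ sep ∷ []) (e i)) }

-- A grammar for all stacks and a grammar for the faulty ones.

opaque
  ≟-from-list : ∀ {A : Set} (xs : List A) → (∀ x → x ∈ xs) → DecidableEquality A
  ≟-from-list xs x∈ x y with Any.index (x∈ x) Fin.≟ Any.index (x∈ y)
  ... | yes e = yes (trans (lookup-index (x∈ x)) (trans (cong (lookup xs) e) (sym (lookup-index (x∈ y)))))
  ... | no ne = no (λ { refl → ne refl })

splits : ∀ {A : Set} → List A → List (List A × A)
splits []       = []
splits (y ∷ ys) = ([] , y) ∷ map (λ (p , x) → y ∷ p , x) (splits ys)

∈-splits⁺ : ∀ {A : Set} p {y : A} {q} → (p , y) ∈ splits (p ++ y ∷ q)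
∈-splits⁺ []      = here refl
∈-splits⁺ (x ∷ p) = there (∈-map⁺ (λ (p , y) → x ∷ p , y) (∈-splits⁺ p))

∈-splits⁻ : ∀ {A : Set} {p} {y : A} xs → (p , y) ∈ splits xs → ∃[ q ] xs ≡ p ++ y ∷ q
∈-splits⁻ (x ∷ xs) (here refl) = xs , refl
∈-splits⁻ (x ∷ xs) (there m) with ∈-map⁻ (λ (p , y) → x ∷ p , y) m
... | _ , m′ , refl with ∈-splits⁻ xs m′
... | q , refl = q , refl

all-or-some : ∀ {A : Set} {P R : A → Set} → (∀ x → P x ⊎ R x) → ∀ xs → (∀ x → x ∈ xs → P x) ⊎ (∃[ x ] R x)
all-or-some f [] = inj₁ (λ _ ())
all-or-some f (x ∷ xs) with f x | all-or-some f xs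
... | inj₂ r | _       = inj₂ (x , r)
... | inj₁ p | inj₂ r  = inj₂ r
... | inj₁ p | inj₁ ps = inj₁ λ { _ (here refl) → p ; y (there m) → ps y m }

module Errors {Q : Set} (states : List Q) (state∈ : ∀ q → q ∈ states) (instr : Q → Instr Q)
              (R : ℕ) (q₀ qₑ : Q) (qₑ-stop : instr qₑ ≡ stop) (goal : State) where

  -- Registers 0 and 1 hold the input, so there are at least two.
  n : ℕ
  n = suc (suc R)

  open Tiling instr n qₑ qₑ-stop goal public

  data Chan : Set where
    tiles : Chan
    track : Track → Chan

  -- The letter tile nothing ends the list of tiles; it reads the final
  -- configuration and an end marker on each track, so that two different
  -- track contents always differ at some position of both.

  data Letter : Set where
    tile : Maybe Tile → Letter
    sym′ : Track → Sym → Letter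

  channel : Letter → Chan
  channel (tile t)   = tiles
  channel (sym′ k x) = track k

  syms : List Sym
  syms = mark mz ∷ mark ma ∷ sep ∷ $ ∷ map state states

  sym∈ : ∀ x → x ∈ syms
  sym∈ (mark mz) = here refl
  sym∈ (mark ma) = there (here refl)
  sym∈ sep = there (there (here refl))
  sym∈ $ = there (there (there (here refl)))
  sym∈ (state q) = there (there (there (there (∈-map⁺ state (state∈ q)))))

  tracks : List Track
  tracks = ctrl ∷ map reg (allFin n)

  track∈ : ∀ k → k ∈ tracks
  track∈ ctrl = here refl
  track∈ (reg i) = there (∈-map⁺ reg (∈-allFin i))

  tracks-unique : Unique tracks
  tracks-unique = fresh (allFin n) ∷ map-unique (λ { refl → refl }) (allFin-unique n)
    where
    fresh : ∀ is → All (ctrl ≢_) (map reg is)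
    fresh [] = []
    fresh (i ∷ is) = (λ ()) ∷ fresh is

  chans : List Chan
  chans = tiles ∷ map track tracks

  chan∈ : ∀ c → c ∈ chans
  chan∈ tiles = here refl
  chan∈ (track k) = there (∈-map⁺ track (track∈ k))

  infix 4 _≟ˢ_ _≟ᵗ_
  _≟ˢ_ : DecidableEquality Sym
  _≟ˢ_ = ≟-from-list syms sym∈

  _≟ᵗ_ : DecidableEquality Track
  _≟ᵗ_ = ≟-from-list tracks track∈

  stepTiles : List Tile
  stepTiles = concatMap (λ q → step q true ∷ step q false ∷ []) states

  allTiles : List Tile
  allTiles = concatMap (λ i → copy i mz ∷ copy i ma ∷ []) (allFin n) ++ stepTiles

  tile∈ : ∀ t → t ∈ allTiles
  tile∈ (copy i m) = ∈-++⁺ˡ (∈-concatMap⁺ (λ i → copy i mz ∷ copy i ma ∷ []) (Any.map (f m) (∈-allFin i)))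
    where
    f : ∀ m {j} → i ≡ j → copy i m ∈ copy j mz ∷ copy j ma ∷ []
    f mz refl = here refl
    f ma refl = there (here refl)
  tile∈ (step q b) =
    ∈-++⁺ʳ (concatMap (λ i → copy i mz ∷ copy i ma ∷ []) (allFin n))
      (∈-concatMap⁺ (λ q → step q true ∷ step q false ∷ []) (Any.map (f b) (state∈ q)))
    where
    f : ∀ b {p} → q ≡ p → step q b ∈ step p true ∷ step p false ∷ []
    f true refl = here refl
    f false refl = there (here refl)

  ends : List (Maybe Tile)
  ends = nothing ∷ map just allTiles

  end∈ : ∀ t → t ∈ ends
  end∈ nothing = here refl
  end∈ (just t) = there (∈-map⁺ just (tile∈ t))

  r₀ r₁ : Fin n
  r₀ = zero
  r₁ = suc zero

  -- The four letters that spell the input lead the list, so that their numbers are fixed; the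
  -- complete enumeration after them repeats them.
  letters : List Letter
  letters =
    sym′ (reg r₀) (mark mz) ∷ sym′ (reg r₀) (mark ma) ∷ sym′ (reg r₁) (mark mz) ∷ sym′ (reg r₁) (mark ma) ∷
    map tile ends ++ concatMap (λ k → map (sym′ k) syms) tracks

  letter∈ : ∀ x → x ∈ letters
  letter∈ (sym′ (reg zero) (mark mz)) = here refl
  letter∈ (sym′ (reg zero) (mark ma)) = there (here refl)
  letter∈ (sym′ (reg (suc zero)) (mark mz)) = there (there (here refl))
  letter∈ (sym′ (reg (suc zero)) (mark ma)) = there (there (there (here refl)))
  letter∈ (tile t) = there (there (there (there (∈-++⁺ˡ (∈-map⁺ tile (end∈ t))))))
  letter∈ (sym′ k x) =
    there (there (there (there (∈-++⁺ʳ (map tile ends)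
      (∈-concatMap⁺ (λ k → map (sym′ k) syms) (Any.map f (track∈ k)))))))
    where
    f : ∀ {j} → k ≡ j → sym′ k x ∈ map (sym′ j) syms
    f refl = ∈-map⁺ (sym′ k) (sym∈ x)

  layout : (Track → List Sym) → List Letter
  layout f = concatMap (λ k → map (sym′ k) (f k)) tracks

  reads′ : Maybe Tile → Track → List Sym
  reads′ nothing  k = config qₑ goal k ++ $ ∷ []
  reads′ (just t) k = reads t k

  U′ : Track → List (Maybe Tile) → List Sym
  U′ k = concatMap (λ t → reads′ t k)

  matched : Track → Maybe Tile → List Letter
  matched k t = tile t ∷ map (sym′ k) (reads′ t k)

  mismatched : Track → Maybe Tile → List Sym → Sym → List Letter
  mismatched k t p x = tile t ∷ map (sym′ k) p ++ sym′ k x ∷ []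

  written : Tile → List Letter
  written t = tile (just t) ∷ layout (writes t)

  bottom : List Letter
  bottom = tile nothing ∷ layout (λ _ → $ ∷ [])

  -- What the input lacks to an initial configuration: the state, the separators of registers 0 and
  -- 1, and zeros for the other registers. The input rule itself thus spells just two numbers in
  -- unary.
  suffixes : Track → List Sym
  suffixes ctrl             = state q₀ ∷ []
  suffixes (reg zero)         = sep ∷ []
  suffixes (reg (suc zero))    = sep ∷ []
  suffixes (reg (suc (suc i))) = mark mz ∷ sep ∷ []

  -- The words generated from any disagree, on some track, with what the
  -- tiles read; those generated from root hold all that the tiles write.

  data Nt : Set where
    any root body : Nt
    match         : Track → Nt

  nts : List Nt
  nts = any ∷ root ∷ body ∷ map match tracks

  nt∈ : ∀ g → g ∈ nts
  nt∈ any = here refl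
  nt∈ root = there (here refl)
  nt∈ body = there (there (here refl))
  nt∈ (match k) = there (there (there (∈-map⁺ match (track∈ k))))

  Prod : Set
  Prod = Maybe Nt × List Letter

  mismatchesAt : Track → Maybe Tile → List Sym × Sym → List Prod
  mismatchesAt k t (p , y) = map (λ x → just (match k) , mismatched k t p x) (filter (λ x → ¬? (x ≟ˢ y)) syms)

  mismatches : Track → Maybe Tile → List Prod
  mismatches k t = concatMap (mismatchesAt k t) (splits (reads′ t k))

  mismatchesOn : Track → List Prod
  mismatchesOn k = concatMap (mismatches k) ends

  growing : Letter → Prod
  growing x = just any , x ∷ []

  grows : List Prod
  grows = map growing letters

  -- Stacks grow from the bottom, so `any` first lays down what follows the error, then the tile at
  -- which it occurs; `match k` adds the tiles before it, which must read correctly.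
  prods : Nt → List Prod
  prods any       = grows ++ concatMap mismatchesOn tracks
  prods root      = (just body , bottom) ∷ []
  prods body      = (nothing , layout suffixes) ∷ map (λ t → just body , written t) allTiles
  prods (match k) = map (λ t → just (match k) , matched k t) ends

  -- From `any`, freezing is possible only after an error has been made. Stacks from `root` are
  -- frozen only through `nothing`, which puts the input on top.
  finals : Nt → List (List Letter)
  finals (match k) = [] ∷ []
  finals _         = []

  grammar : Grammar
  grammar = record
    { Letter = Letter ; Chan = Chan ; Nt = Nt
    ; letters = letters ; letter∈ = letter∈
    ; chans = chans ; chan∈ = chan∈ ; _≟_ = ≟-from-list chans chan∈ ; r₀ = tiles
    ; nts = nts ; nt∈ = nt∈ ; channel = channel ; prods = prods ; finals = finals
    ; u₀ = any ; v₀ = root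
    ; u₀-grow = λ x → ∈-++⁺ˡ (∈-map⁺ growing (letter∈ x)) }

  open Construction grammar public hiding (step)
  open Construction grammar using (step)

  tilesOf : List Letter → List (Maybe Tile)
  tilesOf []             = []
  tilesOf (tile t ∷ w)   = t ∷ tilesOf w
  tilesOf (sym′ k x ∷ w) = tilesOf w

  symsOf : Track → List Letter → List Sym
  symsOf k []           = []
  symsOf k (tile t ∷ w) = symsOf k w
  symsOf k (sym′ j x ∷ w) with j ≟ᵗ k
  ... | yes _ = x ∷ symsOf k w
  ... | no _  = symsOf k w

  π-tiles : ∀ w → π tiles w ≡ map tile (tilesOf w)
  π-tiles [] = refl
  π-tiles (tile t ∷ w) = trans (π-∷-in {x = tile t} w refl) (cong (tile t ∷_) (π-tiles w))
  π-tiles (sym′ k x ∷ w) = trans (π-∷-out {x = sym′ k x} w (λ ())) (π-tiles w)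

  π-track : ∀ k w → π (track k) w ≡ map (sym′ k) (symsOf k w)
  π-track k [] = refl
  π-track k (tile t ∷ w) = trans (π-∷-out {x = tile t} w (λ ())) (π-track k w)
  π-track k (sym′ j x ∷ w) with j ≟ᵗ k
  ... | yes refl = trans (π-∷-in {x = sym′ j x} w refl) (cong (sym′ j x ∷_) (π-track k w))
  ... | no ne    = trans (π-∷-out {x = sym′ j x} w (λ { refl → ne refl })) (π-track k w)

  tilesOf-++ : ∀ v w → tilesOf (v ++ w) ≡ tilesOf v ++ tilesOf w
  tilesOf-++ [] w = refl
  tilesOf-++ (tile t ∷ v) w = cong (t ∷_) (tilesOf-++ v w)
  tilesOf-++ (sym′ k x ∷ v) w = tilesOf-++ v w

  symsOf-++ : ∀ k v w → symsOf k (v ++ w) ≡ symsOf k v ++ symsOf k w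
  symsOf-++ k [] w = refl
  symsOf-++ k (tile t ∷ v) w = symsOf-++ k v w
  symsOf-++ k (sym′ j x ∷ v) w with j ≟ᵗ k
  ... | yes _ = cong (x ∷_) (symsOf-++ k v w)
  ... | no _  = symsOf-++ k v w

  tilesOf-syms : ∀ k w → tilesOf (map (sym′ k) w) ≡ []
  tilesOf-syms k [] = refl
  tilesOf-syms k (x ∷ w) = tilesOf-syms k w

  symsOf-self : ∀ k w → symsOf k (map (sym′ k) w) ≡ w
  symsOf-self k [] = refl
  symsOf-self k (x ∷ w) with k ≟ᵗ k
  ... | yes _ = cong (x ∷_) (symsOf-self k w)
  ... | no ne = ⊥-elim (ne refl)

  symsOf-other : ∀ {j k} → j ≢ k → ∀ w → symsOf k (map (sym′ j) w) ≡ []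
  symsOf-other j≢k [] = refl
  symsOf-other {j} {k} j≢k (x ∷ w) with j ≟ᵗ k
  ... | yes e = ⊥-elim (j≢k e)
  ... | no _  = symsOf-other j≢k w

  tilesOf-layout : ∀ f → tilesOf (layout f) ≡ []
  tilesOf-layout f = go tracks
    where
    go : ∀ ks → tilesOf (concatMap (λ k → map (sym′ k) (f k)) ks) ≡ []
    go [] = refl
    go (k ∷ ks) = trans (tilesOf-++ (map (sym′ k) (f k)) _) (cong₂ _++_ (tilesOf-syms k (f k)) (go ks))

  symsOf-layout : ∀ f k → symsOf k (layout f) ≡ f k
  symsOf-layout f k =
    trans (go tracks)
      (trans (concatMap-pick _ (track∈ k) tracks-unique (λ j j≢k → symsOf-other j≢k (f j))) (symsOf-self k (f k)))
    where
    go : ∀ ks → symsOf k (concatMap (λ k → map (sym′ k) (f k)) ks) ≡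
         concatMap (λ j → symsOf k (map (sym′ j) (f j))) ks
    go [] = refl
    go (j ∷ ks) = trans (symsOf-++ k (map (sym′ j) (f j)) _) (cong (symsOf k (map (sym′ j) (f j)) ++_) (go ks))

  Mismatch : Track → List (Maybe Tile) → List Sym → Set
  Mismatch k es w =
    ∃[ es₁ ] ∃[ t ] ∃[ es₂ ] ∃[ p ] ∃[ y ] ∃[ q ] ∃[ x ] ∃[ w₂ ]
      es ≡ es₁ ++ t ∷ es₂ × reads′ t k ≡ p ++ y ∷ q × w ≡ U′ k es₁ ++ p ++ x ∷ w₂ × x ≢ y

  Open : List Sym → Set
  Open = All (_≢ $)

  -- The end marker occurs in neither word, so a `w` that is too short differs from `p` where `$`
  -- follows it.
  strip : ∀ p w → Open p → Open w →
          (∃[ w₁ ] Open w₁ × w ≡ p ++ w₁) ⊎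
          (∃[ p₁ ] ∃[ y ] ∃[ p₂ ] ∃[ x ] ∃[ w₂ ] p ≡ p₁ ++ y ∷ p₂ × w ++ $ ∷ [] ≡ p₁ ++ x ∷ w₂ × x ≢ y)
  strip [] w op ow = inj₁ (w , ow , refl)
  strip (y ∷ p) [] (ne ∷ op) ow = inj₂ ([] , y , p , $ , [] , refl , refl , λ e → ne (sym e))
  strip (y ∷ p) (x ∷ w) (_ ∷ op) (_ ∷ ow) with x ≟ˢ y
  ... | no ne = inj₂ ([] , y , p , x , w ++ $ ∷ [] , refl , refl , ne)
  ... | yes refl with strip p w op ow
  ...   | inj₁ (w₁ , o , refl) = inj₁ (w₁ , o , refl)
  ...   | inj₂ (p₁ , y₁ , p₂ , x₁ , w₂ , refl , e , ne) =
    inj₂ (x ∷ p₁ , y₁ , p₂ , x₁ , w₂ , refl , cong (x ∷_) e , ne)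

  marks-open : ∀ w → Open (marks w)
  marks-open [] = []
  marks-open (m ∷ w) = (λ ()) ∷ marks-open w

  marks-sep-open : ∀ w → Open (marks w ++ sep ∷ [])
  marks-sep-open w = All-++⁺ (marks-open w) ((λ ()) ∷ [])

  config-open : ∀ q σ k → Open (config q σ k)
  config-open q σ ctrl = (λ ()) ∷ []
  config-open q σ (reg i) = marks-sep-open (counter (σ (toℕ i)))

  reads-open : ∀ t k → Open (reads t k)
  reads-open (copy i m) ctrl = []
  reads-open (copy i m) (reg j) with i Fin.≟ j
  ... | yes _ = (λ ()) ∷ []
  ... | no _  = []
  reads-open (step q b) k with effects (instr q) b
  reads-open (step q b) ctrl | nothing = (λ ()) ∷ []
  reads-open (step q b) (reg i) | nothing = []
  reads-open (step q b) ctrl | just _ = (λ ()) ∷ []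
  reads-open (step q b) (reg i) | just (effect _ e _) = marks-sep-open (e (toℕ i))

  writes-open : ∀ t k → Open (writes t k)
  writes-open (copy i m) k = reads-open (copy i m) k
  writes-open (step q b) k with effects (instr q) b
  writes-open (step q b) k | nothing = []
  writes-open (step q b) ctrl | just _ = (λ ()) ∷ []
  writes-open (step q b) (reg i) | just (effect _ _ w) = marks-sep-open (w (toℕ i))

  V-open : ∀ k ts → Open (V k ts)
  V-open k [] = []
  V-open k (t ∷ ts) = All-++⁺ (writes-open t k) (V-open k ts)

  compare : ∀ k ts w → Open w →
            (w ≡ U k ts ++ config qₑ goal k) ⊎ Mismatch k (map just ts ++ nothing ∷ []) (w ++ $ ∷ [])
  compare k [] w ow with strip (config qₑ goal k) w (config-open qₑ goal k) ow
  ... | inj₁ ([] , _ , e) = inj₁ (trans e (++-identityʳ _))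
  -- Surplus symbols clash with the `$` that the end tile reads after the final configuration.
  ... | inj₁ (x ∷ w₁ , ne ∷ _ , e) =
    inj₂ ([] , nothing , [] , config qₑ goal k , $ , [] , x , w₁ ++ $ ∷ [] , refl , refl ,
          trans (cong (_++ $ ∷ []) e) (++-assoc (config qₑ goal k) _ _) , ne)
  ... | inj₂ (p₁ , y , p₂ , x , w₂ , e , e′ , ne) =
    inj₂ ([] , nothing , [] , p₁ , y , p₂ ++ $ ∷ [] , x , w₂ , refl ,
          trans (cong (_++ $ ∷ []) e) (++-assoc p₁ _ _) , e′ , ne)
  compare k (t ∷ ts) w ow with strip (reads t k) w (reads-open t k) ow
  ... | inj₂ (p₁ , y , p₂ , x , w₂ , e , e′ , ne) =
    inj₂ ([] , just t , map just ts ++ nothing ∷ [] , p₁ , y , p₂ , x , w₂ , refl , e , e′ , ne)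
  ... | inj₁ (w₁ , ow₁ , refl) with compare k ts w₁ ow₁
  ...   | inj₁ refl = inj₁ (sym (++-assoc (reads t k) _ _))
  ...   | inj₂ (es₁ , t′ , es₂ , p , y , q , x , w₂ , e , e₁ , e₂ , ne) =
    inj₂ (just t ∷ es₁ , t′ , es₂ , p , y , q , x , w₂ , cong (just t ∷_) e , e₁ ,
          trans (++-assoc (reads t k) _ _)
            (trans (cong (reads t k ++_) e₂) (sym (++-assoc (reads t k) _ _))) , ne)

  input : ℕ → ℕ → State
  input x y 0 = x
  input x y 1 = y
  input x y _ = 0

  init : ℕ → ℕ → List Letter
  init x y = map (sym′ (reg r₀)) (marks (counter x)) ++ map (sym′ (reg r₁)) (marks (counter y))

  symsOf-init : ∀ x y k w → symsOf k (init x y ++ layout suffixes ++ w) ≡ config q₀ (input x y) k ++ symsOf k w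
  symsOf-init x y k w = begin
    symsOf k (init x y ++ layout suffixes ++ w)
      ≡⟨ symsOf-++ k (init x y) _ ⟩
    symsOf k (init x y) ++ symsOf k (layout suffixes ++ w)
      ≡⟨ cong₂ _++_ (symsOf-++ k (map (sym′ (reg r₀)) (marks (counter x))) _) (symsOf-++ k (layout suffixes) w) ⟩
    (symsOf k (map (sym′ (reg r₀)) (marks (counter x))) ++ symsOf k (map (sym′ (reg r₁)) (marks (counter y)))) ++
      symsOf k (layout suffixes) ++ symsOf k w
      ≡⟨ cong (λ u → (symsOf k (map (sym′ (reg r₀)) (marks (counter x))) ++
                      symsOf k (map (sym′ (reg r₁)) (marks (counter y)))) ++ u ++ symsOf k w)
           (symsOf-layout suffixes k) ⟩
    (symsOf k (map (sym′ (reg r₀)) (marks (counter x))) ++ symsOf k (map (sym′ (reg r₁)) (marks (counter y)))) ++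
      suffixes k ++ symsOf k w
      ≡⟨ cases k ⟩
    config q₀ (input x y) k ++ symsOf k w ∎
    where
    open ≡-Reasoning
    cases : ∀ k → (symsOf k (map (sym′ (reg r₀)) (marks (counter x))) ++ symsOf k (map (sym′ (reg r₁)) (marks (counter y)))) ++
                  suffixes k ++ symsOf k w ≡ config q₀ (input x y) k ++ symsOf k w
    cases ctrl = cong (_++ (state q₀ ∷ symsOf ctrl w)) (cong₂ _++_
      (symsOf-other {reg r₀} (λ ()) (marks (counter x))) (symsOf-other {reg r₁} (λ ()) (marks (counter y))))
    cases (reg zero) = trans (cong (_++ (sep ∷ symsOf (reg zero) w)) (trans (cong₂ _++_
      (symsOf-self (reg r₀) (marks (counter x))) (symsOf-other {reg r₁} (λ ()) (marks (counter y)))) (++-identityʳ _)))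
      (sym (split-∷ʳ (counter x) _))
    cases (reg (suc zero)) = trans (cong (_++ (sep ∷ symsOf (reg (suc zero)) w)) (cong₂ _++_
      (symsOf-other {reg r₀} (λ ()) (marks (counter x))) (symsOf-self (reg r₁) (marks (counter y)))))
      (sym (split-∷ʳ (counter y) _))
    cases (reg (suc (suc i))) = cong (_++ (mark mz ∷ sep ∷ symsOf (reg (suc (suc i))) w)) (cong₂ _++_
      (symsOf-other {reg r₀} (λ ()) (marks (counter x))) (symsOf-other {reg r₁} (λ ()) (marks (counter y))))

  candidate : ℕ → ℕ → List Tile → List Letter
  candidate x y ts = init x y ++ layout suffixes ++ concatMap written ts ++ bottom

  tilesOf-candidate : ∀ x y ts → tilesOf (candidate x y ts) ≡ map just ts ++ nothing ∷ []
  tilesOf-candidate x y ts =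
    trans (tilesOf-++ (init x y) _)
      (trans (cong₂ _++_
        (trans (tilesOf-++ (map (sym′ (reg r₀)) (marks (counter x))) _)
          (cong₂ _++_ (tilesOf-syms (reg r₀) (marks (counter x))) (tilesOf-syms (reg r₁) (marks (counter y)))))
        (trans (tilesOf-++ (layout suffixes) _) (cong₂ _++_ (tilesOf-layout suffixes) (go ts))))
      refl)
    where
    go : ∀ ts → tilesOf (concatMap written ts ++ bottom) ≡ map just ts ++ nothing ∷ []
    go [] = cong (nothing ∷_) (tilesOf-layout (λ _ → $ ∷ []))
    go (t ∷ ts) = cong (just t ∷_)
      (trans (cong tilesOf (++-assoc (layout (writes t)) _ _))
        (trans (tilesOf-++ (layout (writes t)) _) (cong₂ _++_ (tilesOf-layout (writes t)) (go ts))))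

  symsOf-candidate : ∀ x y ts k →
                     symsOf k (candidate x y ts) ≡ (config q₀ (input x y) k ++ V k ts) ++ $ ∷ []
  symsOf-candidate x y ts k =
    trans (symsOf-init x y k _)
      (trans (cong (config q₀ (input x y) k ++_) (go ts)) (sym (++-assoc (config q₀ (input x y) k) _ _)))
    where
    go : ∀ ts → symsOf k (concatMap written ts ++ bottom) ≡ V k ts ++ $ ∷ []
    go [] = symsOf-layout (λ _ → $ ∷ []) k
    go (t ∷ ts) =
      trans (cong (symsOf k) (++-assoc (layout (writes t)) _ _))
        (trans (symsOf-++ k (layout (writes t)) _)
          (trans (cong₂ _++_ (symsOf-layout (writes t) k) (go ts)) (sym (++-assoc (writes t k) _ _))))

  module _ (x y : ℕ) where

    open System (init x y)

    candidate-generated : ∀ ts → Generates root (candidate x y ts)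
    candidate-generated ts = nothing , _ , init x y , step (go ts) (here refl) , refl , refl
      where
      go : ∀ ts → Deriv root (just body) (concatMap written ts ++ bottom)
      go [] = subst (Deriv root (just body)) (++-identityʳ bottom) (step {v = bottom} start (here refl))
      go (t ∷ ts) = subst (Deriv root (just body)) (sym (++-assoc (written t) _ _))
        (step (go ts) (there (∈-map⁺ (λ t → just body , written t) (tile∈ t))))

    generated-candidate : ∀ {γ} → Generates root γ → ∃[ ts ] γ ≡ candidate x y ts
    generated-candidate (g , w , v , d , f , e) = final g (shape d) f e
      where
      Shape : Maybe Nt → List Letter → Set
      Shape (just root) w = w ≡ []
      Shape (just body) w = ∃[ ts ] w ≡ concatMap written ts ++ bottom
      Shape nothing     w = ∃[ ts ] w ≡ layout suffixes ++ concatMap written ts ++ bottom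
      Shape _           w = ⊥
      shape : ∀ {g w} → Deriv root g w → Shape g w
      shape start = refl
      shape (step {root} d (here refl)) with shape d
      ... | refl = [] , ++-identityʳ bottom
      shape (step {body} d (here refl)) with shape d
      ... | ts , refl = ts , refl
      shape (step {body} d (there m)) with shape d | ∈-map⁻ (λ t → just body , written t) m
      ... | ts , refl | t , _ , refl = t ∷ ts , sym (++-assoc (written t) _ _)
      shape (step {any} d m) with shape d
      ... | ()
      shape (step {match k} d m) with shape d
      ... | ()
      final : ∀ g {w v γ} → Shape g w → Final g v → γ ≡ v ++ w → ∃[ ts ] γ ≡ candidate x y ts
      final nothing (ts , refl) refl refl = ts , refl
      final (just any) () f e
      final (just (match k)) () f e
      final (just root) s () e
      final (just body) s () e

    -- It depends on the projections of `w` alone, hence passes to any word with the same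
    -- projections.
    Bad : Track → List Letter → Set
    Bad k w = symsOf k w ≢ U′ k (tilesOf w)

    match-bad : ∀ k t w → Bad k w → Bad k (matched k t ++ w)
    match-bad k t w bad e = bad (++-cancelˡ (reads′ t k) _ _
      (trans (sym (trans (symsOf-++ k (map (sym′ k) (reads′ t k)) w) (cong (_++ symsOf k w) (symsOf-self k (reads′ t k)))))
        (trans e (cong (λ ts → reads′ t k ++ U′ k ts)
          (trans (tilesOf-++ (map (sym′ k) (reads′ t k)) w) (cong (_++ tilesOf w) (tilesOf-syms k (reads′ t k))))))))

    symsOf-mismatched : ∀ k t p x w → symsOf k (mismatched k t p x ++ w) ≡ p ++ x ∷ symsOf k w
    symsOf-mismatched k t p x w =
      trans (symsOf-++ k (mismatched k t p x) w)
        (trans (cong (_++ symsOf k w) (trans (cong (symsOf k) (sym (map-++ (sym′ k) p (x ∷ [])))) (symsOf-self k (p ++ x ∷ []))))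
          (++-assoc p _ _))

    tilesOf-mismatched : ∀ k t p x w → tilesOf (mismatched k t p x ++ w) ≡ t ∷ tilesOf w
    tilesOf-mismatched k t p x w =
      trans (tilesOf-++ (mismatched k t p x) w)
        (cong (λ ts → t ∷ ts ++ tilesOf w)
          (trans (cong tilesOf (sym (map-++ (sym′ k) p (x ∷ [])))) (tilesOf-syms k (p ++ x ∷ []))))

    mismatched-bad : ∀ k t p {y q} x w → reads′ t k ≡ p ++ y ∷ q → x ≢ y → Bad k (mismatched k t p x ++ w)
    mismatched-bad k t p {y} {q} x w e ne h = ne (∷-injectiveˡ (++-cancelˡ p _ _
      (trans (sym (symsOf-mismatched k t p x w))
        (trans h (trans (cong (U′ k) (tilesOf-mismatched k t p x w))
          (trans (cong (_++ U′ k (tilesOf w)) e) (++-assoc p _ _)))))))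

    ∈-mismatches⁻ : ∀ {g v} → (g , v) ∈ concatMap mismatchesOn tracks →
                    ∃[ k ] ∃[ t ] ∃[ p ] ∃[ y ] ∃[ q ] ∃[ x ]
                      g ≡ just (match k) × v ≡ mismatched k t p x × reads′ t k ≡ p ++ y ∷ q × x ≢ y
    ∈-mismatches⁻ m with Any.satisfied (∈-concatMap⁻ mismatchesOn {xs = tracks} m)
    ... | k , m₁ with Any.satisfied (∈-concatMap⁻ (mismatches k) {xs = ends} m₁)
    ... | t , m₂ with find (∈-concatMap⁻ (mismatchesAt k t) {xs = splits (reads′ t k)} m₂)
    ... | (p , y) , s , m₃ with ∈-map⁻ (λ x → just (match k) , mismatched k t p x) m₃
    ... | x , m₄ , refl with ∈-splits⁻ (reads′ t k) s
    ... | q , e = k , t , p , y , q , x , refl , refl , e , proj₂ (∈-filter⁻ (λ x → ¬? (x ≟ˢ y)) {xs = syms} m₄)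

    ∈-mismatches⁺ : ∀ k t p {y q} x → reads′ t k ≡ p ++ y ∷ q → x ≢ y →
                    (just (match k) , mismatched k t p x) ∈ concatMap mismatchesOn tracks
    ∈-mismatches⁺ k t p {y} {q} x e ne =
      ∈-concatMap⁺ mismatchesOn (lose (track∈ k) (∈-concatMap⁺ (mismatches k) (lose (end∈ t)
        (∈-concatMap⁺ (mismatchesAt k t) (lose (subst (λ w → (p , y) ∈ splits w) (sym e) (∈-splits⁺ p))
          (∈-map⁺ (λ x → just (match k) , mismatched k t p x) (∈-filter⁺ (λ x → ¬? (x ≟ˢ y)) (sym∈ x) ne)))))))

    ∈-grows⁻ : ∀ {g v} → (g , v) ∈ grows → g ≡ just any
    ∈-grows⁻ m = go letters m
      where
      go : ∀ xs {g v} → (g , v) ∈ map growing xs → g ≡ just any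
      go (x ∷ xs) (here refl) = refl
      go (x ∷ xs) (there m) = go xs m

    generated-bad : ∀ {γ} → Generates any γ → ∃[ k ] Bad k γ
    generated-bad (g , w , v , d , f , e) = final g (shape d) f e
      where
      Shape : Maybe Nt → List Letter → Set
      Shape (just any)       w = ⊤
      Shape (just (match k)) w = Bad k w
      Shape _                w = ⊥
      grown : ∀ g w → g ≡ just any → Shape g w
      grown _ w refl = tt
      erred : ∀ g v w → ∃[ k ] ∃[ t ] ∃[ p ] ∃[ y ] ∃[ q ] ∃[ x ]
                g ≡ just (match k) × v ≡ mismatched k t p x × reads′ t k ≡ p ++ y ∷ q × x ≢ y →
              Shape g (v ++ w)
      erred _ _ w (k , t , p , y , q , x , refl , refl , e , ne) = mismatched-bad k t p x w e ne
      shape : ∀ {g w} → Deriv any g w → Shape g w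
      shape start = tt
      shape (step {any} {g} {w} {v} d m) =
        [ (λ m₁ → grown g (v ++ w) (∈-grows⁻ m₁)) , (λ m₁ → erred g v w (∈-mismatches⁻ m₁)) ]′ (∈-++⁻ grows m)
      shape (step {match k} {w = w} d m) with ∈-map⁻ (λ t → just (match k) , matched k t) m
      ... | t , _ , refl = match-bad k t w (shape d)
      shape (step {root} d m) with shape d
      ... | ()
      shape (step {body} d m) with shape d
      ... | ()
      final : ∀ g {w v γ} → Shape g w → Final g v → γ ≡ v ++ w → ∃[ k ] Bad k γ
      final (just (match k)) s (here refl) refl = k , s
      final nothing () f e
      final (just any) s () e
      final (just root) s () e
      final (just body) s () e

    same-tiles : ∀ {v w} → π tiles v ≡ π tiles w → tilesOf v ≡ tilesOf w
    same-tiles {v} {w} e = map-injective (λ { refl → refl }) (trans (sym (π-tiles v)) (trans e (π-tiles w)))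

    same-syms : ∀ {v w} k → π (track k) v ≡ π (track k) w → symsOf k v ≡ symsOf k w
    same-syms {v} {w} k e =
      map-injective (λ { refl → refl }) (trans (sym (π-track k v)) (trans e (π-track k w)))

    same-π : ∀ {v w} → tilesOf v ≡ tilesOf w → (∀ k → symsOf k v ≡ symsOf k w) → ∀ c → π c v ≡ π c w
    same-π {v} {w} e f tiles = trans (π-tiles v) (trans (cong (map tile) e) (sym (π-tiles w)))
    same-π {v} {w} e f (track k) =
      trans (π-track k v) (trans (cong (map (sym′ k)) (f k)) (sym (π-track k w)))

    U′-just : ∀ k ts → U′ k (map just ts ++ nothing ∷ []) ≡ (U k ts ++ config qₑ goal k) ++ $ ∷ []
    U′-just k [] = ++-identityʳ _
    U′-just k (t ∷ ts) = trans (cong (reads t k ++_) (U′-just k ts))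
      (trans (sym (++-assoc (reads t k) _ _)) (cong (_++ $ ∷ []) (sym (++-assoc (reads t k) _ _))))

    solution-uncovered : ∀ ts → Solves q₀ (input x y) ts → Covered (candidate x y ts) → ⊥
    solution-uncovered ts sol (γ , g , e) with generated-bad g
    ... | k , bad = bad (begin
      symsOf k γ                                        ≡⟨ same-syms {candidate x y ts} {γ} k (e (track k)) ⟨
      symsOf k (candidate x y ts)                       ≡⟨ symsOf-candidate x y ts k ⟩
      (config q₀ (input x y) k ++ V k ts) ++ $ ∷ []     ≡⟨ cong (_++ $ ∷ []) (sol k) ⟩
      (U k ts ++ config qₑ goal k) ++ $ ∷ []            ≡⟨ U′-just k ts ⟨
      U′ k (map just ts ++ nothing ∷ [])                ≡⟨ cong (U′ k) (tilesOf-candidate x y ts) ⟨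
      U′ k (tilesOf (candidate x y ts))                 ≡⟨ cong (U′ k) (same-tiles {candidate x y ts} {γ} (e tiles)) ⟩
      U′ k (tilesOf γ)                                  ∎)
      where open ≡-Reasoning

    mismatch-covered : ∀ ts k → Mismatch k (map just ts ++ nothing ∷ []) (symsOf k (candidate x y ts)) →
                       Covered (candidate x y ts)
    mismatch-covered ts k (es₁ , t , es₂ , p , y′ , q , x′ , w₂ , e , e₁ , e₂ , ne) =
      _ , (just (match k) , _ , [] , derivation es₁ , here refl , refl) ,
      same-π {candidate x y ts} {erroneous es₁} (sym (tiles-eq)) (λ j → sym (syms-eq j))
      where
      -- Everything that the error leaves open goes to the bottom, below the faulty tile. This is
      -- harmless, as the order of letters from different channels is invisible.
      others : Track → List Sym
      others j with j ≟ᵗ k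
      ... | yes _ = w₂
      ... | no _  = symsOf j (candidate x y ts)
      rest : List Letter
      rest = map tile es₂ ++ layout others
      tail : List Letter
      tail = mismatched k t p x′ ++ rest
      erroneous : List (Maybe Tile) → List Letter
      erroneous es = concatMap (matched k) es ++ tail
      derivation : ∀ es → Deriv any (just (match k)) (erroneous es)
      derivation [] = step (u₀-any rest) (∈-++⁺ʳ grows (∈-mismatches⁺ k t p x′ e₁ ne))
      derivation (t′ ∷ es) = subst (Deriv any (just (match k))) (sym (++-assoc (matched k t′) _ _))
        (step (derivation es) (∈-map⁺ (λ t → just (match k) , matched k t) (end∈ t′)))
      tiles-map : ∀ es → tilesOf (map tile es) ≡ es
      tiles-map [] = refl
      tiles-map (t ∷ es) = cong (t ∷_) (tiles-map es)
      syms-map : ∀ j es → symsOf j (map tile es) ≡ []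
      syms-map j [] = refl
      syms-map j (t ∷ es) = syms-map j es
      tiles-rest : tilesOf rest ≡ es₂
      tiles-rest = trans (tilesOf-++ (map tile es₂) _)
        (trans (cong₂ _++_ (tiles-map es₂) (tilesOf-layout others)) (++-identityʳ _))
      syms-rest : ∀ j → symsOf j rest ≡ others j
      syms-rest j = trans (symsOf-++ j (map tile es₂) _)
        (cong₂ _++_ (syms-map j es₂) (symsOf-layout others j))
      tiles-err : ∀ es → tilesOf (erroneous es) ≡ es ++ t ∷ es₂
      tiles-err [] = trans (tilesOf-mismatched k t p x′ rest) (cong (t ∷_) tiles-rest)
      tiles-err (t′ ∷ es) =
        cong (t′ ∷_)
          (trans (cong tilesOf (++-assoc (map (sym′ k) (reads′ t′ k)) _ _))
            (trans (tilesOf-++ (map (sym′ k) (reads′ t′ k)) _)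
              (cong₂ _++_ (tilesOf-syms k (reads′ t′ k)) (tiles-err es))))
      tiles-eq : tilesOf (erroneous es₁) ≡ tilesOf (candidate x y ts)
      tiles-eq = trans (tiles-err es₁) (trans (sym e) (sym (tilesOf-candidate x y ts)))
      own : others k ≡ w₂
      own with k ≟ᵗ k
      ... | yes _ = refl
      ... | no ne = ⊥-elim (ne refl)
      syms-own : ∀ es → symsOf k (erroneous es) ≡ U′ k es ++ p ++ x′ ∷ w₂
      syms-own [] = trans (symsOf-mismatched k t p x′ rest) (cong (λ u → p ++ x′ ∷ u) (trans (syms-rest k) own))
      syms-own (t′ ∷ es) =
        trans (cong (symsOf k) (++-assoc (map (sym′ k) (reads′ t′ k)) _ _))
          (trans (symsOf-++ k (map (sym′ k) (reads′ t′ k)) _)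
            (trans (cong₂ _++_ (symsOf-self k (reads′ t′ k)) (syms-own es)) (sym (++-assoc (reads′ t′ k) _ _))))
      syms-else : ∀ {j} → k ≢ j → ∀ es → symsOf j (erroneous es) ≡ others j
      syms-else {j} k≢j [] =
        trans (symsOf-++ j (mismatched k t p x′) rest)
          (cong₂ _++_
            (trans (cong (symsOf j) (sym (map-++ (sym′ k) p (x′ ∷ [])))) (symsOf-other k≢j (p ++ x′ ∷ [])))
            (syms-rest j))
      syms-else {j} k≢j (t′ ∷ es) =
        trans (cong (symsOf j) (++-assoc (map (sym′ k) (reads′ t′ k)) _ _))
          (trans (symsOf-++ j (map (sym′ k) (reads′ t′ k)) _)
            (cong₂ _++_ (symsOf-other k≢j (reads′ t′ k)) (syms-else k≢j es)))
      others-else : ∀ {j} → k ≢ j → others j ≡ symsOf j (candidate x y ts)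
      others-else {j} k≢j with j ≟ᵗ k
      ... | yes e = ⊥-elim (k≢j (sym e))
      ... | no _  = refl
      syms-eq : ∀ j → symsOf j (erroneous es₁) ≡ symsOf j (candidate x y ts)
      syms-eq j with k ≟ᵗ j
      ... | yes refl = trans (syms-own es₁) (sym e₂)
      ... | no k≢j = trans (syms-else k≢j es₁) (others-else k≢j)

    -- There are finitely many tracks and `compare` decides each, so the faulty one is found
    -- constructively.
    unsolvable⇒covered : (Solvable q₀ (input x y) → ⊥) → ∀ γ′ → Generates root γ′ → Covered γ′
    unsolvable⇒covered unsolvable γ′ g with generated-candidate g
    ... | ts , refl with all-or-some check tracks
      where
      check : ∀ k → (config q₀ (input x y) k ++ V k ts ≡ U k ts ++ config qₑ goal k) ⊎
                    Mismatch k (map just ts ++ nothing ∷ []) (symsOf k (candidate x y ts))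
      check k with compare k ts (config q₀ (input x y) k ++ V k ts) (All-++⁺ (config-open q₀ (input x y) k) (V-open k ts))
      ... | inj₁ e = inj₁ e
      ... | inj₂ m = inj₂ (subst (Mismatch k _) (sym (symsOf-candidate x y ts k)) m)
    ... | inj₁ all = ⊥-elim (unsolvable (ts , λ k → all k (track∈ k)))
    ... | inj₂ (k , m) = mismatch-covered ts k m

    covered⇒unsolvable : (∀ γ′ → Generates root γ′ → Covered γ′) → Solvable q₀ (input x y) → ⊥
    covered⇒unsolvable cov (ts , sol) =
      solution-uncovered ts sol (cov (candidate x y ts) (candidate-generated ts))

-- Loop programs and their machine code.

infixr 5 _⨾_

data Cmd : Set where
  inc dec : ℕ → Cmd
  _⨾_     : Cmd → Cmd → Cmd
  loop    : ℕ → Cmd → Cmd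

data Exec : Cmd → State → State → Set where
  inc  : ∀ {r σ} → Exec (inc r) σ (σ [ r ≔ suc (σ r) ])
  dec  : ∀ {r σ} → Exec (dec r) σ (σ [ r ≔ pred (σ r) ])
  _⨾_  : ∀ {p q σ σ₁ σ₂} → Exec p σ σ₁ → Exec q σ₁ σ₂ → Exec (p ⨾ q) σ σ₂
  end  : ∀ {r p σ} → σ r ≡ 0 → Exec (loop r p) σ σ
  more : ∀ {r p σ σ₁ σ₂ x} → σ r ≡ suc x → Exec p (σ [ r ≔ x ]) σ₁ → Exec (loop r p) σ₁ σ₂ →
         Exec (loop r p) σ σ₂

Label : Cmd → Set
Label (inc r)    = ⊤
Label (dec r)    = ⊤
Label (p ⨾ q)    = Label p ⊎ Label q
Label (loop r p) = Maybe (Label p)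

entry : ∀ p → Label p
entry (inc r)    = tt
entry (dec r)    = tt
entry (p ⨾ q)    = inj₁ (entry p)
entry (loop r p) = nothing

labels : ∀ p → List (Label p)
labels (inc r)    = tt ∷ []
labels (dec r)    = tt ∷ []
labels (p ⨾ q)    = map inj₁ (labels p) ++ map inj₂ (labels q)
labels (loop r p) = nothing ∷ map just (labels p)

label∈ : ∀ p l → l ∈ labels p
label∈ (inc r) tt = here refl
label∈ (dec r) tt = here refl
label∈ (p ⨾ q) (inj₁ l) = ∈-++⁺ˡ (∈-map⁺ inj₁ (label∈ p l))
label∈ (p ⨾ q) (inj₂ l) = ∈-++⁺ʳ (map inj₁ (labels p)) (∈-map⁺ inj₂ (label∈ q l))
label∈ (loop r p) nothing = here refl
label∈ (loop r p) (just l) = there (∈-map⁺ just (label∈ p l))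

mapᴵ : ∀ {A B : Set} → (A → B) → Instr A → Instr B
mapᴵ f (inc r q)    = inc r (f q)
mapᴵ f (test r q p) = test r (f q) (f p)
mapᴵ f stop         = stop

mapᴵ-∘ : ∀ {A B C : Set} (g : B → C) (f : A → B) i → mapᴵ g (mapᴵ f i) ≡ mapᴵ (λ x → g (f x)) i
mapᴵ-∘ g f (inc r q)    = refl
mapᴵ-∘ g f (test r q p) = refl
mapᴵ-∘ g f stop         = refl

-- The label nothing is the exit of the command.

inFirst : ∀ p q → Maybe (Label p) → Maybe (Label (p ⨾ q))
inFirst p q (just l) = just (inj₁ l)
inFirst p q nothing  = just (inj₂ (entry q))

inSecond : ∀ p q → Maybe (Label q) → Maybe (Label (p ⨾ q))
inSecond p q = Maybe.map inj₂

inBody : ∀ r p → Maybe (Label p) → Maybe (Label (loop r p))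
inBody r p l = just l

code : ∀ p → Label p → Instr (Maybe (Label p))
code (inc r)    tt       = inc r nothing
code (dec r)    tt       = test r nothing nothing
code (p ⨾ q)    (inj₁ l) = mapᴵ (inFirst p q) (code p l)
code (p ⨾ q)    (inj₂ l) = mapᴵ (inSecond p q) (code q l)
code (loop r p) nothing  = test r nothing (just (just (entry p)))
code (loop r p) (just l) = mapᴵ (inBody r p) (code p l)

-- Only a tested register has to have a track.
Within : ℕ → Cmd → Set
Within n (inc r)    = ⊤
Within n (dec r)    = r < n
Within n (p ⨾ q)    = Within n p × Within n q
Within n (loop r p) = r < n × Within n p

width : Cmd → ℕ
width (inc r)    = 0
width (dec r)    = suc r
width (p ⨾ q)    = width p ⊔ width q
width (loop r p) = suc r ⊔ width p

within : ∀ p {n} → width p ≤ n → Within n p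
within (inc r) h = tt
within (dec r) h = h
within (p ⨾ q) h = within p (ℕ.m⊔n≤o⇒m≤o (width p) _ h) , within q (ℕ.m⊔n≤o⇒n≤o (width p) _ h)
within (loop r p) h = ℕ.m⊔n≤o⇒m≤o (suc r) (width p) h , within p (ℕ.m⊔n≤o⇒n≤o (suc r) _ h)

≔-same : ∀ σ r x → (σ [ r ≔ x ]) r ≡ x
≔-same σ r x with r ℕ.≟ r
... | yes _ = refl
... | no ne = ⊥-elim (ne refl)

≔-other : ∀ σ {r} x {s} → s ≢ r → (σ [ r ≔ x ]) s ≡ σ s
≔-other σ {r} x {s} ne with r ℕ.≟ s
... | yes e = ⊥-elim (ne (sym e))
... | no _  = refl

module Running {Q : Set} (instr : Q → Instr Q) (n : ℕ) (qₑ : Q) (qₑ-stop : instr qₑ ≡ stop) (goal : State) where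

  open Tiling instr n qₑ qₑ-stop goal

  -- `φ` places the code of `p` anywhere in the machine and sends its exit to wherever the context
  -- continues. It is generalised since each subcommand needs a placement of its own.
  Embeds : ∀ p → (Maybe (Label p) → Q) → Set
  Embeds p φ = ∀ l → instr (φ (just l)) ≡ mapᴵ φ (code p l)

  ⟺-trans : ∀ {A B C : Set} → A ⟺ B → B ⟺ C → A ⟺ C
  ⟺-trans (f , f′) (g , g′) = (λ x → g (f x)) , (λ x → f′ (g′ x))

  exec-solvable : ∀ {p σ σ′} → Exec p σ σ′ → Within n p → ∀ φ → Embeds p φ →
                  Solvable (φ (just (entry p))) σ ⟺ Solvable (φ nothing) σ′
  exec-solvable inc wi φ emb = solvable-inc (emb tt) (λ s → refl)
  exec-solvable (dec {r} {σ}) wi φ emb = go (σ r) refl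
    where
    go : ∀ x → σ r ≡ x → Solvable (φ (just tt)) σ ⟺ Solvable (φ nothing) (σ [ r ≔ pred (σ r) ])
    go zero e = solvable-zero (emb tt) wi e same
      where
      same : ∀ s → (σ [ r ≔ pred (σ r) ]) s ≡ σ s
      same s with r ℕ.≟ s
      ... | yes refl = trans (cong pred e) (sym e)
      ... | no _     = refl
    go (suc x) e = solvable-suc (emb tt) wi e (λ s → cong (λ y → (σ [ r ≔ pred y ]) s) e)
  exec-solvable (_⨾_ {p} {q} d e) (wp , wq) φ emb =
    ⟺-trans
      (exec-solvable d wp (λ l → φ (inFirst p q l)) (λ l → trans (emb (inj₁ l)) (mapᴵ-∘ φ (inFirst p q) (code p l))))
      (exec-solvable e wq (λ l → φ (inSecond p q l)) (λ l → trans (emb (inj₂ l)) (mapᴵ-∘ φ (inSecond p q) (code q l))))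
  exec-solvable (end z) (wr , _) φ emb = solvable-zero (emb nothing) wr z (λ s → refl)
  exec-solvable (more {r} {p} z d e) (wr , wp) φ emb =
    ⟺-trans (solvable-suc (emb nothing) wr z (λ s → refl))
      (⟺-trans
        (exec-solvable d wp (λ l → φ (inBody r p l)) (λ l → trans (emb (just l)) (mapᴵ-∘ φ (inBody r p) (code p l))))
        (exec-solvable e (wr , wp) φ emb))

-- Compiling recursive functions into loop programs.

Yields : Cmd → ℕ → ℕ → State → Set
Yields p b y σ = ∃[ σ′ ] Exec p σ σ′ × σ′ b ≡ y × (∀ s → s < b → σ′ s ≡ σ s)

clear : ℕ → Cmd
clear r = loop r (dec r)

clear-exec : ∀ r σ → ∃[ σ′ ] Exec (clear r) σ σ′ × σ′ r ≡ 0 × (∀ s → s ≢ r → σ′ s ≡ σ s)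
clear-exec r σ = go (σ r) σ ℕ.≤-refl
  where
  go : ∀ k σ → σ r ≤ k → ∃[ σ′ ] Exec (clear r) σ σ′ × σ′ r ≡ 0 × (∀ s → s ≢ r → σ′ s ≡ σ s)
  go k σ h with σ r in e
  go k σ h | zero = σ , end e , e , λ s _ → refl
  go (suc k) σ (s≤s h) | suc x with go k (σ [ r ≔ x ] [ r ≔ pred ((σ [ r ≔ x ]) r) ])
    (ℕ.≤-trans (ℕ.≤-reflexive (trans (≔-same (σ [ r ≔ x ]) r _) (cong pred (≔-same σ r x))))
      (ℕ.≤-trans ℕ.pred[n]≤n h))
  ... | σ′ , d , e′ , keep =
    σ′ , more e dec d , e′ , λ s ne → trans (keep s ne) (trans (≔-other (σ [ r ≔ x ]) _ ne) (≔-other σ x ne))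

move : ℕ → ℕ → Cmd
move r t = loop r (inc t)

move-exec : ∀ {r t} → r ≢ t → ∀ σ →
            ∃[ σ′ ] Exec (move r t) σ σ′ × σ′ r ≡ 0 × σ′ t ≡ σ r + σ t × (∀ s → s ≢ r → s ≢ t → σ′ s ≡ σ s)
move-exec {r} {t} r≢t σ = go (σ r) σ refl
  where
  go : ∀ k σ → σ r ≡ k →
       ∃[ σ′ ] Exec (move r t) σ σ′ × σ′ r ≡ 0 × σ′ t ≡ k + σ t × (∀ s → s ≢ r → s ≢ t → σ′ s ≡ σ s)
  go zero σ e = σ , end e , e , refl , λ s _ _ → refl
  go (suc k) σ e with go k (σ [ r ≔ k ] [ t ≔ suc ((σ [ r ≔ k ]) t) ])
    (trans (≔-other (σ [ r ≔ k ]) _ r≢t) (≔-same σ r k))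
  ... | σ′ , d , z , v , keep =
    σ′ , more e inc d , z ,
    trans v (trans (cong (k +_) (trans (≔-same (σ [ r ≔ k ]) t _) (cong suc (≔-other σ k (λ h → r≢t (sym h))))))
      (ℕ.+-suc k (σ t))) ,
    λ s s≢r s≢t → trans (keep s s≢r s≢t) (trans (≔-other (σ [ r ≔ k ]) _ s≢t) (≔-other σ k s≢r))

spread-exec : ∀ {r t u} → r ≢ t → r ≢ u → t ≢ u → ∀ σ →
              ∃[ σ′ ] Exec (loop r (inc t ⨾ inc u)) σ σ′ × σ′ r ≡ 0 × σ′ t ≡ σ r + σ t × σ′ u ≡ σ r + σ u ×
                (∀ s → s ≢ r → s ≢ t → s ≢ u → σ′ s ≡ σ s)
spread-exec {r} {t} {u} r≢t r≢u t≢u σ = go (σ r) σ refl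
  where
  go : ∀ k σ → σ r ≡ k →
       ∃[ σ′ ] Exec (loop r (inc t ⨾ inc u)) σ σ′ × σ′ r ≡ 0 × σ′ t ≡ k + σ t × σ′ u ≡ k + σ u ×
         (∀ s → s ≢ r → s ≢ t → s ≢ u → σ′ s ≡ σ s)
  go zero σ e = σ , end e , e , refl , refl , λ s _ _ _ → refl
  go (suc k) σ e = σ′ , more e (inc ⨾ inc) d , z ,
    trans v (trans (cong (k +_)
      (trans (≔-other σ₂ _ t≢u) (trans (≔-same σ₁ t _) (cong suc (≔-other σ k (λ h → r≢t (sym h)))))))
      (ℕ.+-suc k _)) ,
    trans w (trans (cong (k +_)
      (trans (≔-same σ₂ u _)
        (cong suc (trans (≔-other σ₁ _ (λ h → t≢u (sym h))) (≔-other σ k (λ h → r≢u (sym h)))))))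
      (ℕ.+-suc k _)) ,
    λ s s≢r s≢t s≢u → trans (keep s s≢r s≢t s≢u)
      (trans (≔-other σ₂ _ s≢u) (trans (≔-other σ₁ _ s≢t) (≔-other σ k s≢r)))
    where
    σ₁ = σ [ r ≔ k ]
    σ₂ = σ₁ [ t ≔ suc (σ₁ t) ]
    rec = go k (σ₂ [ u ≔ suc (σ₂ u) ]) (trans (≔-other σ₂ _ r≢u) (trans (≔-other σ₁ _ r≢t) (≔-same σ r k)))
    σ′ = proj₁ rec
    d = proj₁ (proj₂ rec)
    z = proj₁ (proj₂ (proj₂ rec))
    v = proj₁ (proj₂ (proj₂ (proj₂ rec)))
    w = proj₁ (proj₂ (proj₂ (proj₂ (proj₂ rec))))
    keep = proj₂ (proj₂ (proj₂ (proj₂ (proj₂ rec))))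

-- Reading a register destroys it, so a second copy is made in `suc b` and moved back.
copying : ℕ → ℕ → Cmd
copying r b = clear b ⨾ clear (suc b) ⨾ loop r (inc b ⨾ inc (suc b)) ⨾ move (suc b) r

copying-exec : ∀ {r b} → r < b → ∀ σ → Yields (copying r b) b (σ r) σ
copying-exec {r} {b} r<b σ
  with clear-exec b σ
... | σ₁ , d₁ , z₁ , k₁ with clear-exec (suc b) σ₁
... | σ₂ , d₂ , z₂ , k₂
  with spread-exec {r} {b} {suc b} (ℕ.<⇒≢ r<b) (ℕ.<⇒≢ (ℕ.m<n⇒m<1+n r<b)) (ℕ.<⇒≢ (ℕ.n<1+n b)) σ₂
... | σ₃ , d₃ , z₃ , t₃ , u₃ , k₃ with move-exec {suc b} {r} (λ h → ℕ.<⇒≢ (ℕ.m<n⇒m<1+n r<b) (sym h)) σ₃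
... | σ₄ , d₄ , z₄ , t₄ , k₄ = σ₄ , d₁ ⨾ d₂ ⨾ d₃ ⨾ d₄ , value , keep
  where
  low : ∀ s → s < b → σ₂ s ≡ σ s
  low s h = trans (k₂ s (ℕ.<⇒≢ (ℕ.m<n⇒m<1+n h))) (k₁ s (ℕ.<⇒≢ h))
  b≢ : b ≢ suc b
  b≢ = ℕ.<⇒≢ (ℕ.n<1+n b)
  value : σ₄ b ≡ σ r
  value = trans (k₄ b b≢ (λ h → ℕ.<⇒≢ r<b (sym h)))
    (trans t₃ (trans (cong₂ _+_ (low r r<b) (trans (k₂ b b≢) z₁)) (ℕ.+-identityʳ _)))
  keep : ∀ s → s < b → σ₄ s ≡ σ s
  keep s h with s ℕ.≟ r
  ... | yes refl = trans t₄ (trans (cong₂ _+_ (trans u₃ (trans (cong₂ _+_ (low r r<b) z₂) (ℕ.+-identityʳ _))) z₃) (ℕ.+-identityʳ _))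
  ... | no s≢r = trans (k₄ s (ℕ.<⇒≢ (ℕ.m<n⇒m<1+n h)) s≢r)
    (trans (k₃ s s≢r (ℕ.<⇒≢ h) (ℕ.<⇒≢ (ℕ.m<n⇒m<1+n h))) (low s h))

consecutive : ℕ → ∀ m → Vec ℕ m
consecutive b zero    = []
consecutive b (suc m) = b ∷ consecutive (suc b) m

-- compile f rs b reads its arguments in the registers rs, which lie below
-- b, leaves the value in b and works with the registers above.

mutual
  compile : ∀ {n} → Rec n → Vec ℕ n → ℕ → Cmd
  compile zeroᴿ rs b = clear b
  compile sucᴿ (r ∷ []) b = copying r b ⨾ inc b
  compile (proj i) rs b = copying (Vec.lookup rs i) b
  compile (comp {m} f gs) rs b =
    compileAll gs rs (suc b) ⨾ compile f (consecutive (suc b) m) (m + suc b) ⨾ clear b ⨾ move (m + suc b) b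
  -- `b` holds the value so far, `1 + b` the index of the round and `2 + b` the rounds still to go.
  compile (prec f g) (r ∷ rs) b = precStart f r rs b ⨾ loop (2 + b) (precBody g rs b)
  -- `b` holds the candidate; `1 + b` is a flag that the loop consumes and that must be raised again
  -- for another round.
  compile (mu f) rs b = (clear b ⨾ clear (1 + b) ⨾ inc (1 + b)) ⨾ loop (1 + b) (muBody f rs b)

  compileAll : ∀ {n m} → Vec (Rec n) m → Vec ℕ n → ℕ → Cmd
  -- This stands in for the empty command: arguments and results lie below `b`.
  compileAll [] rs b       = clear b
  compileAll (g ∷ gs) rs b = compile g rs b ⨾ compileAll gs rs (suc b)

  precStart : ∀ {n} → Rec n → ℕ → Vec ℕ n → ℕ → Cmd
  precStart f r rs b = compile f rs b ⨾ clear (1 + b) ⨾ copying r (2 + b)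

  precBody : ∀ {n} → Rec (suc (suc n)) → Vec ℕ n → ℕ → Cmd
  precBody g rs b = compile g (1 + b ∷ b ∷ rs) (3 + b) ⨾ clear b ⨾ move (3 + b) b ⨾ inc (1 + b)

  muBody : ∀ {n} → Rec (suc n) → Vec ℕ n → ℕ → Cmd
  -- The inner loop clears its own counter and so runs at most once, as a conditional on a nonzero
  -- value.
  muBody f rs b = compile f (b ∷ rs) (2 + b) ⨾ loop (2 + b) (clear (2 + b) ⨾ inc (1 + b) ⨾ inc b)

keep-args : ∀ {n b} {σ σ′ : State} (rs : Vec ℕ n) {xs : Vec ℕ n} → Allᵛ (_< b) rs → (∀ s → s < b → σ′ s ≡ σ s) →
            Vec.map σ rs ≡ xs → Vec.map σ′ rs ≡ xs
keep-args [] h k refl = refl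
keep-args (r ∷ rs) (h ∷ hs) k refl = cong₂ _∷_ (k r h) (keep-args rs hs k refl)

raise : ∀ {n b} {rs : Vec ℕ n} → Allᵛ (_< b) rs → Allᵛ (_< suc b) rs
raise = Allᵛ.map ℕ.m<n⇒m<1+n

consecutive-< : ∀ b m → Allᵛ (_< m + b) (consecutive b m)
consecutive-< b zero = []
consecutive-< b (suc m) = s≤s (ℕ.m≤n+m b m) ∷
  subst (λ c → Allᵛ (_< c) (consecutive (suc b) m)) (ℕ.+-suc m b) (consecutive-< (suc b) m)

mutual
  compile-exec : ∀ {n} (f : Rec n) {xs y} → f [ xs ]⇓ y → ∀ rs b σ → Allᵛ (_< b) rs →
                 Vec.map σ rs ≡ xs → Yields (compile f rs b) b y σ
  compile-exec zeroᴿ zeroᴿ rs b σ h e with clear-exec b σ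
  ... | σ′ , d , z , k = σ′ , d , z , λ s h → k s (ℕ.<⇒≢ h)
  compile-exec sucᴿ (sucᴿ {x}) (r ∷ []) b σ (h ∷ []) refl with copying-exec h σ
  ... | σ′ , d , v , k =
    σ′ [ b ≔ suc (σ′ b) ] , d ⨾ inc , trans (≔-same σ′ b _) (cong suc v) ,
    λ s s<b → trans (≔-other σ′ _ (ℕ.<⇒≢ s<b)) (k s s<b)
  compile-exec (proj i) (proj .i) rs b σ h refl with copying-exec (lookup⁺ h i) σ
  ... | σ′ , d , v , k = σ′ , d , trans v (sym (lookup-map i σ rs)) , k
  compile-exec (comp {m} f gs) (comp gs⇓ f⇓) rs b σ h e
    with compileAll-exec gs gs⇓ rs (suc b) σ (raise h) e
  ... | σ₁ , d₁ , v₁ , k₁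
    with compile-exec f f⇓ (consecutive (suc b) m) (m + suc b) σ₁ (consecutive-< (suc b) m) v₁
  ... | σ₂ , d₂ , v₂ , k₂ with clear-exec b σ₂
  ... | σ₃ , d₃ , z₃ , k₃ with move-exec {m + suc b} {b} (λ h → ℕ.<⇒≢ (ℕ.m≤n+m (suc b) m) (sym h)) σ₃
  ... | σ₄ , d₄ , z₄ , v₄ , k₄ =
    σ₄ , d₁ ⨾ d₂ ⨾ d₃ ⨾ d₄ ,
    trans v₄ (trans (cong₂ _+_ (trans (k₃ _ (λ h → ℕ.<⇒≢ (ℕ.m≤n+m (suc b) m) (sym h))) v₂) z₃) (ℕ.+-identityʳ _)) ,
    λ s s<b → trans (k₄ s (ℕ.<⇒≢ (ℕ.<-≤-trans (ℕ.m<n⇒m<1+n s<b) (ℕ.m≤n+m (suc b) m))) (ℕ.<⇒≢ s<b))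
      (trans (k₃ s (ℕ.<⇒≢ s<b))
        (trans (k₂ s (ℕ.<-≤-trans (ℕ.m<n⇒m<1+n s<b) (ℕ.m≤n+m (suc b) m))) (k₁ s (ℕ.m<n⇒m<1+n s<b))))
  compile-exec (prec f g) {k ∷ xs} p⇓ (r ∷ rs) b σ (h ∷ hs) e
    with iterate f g p⇓ r rs b 0 σ h hs (trans (cong Vec.head e) (sym (ℕ.+-identityʳ k))) (cong Vec.tail e)
  ... | σ′ , cont , v , i , c , keep = σ′ , cont (end c) , v , keep
  compile-exec (mu f) {xs} {y} (mu f0 below) rs b σ h e
    with clear-exec b σ
  ... | σ₁ , d₁ , z₁ , k₁ with clear-exec (1 + b) σ₁
  ... | σ₂ , d₂ , z₂ , k₂
    with search f rs b xs y y 0 f0 below (ℕ.+-identityʳ y) (σ₂ [ 1 + b ≔ suc (σ₂ (1 + b)) ]) h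
      (keep-args rs h (λ s s<b → trans (≔-other σ₂ _ (ℕ.<⇒≢ (ℕ.m<n⇒m<1+n s<b)))
        (trans (k₂ s (ℕ.<⇒≢ (ℕ.m<n⇒m<1+n s<b))) (k₁ s (ℕ.<⇒≢ s<b)))) e)
      (trans (≔-other σ₂ _ (ℕ.<⇒≢ (ℕ.n<1+n b))) (trans (k₂ b (ℕ.<⇒≢ (ℕ.n<1+n b))) z₁))
      (trans (≔-same σ₂ (1 + b) _) (cong suc z₂))
  ... | σ′ , d , v , keep =
    σ′ , (d₁ ⨾ d₂ ⨾ inc) ⨾ d , v ,
    λ s s<b → trans (keep s s<b) (trans (≔-other σ₂ _ (ℕ.<⇒≢ (ℕ.m<n⇒m<1+n s<b)))
        (trans (k₂ s (ℕ.<⇒≢ (ℕ.m<n⇒m<1+n s<b))) (k₁ s (ℕ.<⇒≢ s<b))))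

  compileAll-exec : ∀ {n m} (gs : Vec (Rec n) m) {xs ys} → Pointwise (λ g y → g [ xs ]⇓ y) gs ys →
                    ∀ rs b σ → Allᵛ (_< b) rs → Vec.map σ rs ≡ xs →
                    ∃[ σ′ ] Exec (compileAll gs rs b) σ σ′ × Vec.map σ′ (consecutive b m) ≡ ys ×
                      (∀ s → s < b → σ′ s ≡ σ s)
  compileAll-exec [] [] rs b σ h e with clear-exec b σ
  ... | σ′ , d , z , k = σ′ , d , refl , λ s h → k s (ℕ.<⇒≢ h)
  compileAll-exec (g ∷ gs) (p ∷ ps) rs b σ h e with compile-exec g p rs b σ h e
  ... | σ₁ , d₁ , v₁ , k₁ with compileAll-exec gs ps rs (suc b) σ₁ (raise h) (keep-args rs h k₁ e)
  ... | σ₂ , d₂ , v₂ , k₂ =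
    σ₂ , d₁ ⨾ d₂ , cong₂ _∷_ (trans (k₂ b (ℕ.n<1+n b)) v₁) v₂ ,
    λ s s<b → trans (k₂ s (ℕ.m<n⇒m<1+n s<b)) (k₁ s s<b)

  -- The state after k of k + j rounds.

  iterate : ∀ {n} (f : Rec n) g {k xs y} → prec f g [ k ∷ xs ]⇓ y →
            ∀ r rs b j σ → r < b → Allᵛ (_< b) rs → σ r ≡ k + j → Vec.map σ rs ≡ xs →
            ∃[ σ′ ] (∀ {σ″} → Exec (loop (2 + b) (precBody g rs b)) σ′ σ″ →
                     Exec (compile (prec f g) (r ∷ rs) b) σ σ″) ×
              σ′ b ≡ y × σ′ (1 + b) ≡ k × σ′ (2 + b) ≡ j × (∀ s → s < b → σ′ s ≡ σ s)
  iterate f g (prec₀ f⇓) r rs b j σ h hs e es with compile-exec f f⇓ rs b σ hs es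
  ... | σ₁ , d₁ , v₁ , k₁ with clear-exec (1 + b) σ₁
  ... | σ₂ , d₂ , z₂ , k₂ with copying-exec {r} {2 + b} (ℕ.m<n⇒m<1+n (ℕ.m<n⇒m<1+n h)) σ₂
  ... | σ₃ , d₃ , v₃ , k₃ =
    σ₃ , (λ l → (d₁ ⨾ d₂ ⨾ d₃) ⨾ l) ,
    trans (k₃ b (ℕ.m<n⇒m<1+n (ℕ.n<1+n b))) (trans (k₂ b (ℕ.<⇒≢ (ℕ.n<1+n b))) v₁) ,
    trans (k₃ (1 + b) (ℕ.n<1+n (1 + b))) z₂ ,
    trans v₃ (trans (k₂ r (ℕ.<⇒≢ (ℕ.m<n⇒m<1+n h))) (trans (k₁ r h) e)) ,
    λ s s<b → trans (k₃ s (ℕ.m<n⇒m<1+n (ℕ.m<n⇒m<1+n s<b)))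
      (trans (k₂ s (ℕ.<⇒≢ (ℕ.m<n⇒m<1+n s<b))) (k₁ s s<b))
  iterate f g {suc k} (precₛ p⇓ g⇓) r rs b j σ h hs e es
    with iterate f g p⇓ r rs b (suc j) σ h hs (trans e (sym (ℕ.+-suc k j))) es
  ... | σ₁ , cont , v₁ , i₁ , c₁ , k₁
    with compile-exec g g⇓ (1 + b ∷ b ∷ rs) (3 + b) (σ₁ [ 2 + b ≔ j ])
      (ℕ.m<n⇒m<1+n (ℕ.n<1+n (1 + b)) ∷ ℕ.m<n⇒m<1+n (ℕ.m<n⇒m<1+n (ℕ.n<1+n b)) ∷ raise (raise (raise hs)))
      (cong₂ _∷_ (trans (≔-other σ₁ j (ℕ.<⇒≢ (ℕ.n<1+n (1 + b)))) i₁)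
        (cong₂ _∷_ (trans (≔-other σ₁ j (ℕ.<⇒≢ (ℕ.m<n⇒m<1+n (ℕ.n<1+n b)))) v₁)
          (keep-args rs hs (λ s s<b → trans (≔-other σ₁ j (ℕ.<⇒≢ (ℕ.m<n⇒m<1+n (ℕ.m<n⇒m<1+n s<b)))) (k₁ s s<b)) es)))
  ... | σ₂ , d₂ , v₂ , k₂ with clear-exec b σ₂
  ... | σ₃ , d₃ , z₃ , k₃
    with move-exec {3 + b} {b} (λ q → ℕ.<⇒≢ (ℕ.m<n⇒m<1+n (ℕ.m<n⇒m<1+n (ℕ.n<1+n b))) (sym q)) σ₃
  ... | σ₄ , d₄ , z₄ , v₄ , k₄ =
    σ₄ [ 1 + b ≔ suc (σ₄ (1 + b)) ] ,
    -- Evaluations of `prec` end with the last round, executions of a loop start with the first; the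
    -- continuation appends a round to those already run.
    (λ l → cont (more c₁ (d₂ ⨾ d₃ ⨾ d₄ ⨾ inc) l)) ,
    trans (≔-other σ₄ _ (ℕ.<⇒≢ (ℕ.n<1+n b)))
      (trans v₄ (trans (cong₂ _+_ (trans (k₃ _ 3+b≢b) v₂) z₃) (ℕ.+-identityʳ _))) ,
    trans (≔-same σ₄ (1 + b) _) (cong suc (trans
      (high (1 + b) (ℕ.<⇒≢ (ℕ.m<n⇒m<1+n (ℕ.n<1+n (1 + b)))) 1+b≢b (ℕ.m<n⇒m<1+n (ℕ.n<1+n (1 + b))))
      (trans (≔-other σ₁ j (ℕ.<⇒≢ (ℕ.n<1+n (1 + b)))) i₁))) ,
    trans (≔-other σ₄ _ (λ q → ℕ.<⇒≢ (ℕ.n<1+n (1 + b)) (sym q)))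
      (trans (high (2 + b) (ℕ.<⇒≢ (ℕ.n<1+n (2 + b))) (λ q → ℕ.<⇒≢ (ℕ.m<n⇒m<1+n (ℕ.n<1+n b)) (sym q)) (ℕ.n<1+n (2 + b)))
        (≔-same σ₁ (2 + b) j)) ,
    λ s s<b → trans (≔-other σ₄ _ (ℕ.<⇒≢ (ℕ.m<n⇒m<1+n s<b)))
      (trans (high s (ℕ.<⇒≢ (low3 s<b)) (ℕ.<⇒≢ s<b) (low3 s<b))
        (trans (≔-other σ₁ j (ℕ.<⇒≢ (ℕ.m<n⇒m<1+n (ℕ.m<n⇒m<1+n s<b)))) (k₁ s s<b)))
    where
    low3 : ∀ {s} → s < b → s < 3 + b
    low3 h = ℕ.m<n⇒m<1+n (ℕ.m<n⇒m<1+n (ℕ.m<n⇒m<1+n h))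
    1+b≢b : 1 + b ≢ b
    1+b≢b q = ℕ.<⇒≢ (ℕ.n<1+n b) (sym q)
    3+b≢b : 3 + b ≢ b
    3+b≢b q = ℕ.<⇒≢ (ℕ.m<n⇒m<1+n (ℕ.m<n⇒m<1+n (ℕ.n<1+n b))) (sym q)
    high : ∀ s → s ≢ 3 + b → s ≢ b → s < 3 + b → σ₄ s ≡ (σ₁ [ 2 + b ≔ j ]) s
    high s p q h = trans (k₄ s p q) (trans (k₃ s q) (k₂ s h))

  -- Induction on the distance `d` from the candidate `i` to the least zero `y`, with the flag
  -- raised.
  search : ∀ {n} (f : Rec (suc n)) rs b xs y d i → f [ y ∷ xs ]⇓ 0 → (∀ i → i < y → ∃[ v ] f [ i ∷ xs ]⇓ suc v) →
           d + i ≡ y → ∀ σ → Allᵛ (_< b) rs → Vec.map σ rs ≡ xs → σ b ≡ i → σ (1 + b) ≡ 1 →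
           Yields (loop (1 + b) (muBody f rs b)) b y σ
  search f rs b xs y zero .y f0 below refl σ h e bi fl
    with compile-exec f f0 (b ∷ rs) (2 + b) (σ [ 1 + b ≔ 0 ])
      (ℕ.m<n⇒m<1+n (ℕ.n<1+n b) ∷ raise (raise h))
      (cong₂ _∷_ (trans (≔-other σ 0 (ℕ.<⇒≢ (ℕ.n<1+n b))) bi)
        (keep-args rs h (λ s s<b → ≔-other σ 0 (ℕ.<⇒≢ (ℕ.m<n⇒m<1+n s<b))) e))
  ... | σ₁ , d₁ , v₁ , k₁ =
    σ₁ , more fl (d₁ ⨾ end v₁) (end (trans (k₁ (1 + b) (ℕ.n<1+n (1 + b))) (≔-same σ (1 + b) 0))) ,
    trans (k₁ b (ℕ.m<n⇒m<1+n (ℕ.n<1+n b))) (trans (≔-other σ 0 (ℕ.<⇒≢ (ℕ.n<1+n b))) bi) ,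
    λ s s<b → trans (k₁ s (ℕ.m<n⇒m<1+n (ℕ.m<n⇒m<1+n s<b))) (≔-other σ 0 (ℕ.<⇒≢ (ℕ.m<n⇒m<1+n s<b)))
  search f rs b xs y (suc d) i f0 below refl σ h e bi fl
    with below i (s≤s (ℕ.m≤n+m i d))
  ... | v , f⇓
    with compile-exec f f⇓ (b ∷ rs) (2 + b) (σ [ 1 + b ≔ 0 ])
      (ℕ.m<n⇒m<1+n (ℕ.n<1+n b) ∷ raise (raise h))
      (cong₂ _∷_ (trans (≔-other σ 0 (ℕ.<⇒≢ (ℕ.n<1+n b))) bi)
        (keep-args rs h (λ s s<b → ≔-other σ 0 (ℕ.<⇒≢ (ℕ.m<n⇒m<1+n s<b))) e))
  ... | σ₁ , d₁ , v₁ , k₁ with clear-exec (2 + b) (σ₁ [ 2 + b ≔ v ])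
  ... | σ₂ , d₂ , z₂ , k₂ =
    let σ₃ = σ₂ [ 1 + b ≔ suc (σ₂ (1 + b)) ]
        σ₄ = σ₃ [ b ≔ suc (σ₃ b) ]
        old : ∀ s → s < 2 + b → σ₂ s ≡ (σ [ 1 + b ≔ 0 ]) s
        old s p = trans (k₂ s (ℕ.<⇒≢ p)) (trans (≔-other σ₁ v (ℕ.<⇒≢ p)) (k₁ s p))
        keep : ∀ s → s < b → σ₄ s ≡ σ s
        keep s p = trans (≔-other σ₃ _ (ℕ.<⇒≢ p)) (trans (≔-other σ₂ _ (ℕ.<⇒≢ (ℕ.m<n⇒m<1+n p)))
          (trans (old s (ℕ.m<n⇒m<1+n (ℕ.m<n⇒m<1+n p))) (≔-other σ 0 (ℕ.<⇒≢ (ℕ.m<n⇒m<1+n p)))))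
        (σ′ , d₅ , v₅ , k₅) = search f rs b xs y d (suc i) f0 below (ℕ.+-suc d i) σ₄ h
          (keep-args rs h keep e)
          (trans (≔-same σ₃ b _) (cong suc (trans (≔-other σ₂ _ (ℕ.<⇒≢ (ℕ.n<1+n b)))
            (trans (old b (ℕ.m<n⇒m<1+n (ℕ.n<1+n b))) (trans (≔-other σ 0 (ℕ.<⇒≢ (ℕ.n<1+n b))) bi)))))
          (trans (≔-other σ₃ _ (λ q → ℕ.<⇒≢ (ℕ.n<1+n b) (sym q)))
            (trans (≔-same σ₂ (1 + b) _) (cong suc (trans (old (1 + b) (ℕ.n<1+n (1 + b))) (≔-same σ (1 + b) 0)))))
    in σ′ ,
       more fl
         (d₁ ⨾ more v₁ (d₂ ⨾ inc ⨾ inc)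
           (end (trans (≔-other σ₃ _ (λ q → ℕ.<⇒≢ (ℕ.m<n⇒m<1+n (ℕ.n<1+n b)) (sym q)))
             (trans (≔-other σ₂ _ (λ q → ℕ.<⇒≢ (ℕ.n<1+n (1 + b)) (sym q))) z₂)))) d₅ ,
       v₅ , λ s p → trans (k₅ s p) (keep s p)

-- Computing the code of an instance recursively.

litᴿ : ∀ {n} → ℕ → Rec n
litᴿ zero    = comp zeroᴿ []
litᴿ (suc k) = comp sucᴿ (litᴿ k ∷ [])

litᴿ⇓ : ∀ {n} k {xs : Vec ℕ n} → litᴿ k [ xs ]⇓ k
litᴿ⇓ zero    = comp [] zeroᴿ
litᴿ⇓ (suc k) = comp (litᴿ⇓ k ∷ []) sucᴿ

addᴿ : Rec 2
addᴿ = prec (proj zero) (comp sucᴿ (proj (suc zero) ∷ []))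

addᴿ⇓ : ∀ x y → addᴿ [ x ∷ y ∷ [] ]⇓ x + y
addᴿ⇓ zero y    = prec₀ (proj zero)
addᴿ⇓ (suc x) y = precₛ (addᴿ⇓ x y) (comp (proj (suc zero) ∷ []) sucᴿ)

triangleᴿ : Rec 1
triangleᴿ = prec (litᴿ 0) (comp addᴿ (comp sucᴿ (proj zero ∷ []) ∷ proj (suc zero) ∷ []))

triangleᴿ⇓ : ∀ x → triangleᴿ [ x ∷ [] ]⇓ triangle x
triangleᴿ⇓ zero    = prec₀ (litᴿ⇓ 0)
triangleᴿ⇓ (suc x) =
  precₛ (triangleᴿ⇓ x) (comp (comp (proj zero ∷ []) sucᴿ ∷ proj (suc zero) ∷ []) (addᴿ⇓ (suc x) (triangle x)))

-- An opaque copy of pair, since unifying against unfolded values of pair is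
-- expensive.

opaque
  ⟨_,_⟩ : ℕ → ℕ → ℕ
  ⟨ x , y ⟩ = pair x y

  pair≡⟨⟩ : ∀ x y → pair x y ≡ ⟨ x , y ⟩
  pair≡⟨⟩ x y = refl

pairᴿ : ∀ {n} → Rec n → Rec n → Rec n
pairᴿ f g = comp (comp addᴿ (comp triangleᴿ (addᴿ ∷ []) ∷ proj (suc zero) ∷ [])) (f ∷ g ∷ [])

pairᴿ⇓ : ∀ {n f g x y} {xs : Vec ℕ n} → f [ xs ]⇓ x → g [ xs ]⇓ y → pairᴿ f g [ xs ]⇓ ⟨ x , y ⟩
pairᴿ⇓ {f = f} {g} {x} {y} {xs} p q = subst (pairᴿ f g [ xs ]⇓_) (pair≡⟨⟩ x y)
  (comp (p ∷ q ∷ [])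
    (comp (comp (addᴿ⇓ x y ∷ []) (triangleᴿ⇓ (x + y)) ∷ proj (suc zero) ∷ []) (addᴿ⇓ (triangle (x + y)) y)))

-- The code of con X · P, where X has number m and P has code p.

push : ℕ → ℕ → ℕ
push m p = ⟨ 2 , ⟨ ⟨ 1 , m ⟩ , p ⟩ ⟩

pushᴿ : ∀ {n} → ℕ → Rec n → Rec n
pushᴿ m f = pairᴿ (litᴿ 2) (pairᴿ (pairᴿ (litᴿ 1) (litᴿ m)) f)

pushᴿ⇓ : ∀ {n} m {f x} {xs : Vec ℕ n} → f [ xs ]⇓ x → pushᴿ m f [ xs ]⇓ push m x
pushᴿ⇓ m p = pairᴿ⇓ (litᴿ⇓ 2) (pairᴿ⇓ (pairᴿ⇓ (litᴿ⇓ 1) (litᴿ⇓ m)) p)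

pushes : ℕ → ℕ → ℕ → ℕ
pushes m zero    p = p
pushes m (suc k) p = push m (pushes m k p)

pushesᴿ : ∀ {n} → ℕ → Rec n → Rec n → Rec n
pushesᴿ m f g = comp (prec (proj zero) (pushᴿ m (proj (suc zero)))) (f ∷ g ∷ [])

pushesᴿ⇓ : ∀ {n} m {f g k x} {xs : Vec ℕ n} → f [ xs ]⇓ k → g [ xs ]⇓ x →
           pushesᴿ m f g [ xs ]⇓ pushes m k x
pushesᴿ⇓ m {k = k} {x} p q = comp (p ∷ q ∷ []) (go k)
  where
  go : ∀ k → prec (proj zero) (pushᴿ m (proj (suc zero))) [ k ∷ x ∷ [] ]⇓ pushes m k x
  go zero    = prec₀ (proj zero)
  go (suc k) = precₛ (go k) (pushᴿ⇓ m (proj (suc zero)))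

-- The code of the instance whose algebra has x constants and whose rules
-- other than the first one have code y.

instanceCode : ℕ → ℕ → ℕ
instanceCode x y =
  -- Numbers of constants: 3 is `nt nothing`, 2 is `K`, and 4 to 7 are the marks `mz`, `ma` of
  -- registers 0 and 1. The action 1 is the successor of the number 0 of `TU`, as 0 is silent. The
  -- final pairs code `TV` and `TU`.
  ⟨ ⟨ x , ⟨ x , suc ⟨ ⟨ 3 , ⟨ 1 , push 2 (push 4 (pushes 5 x (push 6 (pushes 7 y ⟨ 0 , 0 ⟩)))) ⟩ ⟩ , y ⟩ ⟩ ⟩ ,
    ⟨ ⟨ 1 , 1 ⟩ , ⟨ 1 , 0 ⟩ ⟩ ⟩

instanceCodeᴿ : Rec 2
instanceCodeᴿ =
  pairᴿ
    (pairᴿ x (pairᴿ x (comp sucᴿ (pairᴿ (pairᴿ (litᴿ 3) (pairᴿ (litᴿ 1)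
      (pushᴿ 2 (pushᴿ 4 (pushesᴿ 5 x (pushᴿ 6 (pushesᴿ 7 y (pairᴿ (litᴿ 0) (litᴿ 0))))))))) y ∷ []))))
    (pairᴿ (pairᴿ (litᴿ 1) (litᴿ 1)) (pairᴿ (litᴿ 1) (litᴿ 0)))
  where
  x y : Rec 2
  x = proj zero
  y = proj (suc zero)

instanceCodeᴿ⇓ : ∀ x y → instanceCodeᴿ [ x ∷ y ∷ [] ]⇓ instanceCode x y
instanceCodeᴿ⇓ x y =
  pairᴿ⇓
    (pairᴿ⇓ (proj zero) (pairᴿ⇓ (proj zero) (comp (pairᴿ⇓ (pairᴿ⇓ (litᴿ⇓ 3) (pairᴿ⇓ (litᴿ⇓ 1)
      (pushᴿ⇓ 2 (pushᴿ⇓ 4 (pushesᴿ⇓ 5 (proj zero) (pushᴿ⇓ 6 (pushesᴿ⇓ 7 (proj (suc zero)) (pairᴿ⇓ (litᴿ⇓ 0) (litᴿ⇓ 0)))))))))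
      (proj (suc zero)) ∷ []) sucᴿ)))
    (pairᴿ⇓ (pairᴿ⇓ (litᴿ⇓ 1) (litᴿ⇓ 1)) (pairᴿ⇓ (litᴿ⇓ 1) (litᴿ⇓ 0)))

codeRule : ∀ {c v} → Fin c × Fin (suc v) × Process c → ℕ
codeRule (X , ℓ , P) = ⟨ toℕ X , ⟨ toℕ ℓ , codeProcess P ⟩ ⟩

codeList-cong : ∀ {A : Set} {f g : A → ℕ} → (∀ x → f x ≡ g x) → ∀ xs → codeList f xs ≡ codeList g xs
codeList-cong e []       = refl
codeList-cong e (x ∷ xs) = cong suc (cong₂ pair (e x) (codeList-cong e xs))

opaque
  unfolding ⟨_,_⟩

  codeList-∷ : ∀ {A : Set} (f : A → ℕ) x xs → codeList f (x ∷ xs) ≡ suc ⟨ f x , codeList f xs ⟩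
  codeList-∷ f x xs = refl

  codeProcess-ε : ∀ {c} → codeProcess {c} ε ≡ ⟨ 0 , 0 ⟩
  codeProcess-ε = refl

  codeProcess-con : ∀ {c} (X : Fin c) → codeProcess (con X) ≡ ⟨ 1 , toℕ X ⟩
  codeProcess-con X = refl

  codeProcess-push : ∀ {c} (X : Fin c) P → codeProcess (con X · P) ≡ push (toℕ X) (codeProcess P)
  codeProcess-push X P = refl

  codePA-codeRule : ∀ Γ → codePA Γ ≡
    ⟨ PA.#constants Γ , ⟨ PA.#visible Γ , codeList codeRule (PA.rules Γ) ⟩ ⟩
  codePA-codeRule Γ =
    cong (λ x → pair (PA.#constants Γ) (pair (PA.#visible Γ) x)) (codeList-cong (λ _ → refl) (PA.rules Γ))

  codeInstance-⟨⟩ : ∀ i → codeInstance i ≡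
    ⟨ codePA (Instance.Γ i) , ⟨ codeProcess (Instance.P i) , codeProcess (Instance.Q i) ⟩ ⟩
  codeInstance-⟨⟩ i = refl

-- The diagonal argument.

-- The base case does useful work: register 0 holds input and has to be cleared as well.
clearRange : ℕ → ℕ → Cmd
clearRange b zero    = clear 0
clearRange b (suc k) = clear b ⨾ clearRange (suc b) k

clearRange-exec : ∀ k b σ → 0 < b →
                  ∃[ σ′ ] Exec (clearRange b k) σ σ′ × σ′ 0 ≡ 0 ×
                    (∀ s → 0 < s → s < b → σ′ s ≡ σ s) × (∀ s → b ≤ s → s < b + k → σ′ s ≡ 0)
clearRange-exec zero b σ 0<b with clear-exec 0 σ
... | σ′ , d , z , keep =
  σ′ , d , z , (λ s 0<s _ → keep s (λ e → ℕ.<⇒≢ 0<s (sym e))) ,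
  λ s p q → ⊥-elim (ℕ.<-irrefl refl (ℕ.≤-<-trans p (subst (s <_) (ℕ.+-identityʳ b) q)))
clearRange-exec (suc k) b σ 0<b with clear-exec b σ
... | σ₁ , d₁ , z₁ , k₁ with clearRange-exec k (suc b) σ₁ (s≤s z≤n)
... | σ₂ , d₂ , z₂ , k₂ , c₂ =
  σ₂ , d₁ ⨾ d₂ , z₂ ,
  (λ s 0<s s<b → trans (k₂ s 0<s (ℕ.m<n⇒m<1+n s<b)) (k₁ s (ℕ.<⇒≢ s<b))) ,
  λ s b≤s s<b+k → cleared s (ℕ.m≤n⇒m<n∨m≡n b≤s) s<b+k
  where
  cleared : ∀ s → b < s ⊎ b ≡ s → s < b + suc k → σ₂ s ≡ 0
  cleared s (inj₁ b<s) q = c₂ s b<s (subst (s <_) (ℕ.+-suc b k) q)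
  cleared s (inj₂ refl) q = trans (k₂ b 0<b (ℕ.n<1+n b)) z₁

clearRange-within : ∀ k b {n} → 0 < n → b + k ≤ n → Within n (clearRange b k)
clearRange-within zero b h p = h , h
clearRange-within (suc k) b {n} h p = (b<n , b<n) , clearRange-within k (suc b) h (subst (_≤ n) (ℕ.+-suc b k) p)
  where
  b<n : b < n
  b<n = ℕ.≤-trans (s≤s (ℕ.m≤m+n b k)) (subst (_≤ n) (ℕ.+-suc b k) p)

mapᴵ-id : ∀ {A : Set} (i : Instr A) → i ≡ mapᴵ (λ x → x) i
mapᴵ-id (inc r q)    = refl
mapᴵ-id (test r q p) = refl
mapᴵ-id stop         = refl

-- The machine cannot contain the code of its own instance; it receives as
-- input the two numbers from which instanceCode computes it.

module Diagonal (f : Rec 1) where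

  opaque
    main : Cmd
    main = compile (comp f (instanceCodeᴿ ∷ [])) (0 ∷ 1 ∷ []) 2

    main-exec : ∀ {σ x y v} → σ 0 ≡ x → σ 1 ≡ y → f [ instanceCode x y ∷ [] ]⇓ v → Yields main 2 v σ
    main-exec {σ} {x} {y} x≡ y≡ f⇓ =
      compile-exec (comp f (instanceCodeᴿ ∷ [])) (comp (instanceCodeᴿ⇓ x y ∷ []) f⇓)
        (0 ∷ 1 ∷ []) 2 σ (s≤s z≤n ∷ s≤s (s≤s z≤n) ∷ []) (cong₂ (λ x y → x ∷ y ∷ []) x≡ y≡)

  -- With it the machine gets `3 + spare` registers: the two inputs, the result, and exactly those
  -- that `clearRange 3 spare` clears. They include all that `main` tests.
  spare : ℕ
  spare = width main

  -- The tiling prescribes the whole final configuration, so everything but the result in register 2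
  -- is cleared.
  program : Cmd
  program = main ⨾ clear 1 ⨾ clearRange 3 spare

  goal : State
  goal 2 = 1
  goal _ = 0

  Q : Set
  Q = Maybe (Label program)

  instr : Q → Instr Q
  instr nothing  = stop
  instr (just l) = code program l

  states : List Q
  states = nothing ∷ map just (labels program)

  state∈ : ∀ q → q ∈ states
  state∈ nothing  = here refl
  state∈ (just l) = there (∈-map⁺ just (label∈ program l))

  open Errors states state∈ instr (suc spare) (just (entry program)) nothing refl goal
  open Running instr n nothing refl goal using (exec-solvable; ⟺-trans)

  -- The fixed rules depend on the machine but not on its input, so their code can serve as that
  -- input without circularity.
  ρ : ℕ
  ρ = codeList codeRule fixedRules

  open System (init N ρ)

  self : Instance
  self = record { Γ = Γ ; normed = normed ; P = ctlP TV ; Q = ctlP TU }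

  block : ∀ r {c d} → toℕ (enc (stk (ltr (sym′ (reg r) (mark mz))))) ≡ c →
          toℕ (enc (stk (ltr (sym′ (reg r) (mark ma))))) ≡ d → ∀ x v →
          codeProcess ⟦ map ltr (map (sym′ (reg r)) (marks (counter x))) ++ v ⟧ ≡
          push c (pushes d x (codeProcess ⟦ v ⟧))
  block r {c} {d} e h x v =
    trans (codeProcess-push _ ⟦ map ltr (map (sym′ (reg r)) (marks (replicate x ma))) ++ v ⟧)
      (cong₂ push e (go x))
    where
    go : ∀ x → codeProcess ⟦ map ltr (map (sym′ (reg r)) (marks (replicate x ma))) ++ v ⟧ ≡
         pushes d x (codeProcess ⟦ v ⟧)
    go zero    = refl
    go (suc x) =
      trans (codeProcess-push _ ⟦ map ltr (map (sym′ (reg r)) (marks (replicate x ma))) ++ v ⟧)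
        (cong₂ push h (go x))

  codeProcess-init : ∀ x y → codeProcess ⟦ map ltr (init x y) ⟧ ≡
                     push 4 (pushes 5 x (push 6 (pushes 7 y ⟨ 0 , 0 ⟩)))
  codeProcess-init x y = begin
    codeProcess ⟦ map ltr (u ++ v) ⟧
      ≡⟨ cong (λ w → codeProcess ⟦ w ⟧) (map-++ ltr u v) ⟩
    codeProcess ⟦ map ltr u ++ map ltr v ⟧
      ≡⟨ block r₀ (toℕ-ltr (sym′ (reg r₀) (mark mz))) (toℕ-ltr (sym′ (reg r₀) (mark ma)))
           x (map ltr v) ⟩
    push 4 (pushes 5 x (codeProcess ⟦ map ltr v ⟧))
      ≡⟨ cong (λ w → push 4 (pushes 5 x (codeProcess ⟦ w ⟧))) (++-identityʳ (map ltr v)) ⟨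
    push 4 (pushes 5 x (codeProcess ⟦ map ltr v ++ [] ⟧))
      ≡⟨ cong (λ p → push 4 (pushes 5 x p))
           (block r₁ (toℕ-ltr (sym′ (reg r₁) (mark mz))) (toℕ-ltr (sym′ (reg r₁) (mark ma))) y []) ⟩
    push 4 (pushes 5 x (push 6 (pushes 7 y (codeProcess ⟦ [] ⟧))))
      ≡⟨ cong (λ p → push 4 (pushes 5 x (push 6 (pushes 7 y p)))) (codeProcess-ε {N}) ⟩
    push 4 (pushes 5 x (push 6 (pushes 7 y ⟨ 0 , 0 ⟩))) ∎
    where
    open ≡-Reasoning
    u = map (sym′ (reg r₀)) (marks (counter x))
    v = map (sym′ (reg r₁)) (marks (counter y))

  codeInstance-self : codeInstance self ≡ instanceCode N ρ
  codeInstance-self =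
    trans (codeInstance-⟨⟩ self)
      (cong₂ ⟨_,_⟩
        (trans (codePA-codeRule Γ)
          (cong (λ x → ⟨ N , ⟨ N , x ⟩ ⟩)
            (trans (codeList-∷ codeRule (enc (stk (nt nothing)) , ⌜ vis (ctl TU) ⌝ , ⟦ K ∷ map ltr (init N ρ) ⟧) fixedRules)
              (cong (λ x → suc ⟨ x , ρ ⟩)
                (cong₂ ⟨_,_⟩ toℕ-nothing
                  (cong₂ (λ x p → ⟨ suc x , p ⟩) toℕ-TU
                    (trans (codeProcess-push (enc (stk K)) ⟦ map ltr (init N ρ) ⟧) (cong₂ push toℕ-K (codeProcess-init N ρ)))))))))
        (cong₂ ⟨_,_⟩
          (trans (codeProcess-con (enc (ctl TV))) (cong ⟨ 1 ,_⟩ toℕ-TV))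
          (trans (codeProcess-con (enc (ctl TU))) (cong ⟨ 1 ,_⟩ toℕ-TU))))

  recode : ∀ {v} → f [ codeInstance self ∷ [] ]⇓ v → f [ instanceCode N ρ ∷ [] ]⇓ v
  recode {v} = subst (λ c → f [ c ∷ [] ]⇓ v) codeInstance-self

  run-program : ∀ x y {v} → f [ instanceCode x y ∷ [] ]⇓ v →
                ∃[ σ ] Exec program (input x y) σ × σ 2 ≡ v × (∀ s → s < n → s ≢ 2 → σ s ≡ 0)
  run-program x y f⇓
    with main-exec {input x y} refl refl f⇓
  ... | σ₁ , d₁ , v₁ , _ with clear-exec 1 σ₁
  ... | σ₂ , d₂ , z₂ , k₂ with clearRange-exec spare 3 σ₂ (s≤s z≤n)
  ... | σ₃ , d₃ , z₃ , k₃ , c₃ =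
    σ₃ , d₁ ⨾ d₂ ⨾ d₃ ,
    trans (k₃ 2 (s≤s z≤n) (s≤s (s≤s (s≤s z≤n)))) (trans (k₂ 2 (λ ())) v₁) , zeros
    where
    zeros : ∀ s → s < n → s ≢ 2 → σ₃ s ≡ 0
    zeros 0 p q = z₃
    zeros 1 p q = trans (k₃ 1 (s≤s z≤n) (s≤s (s≤s z≤n))) z₂
    zeros 2 p q = ⊥-elim (q refl)
    zeros (suc (suc (suc s))) p q = c₃ _ (s≤s (s≤s (s≤s z≤n))) p

  -- A value of `f`, whichever it is, gives a halting run, along which solvability reduces to
  -- comparing the last state with `goal`.
  solvable-run : ∀ x y {v} → f [ instanceCode x y ∷ [] ]⇓ v →
                 ∃[ σ ] (Solvable (just (entry program)) (input x y) ⟺ (∀ (i : Fin n) → σ (toℕ i) ≡ goal (toℕ i))) ×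
                   σ 2 ≡ v × (∀ s → s < n → s ≢ 2 → σ s ≡ 0)
  solvable-run x y f⇓ with run-program x y f⇓
  ... | σ , d , v , zeros =
    σ , ⟺-trans (exec-solvable d bounds (λ q → q) (λ l → mapᴵ-id (code program l))) solvable-end , v , zeros
    where
    bounds : Within n program
    bounds = within main (ℕ.m≤n+m spare 3) , (s≤s (s≤s z≤n) , s≤s (s≤s z≤n)) ,
             clearRange-within spare 3 (s≤s z≤n) ℕ.≤-refl

  accepts⇒solvable : ∀ x y → f [ instanceCode x y ∷ [] ]⇓ 1 → Solvable (just (entry program)) (input x y)
  accepts⇒solvable x y f⇓ with solvable-run x y f⇓
  ... | σ , (_ , from) , v , zeros = from (λ i → final (toℕ i) (Fin.toℕ<n i))
    where
    final : ∀ s → s < n → σ s ≡ goal s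
    final 0 p = zeros 0 p (λ ())
    final 1 p = zeros 1 p (λ ())
    final 2 p = v
    final (suc (suc (suc s))) p = zeros _ p (λ ())

  rejects⇒unsolvable : ∀ x y → f [ instanceCode x y ∷ [] ]⇓ 0 → Solvable (just (entry program)) (input x y) → ⊥
  rejects⇒unsolvable x y f⇓ s with solvable-run x y f⇓
  ... | σ , (to , _) , v , _ with trans (sym v) (to s (suc (suc zero)))
  ... | ()

  -- No case distinction on `R` is made: `R` is refuted first, the refutation makes `f` answer 0,
  -- and the resulting unsolvability proves `R` after all.
  fooled : ∀ {ℓ : Level} (R : Set ℓ) → (Γ ⊢ ctlP TV ≃ ctlP TU → R) → (R → Γ ⊢ ctlP TV ≈ ctlP TU) →
           (R → f [ instanceCode N ρ ∷ [] ]⇓ 1) → ((R → ⊥) → f [ instanceCode N ρ ∷ [] ]⇓ 0) → ⊥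
  fooled R ≃⇒R R⇒≈ yes⇓ no⇓ = not-R (≃⇒R (Similarity.covered⇒≃ grammar (init N ρ)
    (unsolvable⇒covered N ρ (rejects⇒unsolvable N ρ (no⇓ not-R)))))
    where
    not-R : R → ⊥
    not-R r = covered⇒unsolvable N ρ (Dissimilarity.≈⇒covered grammar (init N ρ) (R⇒≈ r))
      (accepts⇒solvable N ρ (yes⇓ r))

theorem2 : {ℓ : Level} (R : (Γ : PA) → Rel (PA.Proc Γ) ℓ) →
    (∀ Γ → Normed Γ → (Γ ⊢_≃_) ⇒ R Γ) →
    (∀ Γ → Normed Γ → R Γ ⇒ (Γ ⊢_≈_)) →
    Undecidable codeInstance
    (λ i → R (Instance.Γ i) (Instance.P i) (Instance.Q i))
theorem2 R ≃⇒R R⇒≈ (f , decides) =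
  fooled (R _ _ _) (≃⇒R _ (Instance.normed self)) (R⇒≈ _ (Instance.normed self))
    (λ r → recode (proj₁ (decides self) r)) (λ ¬r → recode (proj₂ (decides self) ¬r))
  where open Diagonal f
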